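{- Let $n\ge 2$, $c\in\mathbb{Z}_+^n$, and let $K=K(c)$ be the $A_n$-crystal with parameter $c$. Let $a\in\mathcal{B}(c)$, let $K^{\uparrow}[a]$ be the upper subcrystal of $K$ containing the principal vertex $\pi[a]$, let $h^{\uparrow}$ be the coordinate of $\pi[a]$ in the principal lattice $\Pi^{\uparrow}[a]$ of $K^{\uparrow}[a]$, and let $\Delta=(\Delta_1,\ldots,\Delta_{n-1})$ be such that $h^{\uparrow}+\Delta$ is the coordinate of a vertex $v$ of $\Pi^{\uparrow}[a]$. Let $\tilde K$ be the middle subcrystal of $K$ containing $v$ and let $K^{\downarrow}[b]$, $b\in\mathcal{B}(c)$, be the lower subcrystal of $K$ containing $\tilde K$. Then, setting $\Delta_0=\Delta_n:=0$, $$b_i=a_i+\Delta_i^{+}+\Delta_{i-1}^{ - },\qquad i=1,\ldots,n,$$ where $x^+=\max\{0,x\}$ and $x^-=\min\{0,x\}$.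
   Context: An $A_n$-crystal is a (regular, finite, connected) crystal graph of type $A_n$: a directed graph whose edges are colored $1,\ldots,n$, equivalently the Kashiwara crystal graph of an irreducible integrable highest-weight $U_q(\mathfrak{sl}_{n+1})$-module, where an $i$-colored edge $(u,v)$ means $v=F_i(u)$ for the (partial, invertible) lowering operator $F_i$. Each monochromatic connected component of color $i$ is a directed path. Such a crystal has a unique source $s_K$ (zero indegree); for $c\in\mathbb{Z}_+^n$, $K(c)$ denotes the unique $A_n$-crystal in which the maximal $i$-colored path starting at the source has length $c_i$ for every $i$. A subcrystal with color set $I$ means a maximal connected subgraph whose edges have colors in $I$; with colors $\{i,\dots,j\}$ it is itself an $A$-crystal (relabel colors $i,\dots,j$ as $1,\dots,j-i+1$). Principal lattice: let $\mathcal{B}(c)=\{a\in\mathbb{Z}^n:0\le a\le c\}$. For $1\le k\le n$ let $S_{n,k}=w_{n,k,n-k+1}\cdots w_{n,k,2}w_{n,k,1}$ with $w_{n,k,j}=F_jF_{j+1}\cdots F_{j+k-1}$ (operators applied right to left). The principal vertex at $a\in\mathcal{B}(c)$ is $\pi[a]=S_{n,n}^{a_n}\cdots S_{n,1}^{a_1}(s_K)$ (all operators applicable; distinct $a$ give distinct vertices). For an $A_{n-1}$-crystal with colors $1,\dots,n-1$ the principal lattice is defined the same way with $n-1$ in place of $n$, with coordinates $p=(p_1,\dots,p_{n-1})$. Upper subcrystals are the subcrystals of $K$ with colors $1,\ldots,n-1$; lower subcrystals those with colors $2,\ldots,n$; middle subcrystals those with colors $2,\ldots,n-1$. It is known that each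 upper (resp. lower) subcrystal contains exactly one principal vertex of $K$; $K^{\uparrow}[a]$ (resp. $K^{\downarrow}[b]$) denotes the upper (resp. lower) subcrystal containing $\pi[a]$ (resp. $\pi[b]$). Moreover $K^{\uparrow}[a]\cong K(c^{\uparrow})$ with $c^{\uparrow}_i=c_i-a_i+a_{i+1}$, and the coordinate of $\pi[a]$ in $\Pi^{\uparrow}[a]$ is $h^{\uparrow}=(a_2,\ldots,a_n)$. Every middle subcrystal lies in exactly one lower subcrystal. -}

module Defs where

open import Data.Nat using (ℕ; zero; suc; _+_; _≤_; _<?_)
open import Data.Nat.Properties using ()
open import Data.Bool using (Bool; true; false)
open import Data.Nat using (_≡ᵇ_)
open import Data.Fin using (Fin; toℕ; fromℕ<)
open import Data.List using (List; []; _∷_; map; concat; replicate; reverse; upTo; allFin)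
open import Data.Maybe using (Maybe; just; nothing; _>>=_)
import Data.Maybe as Maybe
open import Data.Product using (∃)
open import Data.Integer using (ℤ; _⊔_; _⊓_; 0ℤ)
open import Relation.Nullary using (yes; no)
open import Relation.Binary.PropositionalEquality using (_≡_)

-- Concrete model of the A_n crystals K(c): the word crystal.
-- Vertices are words over letters 1,…,n+1 (as natural numbers).
-- The lowering operator F_i (colour i ≥ 1) acts by the standard
-- (Lascoux–Schützenberger) bracketing rule: in the subword of letters
-- i and i+1 regard each i+1 as "(" and each i as ")"; cancel matched
-- pairs "()"; F_i changes the rightmost unmatched i into i+1 (and is
-- undefined if there is none).

Word : Set
Word = List ℕ

-- scan for the rightmost unmatched letter i
-- (o = number of currently open (unmatched) letters i+1, p = position)
mutual
  scan : ℕ → ℕ → ℕ → Maybe ℕ → Word → Maybe ℕ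
  scan i o p best [] = best
  scan i o p best (x ∷ w) = scanLetter i o p best (x ≡ᵇ i) (x ≡ᵇ suc i) w

  scanLetter : ℕ → ℕ → ℕ → Maybe ℕ → Bool → Bool → Word → Maybe ℕ
  scanLetter i zero    p best true  _     w = scan i zero (suc p) (just p) w
  scanLetter i (suc o) p best true  _     w = scan i o (suc p) best w
  scanLetter i o       p best false true  w = scan i (suc o) (suc p) best w
  scanLetter i o       p best false false w = scan i o (suc p) best w

setAt : ℕ → ℕ → Word → Word
setAt p y [] = []
setAt zero y (x ∷ w) = y ∷ w
setAt (suc p) y (x ∷ w) = x ∷ setAt p y w

F : ℕ → Word → Maybe Word
F i w = Maybe.map (λ p → setAt p (suc i) w) (scan i 0 0 nothing w)

seqOps : List (Word → Maybe Word) → Word → Maybe Word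
seqOps [] w = just w
seqOps (f ∷ fs) w = f w >>= seqOps fs

iterOp : ℕ → (Word → Maybe Word) → Word → Maybe Word
iterOp zero f w = just w
iterOp (suc k) f w = f w >>= iterOp k f

Applicable : (Word → Maybe Word) → Word → Set
Applicable f w = ∃ λ u → f w ≡ just u

-- Source of K(c): the highest-weight word, a concatenation of c_k
-- column words "k (k-1) … 1" for k = 1,…,n.  Its connected component
-- is (isomorphic to) K(c); c_k = length of maximal k-path from it.

colWord : ℕ → Word
colWord k = reverse (map suc (upTo k))

hw : (n : ℕ) → (Fin n → ℕ) → Word
hw n c = concat (map (λ i → concat (replicate (c i) (colWord (suc (toℕ i))))) (allFin n))

wOp : ℕ → ℕ → Word → Maybe Word
wOp k j = seqOps (map F (reverse (map (j +_) (upTo k))))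

SOp : ℕ → ℕ → Word → Maybe Word
SOp n k = seqOps (map (λ t → wOp k (suc t)) (upTo (suc (n Data.Nat.∸ k))))

-- π_s[a] = S_{n,n}^{a_n} ⋯ S_{n,1}^{a_1}(s); a_k is  a (k-1)
piOp : (n : ℕ) → (Fin n → ℕ) → Word → Maybe Word
piOp n a = seqOps (map (λ i → iterOp (a i) (SOp n (suc (toℕ i)))) (allFin n))

-- p ∈ B(c'), where c'_k is the length of the maximal k-path from the
-- source s (colours 1,…,n):  p_k ≤ c'_k  iff  F_k^{p_k}(s) is defined
InBox : (n : ℕ) → Word → (Fin n → ℕ) → Set
InBox n s p = ∀ (i : Fin n) → Applicable (iterOp (p i) (F (suc (toℕ i)))) s

-- Connectivity using only colours lo,…,hi (edges in either direction);
-- the subcrystal with colours lo..hi containing u is {v | Conn lo hi u v}.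
data Conn (lo hi : ℕ) : Word → Word → Set where
  c-refl : ∀ {u} → Conn lo hi u u
  c-fwd  : ∀ {u v w} (i : ℕ) → lo ≤ i → i ≤ hi → F i u ≡ just v → Conn lo hi v w → Conn lo hi u w
  c-bwd  : ∀ {u v w} (i : ℕ) → lo ≤ i → i ≤ hi → F i v ≡ just u → Conn lo hi v w → Conn lo hi u w

IsSourceFor : ℕ → ℕ → Word → Set
IsSourceFor lo hi s = ∀ (i : ℕ) (u : Word) → lo ≤ i → i ≤ hi → F i u ≡ just s → Data.Empty.⊥
  where import Data.Empty

-- Δ extended by Δ_0 = Δ_m+1 = 0, 1-based: DeltaExt m Δ j = Δ_j
DeltaExt : (m : ℕ) → (Fin m → ℤ) → ℕ → ℤ
DeltaExt m Δ zero = 0ℤ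
DeltaExt m Δ (suc j) with j <? m
... | yes j<m = Δ (fromℕ< j<m)
... | no _ = 0ℤ

_⁺ : ℤ → ℤ
x ⁺ = x ⊔ 0ℤ

_⁻ : ℤ → ℤ
x ⁻ = x ⊓ 0ℤ

{-# OPTIONS --safe #-}
module Submission where

-- Two words are bisimilar if all sequences of crystal operators see the same φ and ε. Knuth's
-- relations make columns commute up to bisimilarity, so every source is bisimilar to a product of columns
-- k…1 in any order. Connected bisimilar words are equal, hence a relation between operator words may be
-- verified on any source with the same φ. On a product of columns whose last factors are a_N, …, a_1
-- copies of the columns N…1, …, 1, the operators S_{N,k} act factor by factor. This identifies the source
-- of the lower subcrystal through π[a] as F_1^{A_1}⋯F_N^{A_N} applied to the source, with
-- A_j = a_j + ⋯ + a_N, and the source of the upper one as F_N^{a_1+⋯+a_N}⋯F_2^{a_1+a_2}F_1^{a_1} applied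
-- to it. So v lies in the lower subcrystal of F_1^{P_1}⋯F_m^{P_m}F_n^{a_1+⋯+a_n}⋯F_1^{a_1}, n = m+1, and
-- repeated use of the rank-two relation between F_i^x F_{i+1}^y F_i^z and F_{i+1}^{y′} F_i^{x+z} F_{i+1}^{x′},
-- x′ = min(x, y-z), moves all surplus powers of F_2, …, F_n to the left, leaving F_1^{B_1}⋯F_n^{B_n}
-- with B_j = P_j + min(a_j, p_{j-1}).
open import Defs
open import Data.Bool as Bool using (Bool; true; false)
open import Data.Empty using (⊥-elim)
open import Data.List using (List; []; _∷_; _++_; length; replicate)
open import Data.List.Properties using (++-assoc; ++-identityʳ)
open import Data.List.Relation.Unary.All as All using (All; []; _∷_)
open import Data.List.Relation.Unary.All.Properties using (++⁺; replicate⁺)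
open import Data.Maybe using (Maybe; just; nothing)
open import Data.Maybe.Properties using (just-injective)
open import Data.Nat
open import Data.Nat.Induction using (<-wellFounded)
open import Data.Nat.ListAction using (sum)
open import Data.Nat.ListAction.Properties using (sum-++)
open import Data.Nat.Properties
open import Data.Product using (∃; _×_; _,_; proj₁; proj₂)
open import Data.Sum using (_⊎_; inj₁; inj₂)
open import Data.Unit using (⊤; tt)
open import Function using (_∘_)
open import Induction.WellFounded using (Acc; acc)
open import Relation.Binary.Bundles using (Setoid)
open import Relation.Binary.Definitions using (tri<; tri≈; tri>)
open import Relation.Binary.PropositionalEquality
import Relation.Binary.Reasoning.Setoid as SetoidReasoning
open import Relation.Nullary using (yes; no; contradiction)

-- Signatures and crystal operators

-- The obstacle is that the source of an upper subcrystal is an arbitrary word, on which nothing can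
-- be computed directly; bisimilarity takes the place of crystal isomorphism because it ignores the
-- shape of the word. The return from bisimilarity to equality rests on the letter sum: each defined
-- step changes it by one, and a product of columns k...1 minimises it in its component. The
-- exponents of the two source words are column counts. Lifting every column k...1 to k+1...2 uses
-- F_j once per column of height at least j, which gives a_j + ⋯ + a_N; pushing every top letter to
-- N+1 uses F_j once per column of height at most j, which gives a_1 + ⋯ + a_j. The rank-two
-- relation is the change of string coordinates between the two reduced words of the longest element
-- of S_3. It yields exponents min(P_{j-1}, a_j + P_j) = P_j + min(a_j, p_{j-1}); their successive
-- differences are b_j = (p_j - a_{j+1})⁺ + min(a_j, p_{j-1}), and p_j = a_{j+1} + Δ_j turns this
-- into a_j + Δ_j⁺ + Δ_{j-1}⁻.

data Role : Set where
  closing opening neutral : Role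

roleOf : Bool → Bool → Role
roleOf true  _     = closing
roleOf false true  = opening
roleOf false false = neutral

role : ℕ → ℕ → Role
role i x = roleOf (x ≡ᵇ i) (x ≡ᵇ suc i)

≡ᵇ-refl : ∀ n → (n ≡ᵇ n) ≡ true
≡ᵇ-refl zero    = refl
≡ᵇ-refl (suc n) = ≡ᵇ-refl n

≡ᵇ-true : ∀ m n → (m ≡ᵇ n) ≡ true → m ≡ n
≡ᵇ-true m n p = ≡ᵇ⇒≡ m n (subst Bool.T (sym p) tt)

≢⇒≡ᵇ-false : ∀ {m n} → m ≢ n → (m ≡ᵇ n) ≡ false
≢⇒≡ᵇ-false {m} {n} m≢n with m ≡ᵇ n in eq
... | true  = contradiction (≡ᵇ-true m n eq) m≢n
... | false = refl

role-closing : ∀ i → role i i ≡ closing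
role-closing i rewrite ≡ᵇ-refl i = refl

role-opening : ∀ i → role i (suc i) ≡ opening
role-opening i rewrite ≢⇒≡ᵇ-false (1+n≢n {i}) | ≡ᵇ-refl i = refl

role-neutral : ∀ {i x} → x ≢ i → x ≢ suc i → role i x ≡ neutral
role-neutral p q rewrite ≢⇒≡ᵇ-false p | ≢⇒≡ᵇ-false q = refl

data RoleView (i : ℕ) : ℕ → Role → Set where
  closing : RoleView i i closing
  opening : RoleView i (suc i) opening
  neutral : ∀ {x} → x ≢ i → x ≢ suc i → RoleView i x neutral

roleView : ∀ i x → RoleView i x (role i x)
roleView i x with x ≟ i
... | yes refl rewrite role-closing i = closing
... | no x≢i with x ≟ suc i
...   | yes refl rewrite role-opening i = opening
...   | no x≢1+i rewrite role-neutral x≢i x≢1+i = neutral x≢i x≢1+i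

consφ : Role → ℕ → ℕ
consφ closing n = suc n
consφ opening n = pred n
consφ neutral n = n

consε : Role → ℕ → ℕ → ℕ
consε closing n       k = k
consε opening zero    k = suc k
consε opening (suc n) k = k
consε neutral n       k = k

-- The number of unmatched letters i, and `ε` that of unmatched letters i+1. The recursion reads the
-- word from the right: a prepended i+1 cancels the first unmatched i of the tail, if there is one,
-- and otherwise stays open.
φ : ℕ → Word → ℕ
φ i []      = 0
φ i (x ∷ w) = consφ (role i x) (φ i w)

ε : ℕ → Word → ℕ
ε i []      = 0
ε i (x ∷ w) = consε (role i x) (φ i w) (ε i w)

ε-tail : ∀ i x w → ε i (x ∷ w) ≡ 0 → ε i w ≡ 0
ε-tail i x w z with role i x
... | closing = z
... | neutral = z
... | opening with φ i w
...   | suc _ = z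

consf : Role → ℕ → ℕ → ℕ → Word → Word → Word
consf closing zero          i x w w′ = suc i ∷ w
consf closing (suc _)       i x w w′ = x ∷ w′
consf opening zero          i x w w′ = x ∷ w
consf opening (suc zero)    i x w w′ = x ∷ w
consf opening (suc (suc _)) i x w w′ = x ∷ w′
consf neutral _             i x w w′ = x ∷ w′

conse : Role → ℕ → ℕ → ℕ → Word → Word → Word
conse opening zero i x w w′ = i ∷ w
conse opening (suc _) i x w w′ = x ∷ w′
conse closing _    i x w w′ = x ∷ w′
conse neutral _    i x w w′ = x ∷ w′

-- Total versions of the lowering and raising operators, acting as the identity where those are undefined.
f : ℕ → Word → Word
f i []      = []
f i (x ∷ w) = consf (role i x) (φ i w) i x w (f i w)

e : ℕ → Word → Word
e i []      = []
e i (x ∷ w) = conse (role i x) (φ i w) i x w (e i w)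

infix 4 _⟶[_]_

-- A letter i+1 in front captures one unmatched i of the tail. The step can pass it only if a second
-- one remains, which is the side condition of `there`.
data _⟶[_]_ : Word → ℕ → Word → Set where
  here  : ∀ {i w} → φ i w ≡ 0 → i ∷ w ⟶[ i ] suc i ∷ w
  there : ∀ {i x w w′} → (x ≡ suc i → 2 ≤ φ i w) → w ⟶[ i ] w′ → x ∷ w ⟶[ i ] x ∷ w′

⟶-φ : ∀ {i u v} → u ⟶[ i ] v → φ i u ≡ suc (φ i v)
⟶-φ {i} (here {w = w} p) rewrite role-closing i | role-opening i | p = refl
⟶-φ {i} (there {x = x} {w} {w′} q s) with role i x | roleView i x
... | closing | _ = cong suc (⟶-φ s)
... | neutral | _ = ⟶-φ s
... | opening | opening with φ i w | φ i w′ | ⟶-φ s | q refl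
...   | _ | zero  | refl | s≤s ()
...   | _ | suc _ | refl | _ = refl

⟶-ε : ∀ {i u v} → u ⟶[ i ] v → ε i v ≡ suc (ε i u)
⟶-ε {i} (here {w = w} p) rewrite role-closing i | role-opening i | p = refl
⟶-ε {i} (there {x = x} {w} {w′} q s) with role i x | roleView i x
... | closing | _ = ⟶-ε s
... | neutral | _ = ⟶-ε s
... | opening | opening with φ i w | φ i w′ | ⟶-φ s | q refl | ⟶-ε s
...   | _ | zero  | refl | s≤s () | _
...   | _ | suc _ | refl | _ | eq = eq

⟶-f : ∀ {i u v} → u ⟶[ i ] v → f i u ≡ v
⟶-f {i} (here p) rewrite role-closing i | p = refl
⟶-f {i} (there {x = x} {w} {w′} q s) with role i x | roleView i x
... | neutral | _ = cong (x ∷_) (⟶-f s)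
... | closing | closing rewrite ⟶-φ s = cong (x ∷_) (⟶-f s)
... | opening | opening with φ i w | q refl
...   | suc zero    | s≤s ()
...   | suc (suc _) | _ = cong (x ∷_) (⟶-f s)

⟶-e : ∀ {i u v} → u ⟶[ i ] v → e i v ≡ u
⟶-e {i} (here p) rewrite role-opening i | p = refl
⟶-e {i} (there {x = x} {w} {w′} q s) with role i x | roleView i x
... | neutral | _ = cong (x ∷_) (⟶-e s)
... | closing | _ = cong (x ∷_) (⟶-e s)
... | opening | opening with φ i w | φ i w′ | ⟶-φ s | q refl
...   | _ | zero  | refl | s≤s ()
...   | _ | suc _ | refl | _ = cong (x ∷_) (⟶-e s)

f-undefined : ∀ i w → φ i w ≡ 0 → f i w ≡ w
f-undefined i []      _ = refl
f-undefined i (x ∷ w) p with role i x | roleView i x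
... | neutral | _ = cong (x ∷_) (f-undefined i w p)
... | opening | opening with φ i w
...   | zero     = refl
...   | suc zero = refl

f-defined : ∀ i w → 1 ≤ φ i w → w ⟶[ i ] f i w
f-defined i (x ∷ w) p with role i x | roleView i x
... | neutral | neutral _ ne = there (λ eq → contradiction eq ne) (f-defined i w p)
... | opening | opening with φ i w in eq
...   | suc (suc k) = there (λ _ → subst (2 ≤_) (sym eq) (s≤s (s≤s z≤n))) (f-defined i w (subst (1 ≤_) (sym eq) (s≤s z≤n)))
f-defined i (x ∷ w) p | closing | closing with φ i w in eq
...   | zero  = here eq
...   | suc k = there (λ ne → contradiction (sym ne) 1+n≢n) (f-defined i w (subst (1 ≤_) (sym eq) (s≤s z≤n)))

e-undefined : ∀ i w → ε i w ≡ 0 → e i w ≡ w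
e-undefined i []      _ = refl
e-undefined i (x ∷ w) p with role i x | roleView i x
... | neutral | _ = cong (x ∷_) (e-undefined i w p)
... | closing | _ = cong (x ∷_) (e-undefined i w p)
... | opening | opening with φ i w
...   | suc _ = cong (x ∷_) (e-undefined i w p)

e-defined : ∀ i w → 1 ≤ ε i w → e i w ⟶[ i ] w
e-defined i (x ∷ w) p with role i x | roleView i x
... | neutral | neutral _ ne = there (λ eq → contradiction eq ne) (e-defined i w p)
... | closing | closing = there (λ ne → contradiction (sym ne) 1+n≢n) (e-defined i w p)
... | opening | opening with φ i w in eq
...   | zero  = here eq
...   | suc k = there (λ _ → subst (2 ≤_) (sym (trans (⟶-φ s) (cong suc eq))) (s≤s (s≤s z≤n))) s
  where s = e-defined i w p

-- Only meaningful when φ i w is positive.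
rightmost : ℕ → Word → ℕ
rightmost i []      = 0
rightmost i (x ∷ w) with role i x | φ i w
... | closing | zero = 0
... | _       | _    = suc (rightmost i w)

-- The outcome of a scan with o open brackets over a word with n unmatched closing ones.
orElse : ℕ → ℕ → Maybe ℕ → ℕ → Maybe ℕ
orElse o       zero    best r = best
orElse zero    (suc _) best r = just r
orElse (suc o) (suc n) best r = orElse o n best r

-- Open brackets consume unmatched closing ones from the left, so the rightmost survives as soon as
-- there are more than o of them, and its position does not depend on o. The generality in o, p and
-- `best` carries the induction.
scan-spec : ∀ i o p best w → scan i o p best w ≡ orElse o (φ i w) best (p + rightmost i w)
scan-spec i zero p best [] = refl
scan-spec i (suc o) p best [] = refl
scan-spec i o p best (x ∷ w) with x ≡ᵇ i | x ≡ᵇ suc i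
scan-spec i zero p best (x ∷ w) | true | _ rewrite scan-spec i zero (suc p) (just p) w with φ i w
... | zero  = cong just (sym (+-identityʳ p))
... | suc _ = cong just (sym (+-suc p _))
scan-spec i (suc o) p best (x ∷ w) | true | _ rewrite scan-spec i o (suc p) best w with φ i w
... | zero with o
...   | zero = refl
...   | suc _ = refl
scan-spec i (suc o) p best (x ∷ w) | true | _ | suc n rewrite +-suc p (rightmost i w) = refl
scan-spec i zero p best (x ∷ w) | false | true
  rewrite scan-spec i 1 (suc p) best w | +-suc p (rightmost i w) with φ i w
... | zero  = refl
... | suc n = refl
scan-spec i (suc o) p best (x ∷ w) | false | true
  rewrite scan-spec i (suc (suc o)) (suc p) best w | +-suc p (rightmost i w) with φ i w
... | zero  = refl
... | suc n = refl
scan-spec i zero p best (x ∷ w) | false | false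
  rewrite scan-spec i zero (suc p) best w | +-suc p (rightmost i w) = refl
scan-spec i (suc o) p best (x ∷ w) | false | false
  rewrite scan-spec i (suc o) (suc p) best w | +-suc p (rightmost i w) = refl

setAt-rightmost : ∀ i w → 1 ≤ φ i w → setAt (rightmost i w) (suc i) w ≡ f i w
setAt-rightmost i (x ∷ w) p with role i x
... | neutral = cong (x ∷_) (setAt-rightmost i w p)
... | opening with φ i w in eq
...   | suc (suc k) = cong (x ∷_) (setAt-rightmost i w (subst (1 ≤_) (sym eq) (s≤s z≤n)))
setAt-rightmost i (x ∷ w) p | closing with φ i w in eq
...   | zero  = refl
...   | suc k = cong (x ∷_) (setAt-rightmost i w (subst (1 ≤_) (sym eq) (s≤s z≤n)))

F-f : ∀ i w → 1 ≤ φ i w → F i w ≡ just (f i w)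
F-f i w p rewrite scan-spec i 0 0 nothing w with φ i w in eq
F-f i w () | zero
... | suc _ = cong just (setAt-rightmost i w (subst (1 ≤_) (sym eq) (s≤s z≤n)))

F-just : ∀ {i w u} → F i w ≡ just u → w ⟶[ i ] u
F-just {i} {w} {u} eq with φ i w in φ≡
... | suc k with 1≤ ← subst (1 ≤_) (sym φ≡) (s≤s z≤n) =
  subst (w ⟶[ i ]_) (just-injective (trans (sym (F-f i w 1≤)) eq)) (f-defined i w 1≤)
F-just {i} {w} eq | zero rewrite scan-spec i 0 0 nothing w | φ≡ with () ← eq

-- The tensor product rule: only the open brackets of u and the closing brackets of v that are
-- unmatched in their own factor can still cancel.
φ-++ : ∀ i u v → φ i (u ++ v) ≡ φ i u + (φ i v ∸ ε i u)
φ-++ i []      v = refl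
φ-++ i (x ∷ u) v rewrite φ-++ i u v with role i x
... | closing = refl
... | neutral = refl
... | opening with φ i u
...   | zero  = pred[m∸n]≡m∸[1+n] (φ i v) (ε i u)
...   | suc _ = refl

ε-++ : ∀ i u v → ε i (u ++ v) ≡ ε i v + (ε i u ∸ φ i v)
ε-++ i []      v = sym (trans (cong (ε i v +_) (0∸n≡0 (φ i v))) (+-identityʳ _))
ε-++ i (x ∷ u) v rewrite φ-++ i u v with role i x
... | closing = ε-++ i u v
... | neutral = ε-++ i u v
... | opening rewrite ε-++ i u v with φ i u
...   | suc _ = refl
...   | zero  = aux (φ i v) (ε i u) (ε i v)
  where
  aux : ∀ m n k → consε opening (m ∸ n) (k + (n ∸ m)) ≡ k + (suc n ∸ m)
  aux zero    zero    k = sym (+-suc k 0)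
  aux zero    (suc n) k = sym (+-suc k (suc n))
  aux (suc m) zero    k rewrite 0∸n≡0 m = refl
  aux (suc m) (suc n) k = aux m n k

-- If v has an unmatched i beyond those captured by u, the rightmost unmatched i of the product lies
-- in v; in the opposite case, treated by `⟶-++ˡ`, none in v is left and the step happens in u.
⟶-++ʳ : ∀ {i v v′} u → ε i u < φ i v → v ⟶[ i ] v′ → u ++ v ⟶[ i ] u ++ v′
⟶-++ʳ [] lt s = s
⟶-++ʳ {i} {v} (x ∷ u) lt s = there pass (⟶-++ʳ u lt′ s)
  where
  lt′ : ε i u < φ i v
  lt′ with role i x
  ... | closing = lt
  ... | neutral = lt
  ... | opening with φ i u
  ...   | zero  = <-trans ≤-refl lt
  ...   | suc _ = lt
  pass : x ≡ suc i → 2 ≤ φ i (u ++ v)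
  pass refl rewrite φ-++ i u v | role-opening i with φ i u
  ... | suc k = s≤s (≤-trans (m<n⇒0<n∸m lt) (m≤n+m _ k))
  ... | zero  = subst (_≤ φ i v ∸ ε i u) (m+n∸n≡m 2 (ε i u)) (∸-monoˡ-≤ (ε i u) lt)

⟶-++ˡ : ∀ {i u u′} v → φ i v ≤ ε i u → u ⟶[ i ] u′ → u ++ v ⟶[ i ] u′ ++ v
⟶-++ˡ {i} v le (here {w = w} p) = here (trans (φ-++ i w v) (trans (cong₂ _+_ p (m≤n⇒m∸n≡0 le′)) refl))
  where
  le′ : φ i v ≤ ε i w
  le′ rewrite role-closing i = le
⟶-++ˡ {i} v le (there {x = x} {w} {w′} q s) = there
  (λ eq → subst (2 ≤_) (sym (φ-++ i w v)) (≤-trans (q eq) (m≤m+n _ _)))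
  (⟶-++ˡ v le′ s)
  where
  le′ : φ i v ≤ ε i w
  le′ with role i x | φ i w | ⟶-φ s
  ... | closing | _ | _ = le
  ... | neutral | _ | _ = le
  ... | opening | suc _ | _ = le

f-++ʳ : ∀ i u v → ε i u < φ i v → f i (u ++ v) ≡ u ++ f i v
f-++ʳ i u v lt = ⟶-f (⟶-++ʳ u lt (f-defined i v (≤-trans (s≤s z≤n) lt)))

f-++ˡ : ∀ i u v → φ i v ≤ ε i u → f i (u ++ v) ≡ f i u ++ v
f-++ˡ i u v le with φ i u in eq
... | suc _ = ⟶-f (⟶-++ˡ v le (f-defined i u (subst (1 ≤_) (sym eq) (s≤s z≤n))))
... | zero  = trans (f-undefined i (u ++ v) (trans (φ-++ i u v) (cong₂ _+_ eq (m≤n⇒m∸n≡0 le))))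
                    (cong (_++ v) (sym (f-undefined i u eq)))

e-++ˡ : ∀ i u v → φ i v < ε i u → e i (u ++ v) ≡ e i u ++ v
e-++ˡ i u v lt = ⟶-e (⟶-++ˡ v (s≤s⁻¹ (subst (φ i v <_) (⟶-ε s) lt)) s)
  where s = e-defined i u (≤-trans (s≤s z≤n) lt)

e-++ʳ : ∀ i u v → ε i u ≤ φ i v → e i (u ++ v) ≡ u ++ e i v
e-++ʳ i u v le with ε i v in eq
... | suc _ = ⟶-e (⟶-++ʳ u (subst (ε i u <_) (sym (⟶-φ s)) (s≤s le)) s)
  where s = e-defined i v (subst (1 ≤_) (sym eq) (s≤s z≤n))
... | zero  = trans (e-undefined i (u ++ v) (trans (ε-++ i u v) (cong₂ _+_ eq (m≤n⇒m∸n≡0 le))))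
                    (cong (u ++_) (sym (e-undefined i v eq)))

-- Knuth relations and columns

data Knuth : Word → Word → Set where
  yzx-yxz : ∀ {x y z} → x < y → y ≤ z → Knuth (y ∷ z ∷ x ∷ []) (y ∷ x ∷ z ∷ [])
  xzy-zxy : ∀ {x y z} → x ≤ y → y < z → Knuth (x ∷ z ∷ y ∷ []) (z ∷ x ∷ y ∷ [])

SameSignature : ℕ → Word → Word → Set
SameSignature i u w = φ i u ≡ φ i w × ε i u ≡ ε i w

Compatible : (Word → Word → Set) → ℕ → Word → Word → Set
Compatible R i u w = SameSignature i u w × R (f i u) (f i w) × R (e i u) (e i w)

-- Only the roles of the three letters in colour i matter. Two cases exchange the relations: raising
-- with x = i, y = z = i+1 turns the first into the second, and lowering with x = y = i, z = i+1
-- turns the second into the first. Neither relation alone would be closed.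
Knuth-compatible : ∀ {u w} → Knuth u w → ∀ i → Compatible Knuth i u w
Knuth-compatible (yzx-yxz {x} {y} {z} p q) i
  with role i x | roleView i x | role i y | roleView i y | role i z | roleView i z
... | _ | neutral _ _ | _ | neutral _ _ | _ | neutral _ _ = (refl , refl) , yzx-yxz p q , yzx-yxz p q
... | _ | closing | _ | opening | _ | opening = (refl , refl) , yzx-yxz p q , xzy-zxy ≤-refl ≤-refl
... | _ | closing | _ | opening | _ | neutral _ _ = (refl , refl) , yzx-yxz p q , yzx-yxz p q
... | _ | closing | _ | neutral _ y≢ | _ | neutral _ _ =
  (refl , refl) , yzx-yxz (≤∧≢⇒< p (≢-sym y≢)) q , yzx-yxz p q
... | _ | opening | _ | neutral _ _ | _ | neutral _ _ =
  (refl , refl) , yzx-yxz p q , yzx-yxz (<-trans ≤-refl p) q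
... | _ | neutral _ _ | _ | closing | _ | closing =
  (refl , refl) , yzx-yxz p (n≤1+n i) , yzx-yxz p q
... | _ | neutral _ _ | _ | closing | _ | opening =
  (refl , refl) , yzx-yxz (m≤n⇒m≤1+n p) ≤-refl , yzx-yxz p ≤-refl
... | _ | neutral _ _ | _ | closing | _ | neutral z≢ _ =
  (refl , refl) , yzx-yxz (m≤n⇒m≤1+n p) (≤∧≢⇒< q (≢-sym z≢)) , yzx-yxz p q
... | _ | neutral x≢ _ | _ | opening | _ | opening =
  (refl , refl) , yzx-yxz p q , yzx-yxz (≤∧≢⇒< (s≤s⁻¹ p) x≢) (n≤1+n i)
... | _ | neutral x≢ _ | _ | opening | _ | neutral _ _ =
  (refl , refl) , yzx-yxz p q , yzx-yxz (≤∧≢⇒< (s≤s⁻¹ p) x≢) (≤-trans (n≤1+n i) q)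
... | _ | neutral _ _ | _ | neutral _ _ | _ | closing =
  (refl , refl) , yzx-yxz p (m≤n⇒m≤1+n q) , yzx-yxz p q
... | _ | neutral _ _ | _ | neutral _ y≢ | _ | opening =
  (refl , refl) , yzx-yxz p q , yzx-yxz p (s≤s⁻¹ (≤∧≢⇒< q y≢))
... | _ | closing | _ | closing | _ | _ = contradiction p (<-irrefl refl)
... | _ | closing | _ | _ | _ | closing = contradiction (≤-trans p q) (<-irrefl refl)
... | _ | closing | _ | neutral _ y≢ | _ | opening = contradiction (≤-antisym q p) y≢
... | _ | opening | _ | closing | _ | _ = contradiction (<-trans ≤-refl p) (<-irrefl refl)
... | _ | opening | _ | opening | _ | _ = contradiction p (<-irrefl refl)
... | _ | opening | _ | _ | _ | closing = contradiction (<-trans ≤-refl (≤-trans p q)) (<-irrefl refl)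
... | _ | opening | _ | _ | _ | opening = contradiction (≤-trans p q) (<-irrefl refl)
... | _ | neutral _ _ | _ | opening | _ | closing = contradiction q (<-irrefl refl)
Knuth-compatible (xzy-zxy {x} {y} {z} p q) i
  with role i x | roleView i x | role i y | roleView i y | role i z | roleView i z
... | _ | closing | _ | closing | _ | opening =
  (refl , refl) , yzx-yxz ≤-refl ≤-refl , xzy-zxy p q
... | _ | closing | _ | closing | _ | neutral _ z≢ =
  (refl , refl) , xzy-zxy (n≤1+n i) (≤∧≢⇒< q (≢-sym z≢)) , xzy-zxy p q
... | _ | closing | _ | opening | _ | neutral _ _ =
  (refl , refl) , xzy-zxy ≤-refl q , xzy-zxy ≤-refl (<-trans ≤-refl q)
... | _ | closing | _ | neutral y≢ _ | _ | neutral _ _ =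
  (refl , refl) , xzy-zxy (≤∧≢⇒< p (≢-sym y≢)) q , xzy-zxy p q
... | _ | opening | _ | opening | _ | neutral _ _ =
  (refl , refl) , xzy-zxy p q , xzy-zxy (n≤1+n i) q
... | _ | opening | _ | neutral _ _ | _ | neutral _ _ =
  (refl , refl) , xzy-zxy p q , xzy-zxy (≤-trans (n≤1+n i) p) q
... | _ | neutral _ _ | _ | closing | _ | opening = (refl , refl) , xzy-zxy p q , xzy-zxy p q
... | _ | neutral _ _ | _ | closing | _ | neutral _ z≢ =
  (refl , refl) , xzy-zxy (m≤n⇒m≤1+n p) (≤∧≢⇒< q (≢-sym z≢)) , xzy-zxy p q
... | _ | neutral _ x≢ | _ | opening | _ | neutral _ _ =
  (refl , refl) , xzy-zxy p q , xzy-zxy (s≤s⁻¹ (≤∧≢⇒< p x≢)) (<-trans ≤-refl q)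
... | _ | neutral _ _ | _ | neutral _ _ | _ | closing =
  (refl , refl) , xzy-zxy p (m≤n⇒m≤1+n q) , xzy-zxy p q
... | _ | neutral _ _ | _ | neutral y≢ _ | _ | opening =
  (refl , refl) , xzy-zxy p q , xzy-zxy p (≤∧≢⇒< (s≤s⁻¹ q) y≢)
... | _ | neutral _ _ | _ | neutral _ _ | _ | neutral _ _ = (refl , refl) , xzy-zxy p q , xzy-zxy p q
... | _ | closing | _ | _ | _ | closing = contradiction (≤-trans (s≤s p) q) (<-irrefl refl)
... | _ | closing | _ | opening | _ | opening = contradiction q (<-irrefl refl)
... | _ | closing | _ | neutral y≢ _ | _ | opening = contradiction (≤-antisym (s≤s⁻¹ q) p) y≢
... | _ | opening | _ | closing | _ | _ = contradiction p (<-irrefl refl)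
... | _ | opening | _ | _ | _ | closing = contradiction (<-trans ≤-refl (≤-trans (s≤s p) q)) (<-irrefl refl)
... | _ | opening | _ | _ | _ | opening = contradiction (≤-trans (s≤s p) q) (<-irrefl refl)
... | _ | neutral _ _ | _ | closing | _ | closing = contradiction q (<-irrefl refl)
... | _ | neutral _ _ | _ | opening | _ | opening = contradiction q (<-irrefl refl)
... | _ | neutral _ _ | _ | opening | _ | closing = contradiction (<-trans ≤-refl q) (<-irrefl refl)

down : ℕ → ℕ → Word
down j zero    = []
down j (suc k) = j + k ∷ down j k

φ-closing : ∀ i w → φ i (i ∷ w) ≡ suc (φ i w)
φ-closing i w rewrite role-closing i = refl

φ-opening : ∀ i w → φ i (suc i ∷ w) ≡ pred (φ i w)
φ-opening i w rewrite role-opening i = refl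

φ-neutral : ∀ {i x} w → x ≢ i → x ≢ suc i → φ i (x ∷ w) ≡ φ i w
φ-neutral w p q rewrite role-neutral p q = refl

ε-closing : ∀ i w → ε i (i ∷ w) ≡ ε i w
ε-closing i w rewrite role-closing i = refl

ε-neutral : ∀ {i x} w → x ≢ i → x ≢ suc i → ε i (x ∷ w) ≡ ε i w
ε-neutral w p q rewrite role-neutral p q = refl

down-outside : ∀ {i} j k → (∀ x → j ≤ x → x < j + k → x ≢ i × x ≢ suc i) → SameSignature i (down j k) []
down-outside j zero    out = refl , refl
down-outside j (suc k) out
  with p , q ← out (j + k) (m≤m+n j k) (≤-reflexive (sym (+-suc j k)))
     | a , b ← down-outside j k (λ x l r → out x l (≤-trans r (+-monoʳ-≤ j (n≤1+n k))))
  = trans (φ-neutral (down j k) p q) a , trans (ε-neutral (down j k) p q) b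

down-above : ∀ {i} j k → suc i < j → SameSignature i (down j k) []
down-above j k lt = down-outside j k λ x l _ →
  (λ { refl → <-irrefl refl (≤-trans (s≤s (n≤1+n _)) (≤-trans lt l)) }) ,
  (λ { refl → <-irrefl refl (≤-trans lt l) })

down-below : ∀ {i} j k → j + k ≤ i → SameSignature i (down j k) []
down-below j k le = down-outside j k λ x _ r →
  (λ { refl → <-irrefl refl (≤-trans r le) }) ,
  (λ { refl → <-irrefl refl (≤-trans (s≤s (n≤1+n _)) (≤-trans r le)) })

φ-down-top : ∀ j k → φ (j + k) (down j (suc k)) ≡ 1
φ-down-top j k = trans (φ-closing (j + k) (down j k)) (cong suc (proj₁ (down-below j k ≤-refl)))

ε-down-top : ∀ j k → ε (j + k) (down j (suc k)) ≡ 0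
ε-down-top j k = trans (ε-closing (j + k) (down j k)) (proj₂ (down-below j k ≤-refl))

-- Inside a column every letter i+1 is matched by the letter i below it, so only the two ends count.
down-inside : ∀ {i} j k → j ≤ i → suc i < j + k → SameSignature i (down j k) []
down-inside {i} j zero    le lt = contradiction (≤-trans lt (≤-trans (≤-reflexive (+-identityʳ j)) le)) (≤⇒≯ (n≤1+n i))
down-inside {i} j (suc k) le lt with j + k ≟ suc i
... | no ne with a , b ← down-inside j k le (≤∧≢⇒< (s≤s⁻¹ (subst (suc i <_) (+-suc j k) lt)) (≢-sym ne)) =
  trans (φ-neutral (down j k) p ne) a , trans (ε-neutral (down j k) p ne) b
  where p : j + k ≢ i
        p refl = <-irrefl refl (s≤s⁻¹ (subst (suc (j + k) <_) (+-suc j k) lt))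
down-inside {i} j (suc zero) le lt | yes eq = contradiction (≤-trans (≤-reflexive (sym eq)) (≤-trans (≤-reflexive (+-identityʳ j)) le)) (<-irrefl refl)
down-inside {i} j (suc (suc k)) le lt | yes eq with refl ← suc-injective (trans (sym (+-suc j k)) eq) = lemma
  where
  lemma : SameSignature (j + k) (down j (2 + k)) []
  lemma rewrite +-suc j k | role-opening (j + k) | φ-down-top j k | ε-down-top j k = refl , refl

down-bottom : ∀ i k → φ i (down (suc i) (suc k)) ≡ 0 × ε i (down (suc i) (suc k)) ≡ 1
down-bottom i zero rewrite +-identityʳ i | role-opening i = refl , refl
down-bottom i (suc k) with a , b ← down-bottom i k =
  trans (φ-neutral (down (suc i) (suc k)) p q) a , trans (ε-neutral (down (suc i) (suc k)) p q) b
  where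
  p : suc i + suc k ≢ i
  p eq = m≢1+m+n i (sym eq)
  q : suc i + suc k ≢ suc i
  q eq = m+1+n≢m (suc i) eq

down-φ : ∀ {i} j k → i ≢ j + k → φ i (down j (suc k)) ≡ 0
down-φ {i} j k ne with suc i <? j
... | yes lt = proj₁ (down-above j (suc k) lt)
... | no ge with suc i ≟ j
...   | yes refl = proj₁ (down-bottom i k)
...   | no ne′ with suc i <? j + suc k
...     | yes lt = proj₁ (down-inside j (suc k) (s≤s⁻¹ (≤∧≢⇒< (≮⇒≥ ge) (≢-sym ne′))) lt)
...     | no ge″ = proj₁ (down-below j (suc k) (s≤s⁻¹ (≤∧≢⇒< (≮⇒≥ ge″)
                     (λ eq → ne (suc-injective (trans (sym eq) (+-suc j k)))))))

down-ε : ∀ {i} j k → suc i ≢ j → ε i (down j k) ≡ 0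
down-ε     j zero    ne = refl
down-ε {i} j (suc k) ne with suc i <? j
... | yes lt = proj₂ (down-above j (suc k) lt)
... | no ge with i ≟ j + k
...   | yes refl = ε-down-top j k
...   | no i≢ with suc i <? j + suc k
...     | yes lt = proj₂ (down-inside j (suc k) (s≤s⁻¹ (≤∧≢⇒< (≮⇒≥ ge) (≢-sym ne))) lt)
...     | no ge″ = proj₂ (down-below j (suc k) (s≤s⁻¹ (≤∧≢⇒< (≮⇒≥ ge″)
                     (λ eq → i≢ (suc-injective (trans (sym eq) (+-suc j k)))))))

-- Bisimilarity of words

-- The colours o+1,...,o+m. The offset lets one development serve the whole crystal and the upper
-- subcrystals (o = 0), the lower subcrystals (o = 1) and two adjacent colours (m = 2).
module Window (o m : ℕ) where

  Colour : ℕ → Set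
  Colour i = suc o ≤ i × i ≤ o + m

  data Move : Set where
    lower raise : ∀ i → Colour i → Move

  move : Move → Word → Word
  move (lower i _) = f i
  move (raise i _) = e i

  run : List Move → Word → Word
  run []      w = w
  run (x ∷ X) w = run X (move x w)

  infix 4 _≋_

  record _≋_ (u w : Word) : Set where
    constructor bisim
    field same : ∀ X i → Colour i → SameSignature i (run X u) (run X w)
  open _≋_ public

  ≋-coinduction : (R : Word → Word → Set) →
    (∀ {u w} → R u w → ∀ i → Colour i → Compatible R i u w) → ∀ {u w} → R u w → u ≋ w
  ≋-coinduction R closed r = bisim (go r)
    where
    go : ∀ {u w} → R u w → ∀ X i → Colour i → SameSignature i (run X u) (run X w)
    go r []      i c = proj₁ (closed r i c)
    go r (lower j c ∷ X) = go (proj₁ (proj₂ (closed r j c))) X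
    go r (raise j c ∷ X) = go (proj₂ (proj₂ (closed r j c))) X

  ≋-refl : ∀ {u} → u ≋ u
  ≋-refl = bisim λ _ _ _ → refl , refl

  ≋-sym : ∀ {u w} → u ≋ w → w ≋ u
  ≋-sym (bisim s) = bisim λ X i c → sym (proj₁ (s X i c)) , sym (proj₂ (s X i c))

  ≋-trans : ∀ {u v w} → u ≋ v → v ≋ w → u ≋ w
  ≋-trans (bisim s) (bisim t) = bisim λ X i c →
    trans (proj₁ (s X i c)) (proj₁ (t X i c)) , trans (proj₂ (s X i c)) (proj₂ (t X i c))

  ≋-setoid : Setoid _ _
  ≋-setoid = record
    { Carrier = Word ; _≈_ = _≋_
    ; isEquivalence = record { refl = ≋-refl ; sym = ≋-sym ; trans = ≋-trans } }

  ≋-move : ∀ x {u w} → u ≋ w → move x u ≋ move x w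
  ≋-move x (bisim s) = bisim λ X → s (x ∷ X)

  ≋-signature : ∀ {u w i} → u ≋ w → Colour i → SameSignature i u w
  ≋-signature (bisim s) = s [] _

  data Juxtaposed : Word → Word → Set where
    juxtapose : ∀ {u₁ u₂ w₁ w₂} → u₁ ≋ w₁ → u₂ ≋ w₂ → Juxtaposed (u₁ ++ u₂) (w₁ ++ w₂)

  -- By the tensor product rule the factor that an operator changes is determined by `φ` and `ε` of
  -- the factors, and these agree on both sides.
  juxtaposed-compatible : ∀ {u w} → Juxtaposed u w → ∀ i → Colour i → Compatible Juxtaposed i u w
  juxtaposed-compatible (juxtapose {u₁} {u₂} {w₁} {w₂} p q) i c = (eqφ , eqε) , lowered , raised
    where
    p₁ = proj₁ (≋-signature p c)
    p₂ = proj₂ (≋-signature p c)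
    q₁ = proj₁ (≋-signature q c)
    q₂ = proj₂ (≋-signature q c)
    eqφ : φ i (u₁ ++ u₂) ≡ φ i (w₁ ++ w₂)
    eqφ rewrite φ-++ i u₁ u₂ | φ-++ i w₁ w₂ | p₁ | p₂ | q₁ = refl
    eqε : ε i (u₁ ++ u₂) ≡ ε i (w₁ ++ w₂)
    eqε rewrite ε-++ i u₁ u₂ | ε-++ i w₁ w₂ | p₂ | q₁ | q₂ = refl
    lowered : Juxtaposed (f i (u₁ ++ u₂)) (f i (w₁ ++ w₂))
    lowered with ε i u₁ <? φ i u₂
    ... | yes lt rewrite f-++ʳ i u₁ u₂ lt | f-++ʳ i w₁ w₂ (subst₂ _<_ p₂ q₁ lt) =
      juxtapose p (≋-move (lower i c) q)
    ... | no ge rewrite f-++ˡ i u₁ u₂ (≮⇒≥ ge) | f-++ˡ i w₁ w₂ (subst₂ _≤_ q₁ p₂ (≮⇒≥ ge)) =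
      juxtapose (≋-move (lower i c) p) q
    raised : Juxtaposed (e i (u₁ ++ u₂)) (e i (w₁ ++ w₂))
    raised with φ i u₂ <? ε i u₁
    ... | yes lt rewrite e-++ˡ i u₁ u₂ lt | e-++ˡ i w₁ w₂ (subst₂ _<_ q₁ p₂ lt) =
      juxtapose (≋-move (raise i c) p) q
    ... | no ge rewrite e-++ʳ i u₁ u₂ (≮⇒≥ ge) | e-++ʳ i w₁ w₂ (subst₂ _≤_ p₂ q₁ (≮⇒≥ ge)) =
      juxtapose p (≋-move (raise i c) q)

  ++-cong : ∀ {u₁ u₂ w₁ w₂} → u₁ ≋ w₁ → u₂ ≋ w₂ → u₁ ++ u₂ ≋ w₁ ++ w₂
  ++-cong p q = ≋-coinduction Juxtaposed juxtaposed-compatible (juxtapose p q)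

  ∷-cong : ∀ x {u w} → u ≋ w → x ∷ u ≋ x ∷ w
  ∷-cong x p = ++-cong {x ∷ []} ≋-refl p

  ++-congˡ : ∀ u {v w} → v ≋ w → u ++ v ≋ u ++ w
  ++-congˡ u p = ++-cong {u} ≋-refl p

  ++-congʳ : ∀ v {u w} → u ≋ w → u ++ v ≋ w ++ v
  ++-congʳ v p = ++-cong p (≋-refl {v})

  isolated : ∀ {u} → (∀ i → Colour i → SameSignature i u []) → u ≋ []
  isolated {u} iso = ≋-coinduction R closed (refl , refl)
    where
    R : Word → Word → Set
    R v w = v ≡ u × w ≡ []
    closed : ∀ {v w} → R v w → ∀ i → Colour i → Compatible R i v w
    closed (refl , refl) i c with a , b ← iso i c =
      (a , b) , (f-undefined i u a , refl) , (e-undefined i u b , refl)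

  Knuth⇒≋ : ∀ {u w} v → Knuth u w → u ++ v ≋ w ++ v
  Knuth⇒≋ v k = ++-congʳ v (≋-coinduction Knuth (λ r i _ → Knuth-compatible r i) k)

  module ≋-Reasoning = SetoidReasoning ≋-setoid

  -- The relation y x z ~ y z x carries the large letter z up through the column; the top letter
  -- stays in front because it is the y of the last exchange.
  slide : ∀ b j z v → b + j ≤ z → down b (suc j) ++ z ∷ v ≋ b + j ∷ z ∷ down b j ++ v
  slide b zero    z v le = ≋-refl
  slide b (suc j) z v le = begin
    b + suc j ∷ down b (suc j) ++ z ∷ v      ≈⟨ ∷-cong (b + suc j) (slide b j z v (≤-trans (+-monoʳ-≤ b (n≤1+n j)) le)) ⟩
    b + suc j ∷ b + j ∷ z ∷ down b j ++ v    ≈⟨ ≋-sym (Knuth⇒≋ (down b j ++ v) (yzx-yxz (+-monoʳ-< b ≤-refl) le)) ⟩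
    b + suc j ∷ z ∷ b + j ∷ down b j ++ v    ∎
    where open ≋-Reasoning

  -- The letter b+k travels through the shorter column and becomes the new top of the longer one.
  -- Each level costs one relation z x y ~ x z y, with two slides to bring its three letters
  -- together and apart again.
  insert : ∀ b j k → j ≤ k → b + k ∷ down b j ++ down b k ≋ down b j ++ down b (suc k)
  insert b zero    k       le = ≋-refl
  insert b (suc j) (suc k) (s≤s le) = begin
    b + suc k ∷ down b (suc j) ++ b + k ∷ down b k
      ≈⟨ ∷-cong (b + suc k) (slide b j (b + k) (down b k) (+-monoʳ-≤ b le)) ⟩
    b + suc k ∷ b + j ∷ b + k ∷ down b j ++ down b k
      ≈⟨ ≋-sym (Knuth⇒≋ (down b j ++ down b k) (xzy-zxy (+-monoʳ-≤ b le) (+-monoʳ-< b ≤-refl))) ⟩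
    b + j ∷ b + suc k ∷ b + k ∷ down b j ++ down b k
      ≈⟨ ∷-cong (b + j) (∷-cong (b + suc k) (insert b j k le)) ⟩
    b + j ∷ b + suc k ∷ down b j ++ down b (suc k)
      ≈⟨ ≋-sym (slide b j (b + suc k) (down b (suc k)) (+-monoʳ-≤ b (≤-trans le (n≤1+n k)))) ⟩
    down b (suc j) ++ b + suc k ∷ down b (suc k) ∎
    where open ≋-Reasoning

  commute-≤ : ∀ b j k → j ≤ k → down b k ++ down b j ≋ down b j ++ down b k
  commute-≤ b j k le with m≤n⇒m<n∨m≡n le
  ... | inj₂ refl = ≋-refl
  commute-≤ b j (suc k) _ | inj₁ (s≤s le) = ≋-trans (∷-cong (b + k) (commute-≤ b j k le)) (insert b j k le)

  commute : ∀ b j k → down b k ++ down b j ≋ down b j ++ down b k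
  commute b j k with ≤-total j k
  ... | inj₁ le = commute-≤ b j k le
  ... | inj₂ ge = ≋-sym (commute-≤ b k j ge)

  Source : Word → Set
  Source w = ∀ i → Colour i → ε i w ≡ 0

  cols : List ℕ → Word
  cols []      = []
  cols (k ∷ l) = down (suc o) k ++ cols l

  down-Source : ∀ k → Source (down (suc o) k)
  down-Source k i (lt , _) = down-ε (suc o) k λ eq → <-irrefl refl (subst (suc o ≤_) (suc-injective eq) lt)

  φ-Source-++ : ∀ {u} v {i} → ε i u ≡ 0 → φ i (u ++ v) ≡ φ i u + φ i v
  φ-Source-++ {u} v {i} s = trans (φ-++ i u v) (cong (λ k → φ i u + (φ i v ∸ k)) s)

  cols-Source : ∀ l → Source (cols l)
  cols-Source []      i c = refl
  cols-Source (k ∷ l) i c rewrite ε-++ i (down (suc o) k) (cols l) | cols-Source l i c | down-Source k i c = 0∸n≡0 (φ i (cols l))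

  φ-cols : ∀ k l {i} → Colour i → φ i (cols (k ∷ l)) ≡ φ i (down (suc o) k) + φ i (cols l)
  φ-cols k l {i} c = φ-Source-++ {down (suc o) k} (cols l) (down-Source k i c)

  Valid : List ℕ → Set
  Valid = All (λ k → 1 ≤ k × k ≤ m)

  φ-column : ∀ k → φ (o + suc k) (down (suc o) (suc k)) ≡ 1
  φ-column k rewrite +-suc o k = φ-down-top (suc o) k

  φ-column-≢ : ∀ {i} k → i ≢ o + suc k → φ i (down (suc o) (suc k)) ≡ 0
  φ-column-≢ {i} k ne = down-φ (suc o) k λ eq → ne (trans eq (sym (+-suc o k)))

  colour : ∀ {k} → 1 ≤ k × k ≤ m → Colour (o + k)
  colour {suc k} (_ , le) = subst (suc o ≤_) (sym (+-suc o k)) (s≤s (m≤m+n o k)) , +-monoʳ-≤ o le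

  -- In a product of columns `φ` in colour o+k counts the columns of height k; a positive value
  -- exhibits one, and commuting columns brings it to the front.
  extract : ∀ {l k} → Valid l → 1 ≤ k × k ≤ m → 1 ≤ φ (o + k) (cols l) → ∃ λ l′ → Valid l′ × cols l ≋ cols (k ∷ l′)
  extract {suc k′ ∷ l} {k} (v ∷ vs) vk pos with k ≟ suc k′
  ... | yes refl = l , vs , ≋-refl
  ... | no ne with l′ , vs′ , eq ← extract {l} vs vk
           (subst (1 ≤_) (trans (φ-cols (suc k′) l (colour vk)) (cong (_+ φ (o + k) (cols l)) (φ-column-≢ k′ (λ eq → ne (+-cancelˡ-≡ o _ _ eq))))) pos) =
    suc k′ ∷ l′ , v ∷ vs′ , (begin
      down (suc o) (suc k′) ++ cols l                        ≈⟨ ++-congˡ (down (suc o) (suc k′)) eq ⟩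
      down (suc o) (suc k′) ++ down (suc o) k ++ cols l′     ≡⟨ sym (++-assoc (down (suc o) (suc k′)) _ _) ⟩
      (down (suc o) (suc k′) ++ down (suc o) k) ++ cols l′   ≈⟨ ++-congʳ (cols l′) (commute (suc o) k (suc k′)) ⟩
      (down (suc o) k ++ down (suc o) (suc k′)) ++ cols l′   ≡⟨ ++-assoc (down (suc o) k) _ _ ⟩
      down (suc o) k ++ down (suc o) (suc k′) ++ cols l′     ∎)
    where open ≋-Reasoning

  -- It contains every letter of the window once, so all its brackets match: this is the
  -- one-dimensional determinant crystal. Hence heights beyond m never have to be recorded.
  full-column : down (suc o) (suc m) ≋ []
  full-column = isolated λ i c → trans (down-φ (suc o) m (λ eq → <-irrefl refl (≤-trans (s≤s (proj₂ c)) (≤-reflexive (sym eq))))) refl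
                               , down-Source (suc m) i c

  grow : ∀ k l → k ≤ m → Valid l → ∃ λ l′ → Valid l′ × suc o + k ∷ cols (k ∷ l) ≋ cols l′
  grow k l le vl with m≤n⇒m<n∨m≡n le
  ... | inj₁ lt   = suc k ∷ l , (s≤s z≤n , lt) ∷ vl , ≋-refl
  ... | inj₂ refl = l , vl , ++-congʳ (cols l) full-column

  Source-tail : ∀ x w → Source (x ∷ w) → Source w
  Source-tail x w s i c = ε-tail i x w (s i c)

  Source-opening : ∀ i w → Source (suc i ∷ w) → Colour i → 1 ≤ φ i w
  Source-opening i w s c with φ i w | s i c
  ... | suc _ | _ = s≤s z≤n
  ... | zero  | z rewrite role-opening i with () ← z

  outside-isolated : ∀ {x} → (∀ i → Colour i → x ≢ i × x ≢ suc i) → x ∷ [] ≋ []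
  outside-isolated p = isolated λ i c → let a , b = p i c in φ-neutral [] a b , ε-neutral [] a b

  -- Prepending a letter to a source lengthens one of its columns, by the source condition.
  source⇒cols : ∀ w → Source w → ∃ λ l → Valid l × w ≋ cols l
  source⇒cols []      _ = [] , [] , ≋-refl
  source⇒cols (x ∷ w) s with l , vl , eq ← source⇒cols w (Source-tail x w s) | suc o ≤? x | x ≤? suc o + m
  ... | no lt | _ = l , vl , ++-cong {x ∷ []} {w} {[]} (outside-isolated λ i c →
    (λ { refl → lt (proj₁ c) }) , (λ { refl → lt (≤-trans (proj₁ c) (n≤1+n i)) })) eq
  ... | yes _ | no gt = l , vl , ++-cong {x ∷ []} {w} {[]} (outside-isolated λ i c →
    (λ { refl → gt (≤-trans (proj₂ c) (n≤1+n _)) }) , (λ { refl → gt (s≤s (proj₂ c)) })) eq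
  ... | yes le | yes le′ with m≤n⇒∃[o]m+o≡n le
  ...   | zero , refl with l′ , vl′ , eq′ ← grow 0 l z≤n vl =
    l′ , vl′ , ≋-trans (∷-cong (suc o + 0) eq) eq′
  ...   | suc j , refl
    with v ← (s≤s z≤n , +-cancelˡ-≤ (suc o) _ _ le′)
    with l₀ , vl₀ , eq₀ ← extract {k = suc j} vl v (subst (1 ≤_) (proj₁ (≋-signature eq (colour v))) (Source-opening (o + suc j) w s (colour v)))
    with l′ , vl′ , eq′ ← grow (suc j) l₀ (proj₂ v) vl₀ =
    l′ , vl′ , ≋-trans (∷-cong (suc o + suc j) (≋-trans eq eq₀)) eq′

  cols-cong : ∀ l l′ → Valid l → Valid l′ → (∀ i → Colour i → φ i (cols l) ≡ φ i (cols l′)) → cols l ≋ cols l′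
  cols-cong []          []          _ _ _ = ≋-refl
  cols-cong []          (suc k ∷ l′) _ (v ∷ vs) eq with () ← trans (eq _ (colour v)) (trans (φ-cols (suc k) l′ (colour v)) (cong (_+ φ (o + suc k) (cols l′)) (φ-column k)))
  cols-cong (suc k ∷ l) l′ (v ∷ vs) vs′ eq
    with l₀ , vs₀ , eq₀ ← extract vs′ v (subst (1 ≤_) (eq _ (colour v)) (subst (1 ≤_) (sym (trans (φ-cols (suc k) l (colour v)) (cong (_+ φ (o + suc k) (cols l)) (φ-column k)))) (s≤s z≤n))) =
    ≋-trans (++-congˡ (down (suc o) (suc k)) (cols-cong l l₀ vs vs₀ λ i c → +-cancelˡ-≡ (φ i (down (suc o) (suc k))) _ _
      (trans (sym (φ-cols (suc k) l c)) (trans (eq i c) (trans (proj₁ (≋-signature eq₀ c)) (φ-cols (suc k) l₀ c))))))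
      (≋-sym eq₀)

  -- This plays the role of the uniqueness of the crystal with a given parameter: both words reduce
  -- to products of columns, and `φ` gives the multiplicity of every height.
  sources-bisimilar : ∀ {u w} → Source u → Source w → (∀ i → Colour i → φ i u ≡ φ i w) → u ≋ w
  sources-bisimilar {u} {w} su sw eq with l , vl , p ← source⇒cols u su | l′ , vl′ , q ← source⇒cols w sw =
    ≋-trans p (≋-trans (cols-cong l l′ vl vl′ λ i c →
      trans (sym (proj₁ (≋-signature p c))) (trans (eq i c) (proj₁ (≋-signature q c)))) (≋-sym q))

-- Uniqueness of sources

⟶-sum : ∀ {i u v} → u ⟶[ i ] v → sum v ≡ suc (sum u)
⟶-sum (here _)                = refl
⟶-sum (there {x = x} {w} _ s) = trans (cong (x +_) (⟶-sum s)) (+-suc x (sum w))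

⟶-All : ∀ {i u v} {P : ℕ → Set} → u ⟶[ i ] v → (P i → P (suc i)) → All P u → All P v
⟶-All (here _)    g (p ∷ ps) = g p ∷ ps
⟶-All (there _ s) g (p ∷ ps) = p ∷ ⟶-All s g ps

⟵-All : ∀ {i u v} {P : ℕ → Set} → u ⟶[ i ] v → (P (suc i) → P i) → All P v → All P u
⟵-All (here _)    g (p ∷ ps) = g p ∷ ps
⟵-All (there _ s) g (p ∷ ps) = p ∷ ⟵-All s g ps

⟶-length : ∀ {i u v} → u ⟶[ i ] v → length v ≡ length u
⟶-length (here _)    = refl
⟶-length (there _ s) = cong suc (⟶-length s)

data Descending (o : ℕ) : Word → Set where
  []   : Descending o []
  cons : ∀ {x w} → o < x → All (_< x) w → Descending o w → Descending o (x ∷ w)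

φ-small : ∀ {i w} → All (_< i) w → φ i w ≡ 0
φ-small []                    = refl
φ-small {i} {x ∷ w} (lt ∷ ps) = trans (φ-neutral w (<⇒≢ lt) (<⇒≢ (m≤n⇒m≤1+n lt))) (φ-small ps)

φ-descending : ∀ {o i w} → Descending o w → All (_< suc i) w → φ i w ≤ 1
φ-descending [] _ = z≤n
φ-descending {i = i} (cons {x} {w} _ ps d) (lt ∷ lts) with role i x | roleView i x
... | neutral | _       = φ-descending d lts
... | closing | closing = s≤s (≤-reflexive (φ-small ps))
... | opening | opening = contradiction lt (<-irrefl refl)

descending-avoids : ∀ {o i w} → Descending o w → All (_< suc i) w → φ i w ≡ 0 → All (_< i) w
descending-avoids [] _ _ = []
descending-avoids {i = i} (cons {x} {w} _ ps d) (lt ∷ _) z with role i x | roleView i x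
... | neutral | neutral ne _ = x<i ∷ All.map (λ y<x → <-trans y<x x<i) ps
  where x<i = ≤∧≢⇒< (s≤s⁻¹ lt) ne
... | opening | opening = contradiction lt (<-irrefl refl)

⟶-descending : ∀ {o i u v} → u ⟶[ i ] v → Descending o u → Descending o v
⟶-descending (here _) (cons lt ps d) = cons (m≤n⇒m≤1+n lt) (All.map m≤n⇒m≤1+n ps) d
⟶-descending {i = i} (there {x = x} pass s) (cons lt ps d) = cons lt (⟶-All s step ps) (⟶-descending s d)
  where
  step : i < x → suc i < x
  step i<x with x ≟ suc i
  ... | no ne    = ≤∧≢⇒< i<x (≢-sym ne)
  -- A step inside the tail behind a letter i+1 needs two unmatched i there, but a strictly
  -- decreasing tail has at most one.
  ... | yes refl = contradiction (≤-trans (pass refl) (φ-descending d ps)) λ { (s≤s ()) }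

⟵-descending : ∀ {o i u v} → o < i → u ⟶[ i ] v → Descending o v → Descending o u
⟵-descending lt (here z)    (cons _ ps d)  = cons lt (descending-avoids d ps z) d
⟵-descending lt (there _ s) (cons lt′ ps d) = cons lt′ (⟵-All s (λ p → <-trans ≤-refl p) ps) (⟵-descending lt s d)

descending-head : ∀ {o x w} → Descending o (x ∷ w) → suc o + length w ≤ x
descending-head {o} {x} (cons lt [] _) = subst (_≤ x) (sym (+-identityʳ (suc o))) lt
descending-head {o} {x} (cons {w = y ∷ w} _ (y<x ∷ _) d) = subst (_≤ x) (sym (+-suc (suc o) (length w))) (≤-trans (s≤s (descending-head d)) y<x)

sum-descending : ∀ {o w} → Descending o w → sum (down (suc o) (length w)) ≤ sum w
sum-descending [] = z≤n
sum-descending d@(cons _ _ d′) = +-mono-≤ (descending-head d) (sum-descending d′)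

-- The invariant of a component: the factors stay strictly decreasing and keep their lengths. Since
-- `down (suc o) k` has the least sum among such factors of length k, it bounds the letter sum from
-- below.
data DescendingColumns (o : ℕ) : List ℕ → Word → Set where
  []  : DescendingColumns o [] []
  _∷_ : ∀ {k l c w} → Descending o c × length c ≡ k → DescendingColumns o l w → DescendingColumns o (k ∷ l) (c ++ w)

down-< : ∀ j k → All (_< j + k) (down j k)
down-< j zero    = []
down-< j (suc k) rewrite +-suc j k = ≤-refl ∷ All.map m≤n⇒m≤1+n (down-< j k)

down-descending : ∀ o k → Descending o (down (suc o) k) × length (down (suc o) k) ≡ k
down-descending o zero    = [] , refl
down-descending o (suc k) with d , eq ← down-descending o k = cons (m≤m+n (suc o) k) (down-< (suc o) k) d , cong suc eq

f-column : ∀ {o k c} i → Descending o c × length c ≡ k → Descending o (f i c) × length (f i c) ≡ k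
f-column {c = c} i (d , eq) with φ i c in z
... | zero  rewrite f-undefined i c z = d , eq
... | suc _ = ⟶-descending s d , trans (⟶-length s) eq
  where s = f-defined i c (subst (1 ≤_) (sym z) (s≤s z≤n))

e-column : ∀ {o k c} i → o < i → Descending o c × length c ≡ k → Descending o (e i c) × length (e i c) ≡ k
e-column {c = c} i lt (d , eq) with ε i c in z
... | zero  rewrite e-undefined i c z = d , eq
... | suc _ = ⟵-descending lt s d , trans (sym (⟶-length s)) eq
  where s = e-defined i c (subst (1 ≤_) (sym z) (s≤s z≤n))

f-columns : ∀ {o l w} i → DescendingColumns o l w → DescendingColumns o l (f i w)
f-columns i [] = []
f-columns i (_∷_ {c = c} {w} d ds) with ε i c <? φ i w
... | yes lt rewrite f-++ʳ i c w lt = d ∷ f-columns i ds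
... | no ge rewrite f-++ˡ i c w (≮⇒≥ ge) = f-column i d ∷ ds

e-columns : ∀ {o l w} i → o < i → DescendingColumns o l w → DescendingColumns o l (e i w)
e-columns i _ [] = []
e-columns i o<i (_∷_ {c = c} {w} d ds) with φ i w <? ε i c
... | yes lt rewrite e-++ˡ i c w lt = e-column i o<i d ∷ ds
... | no ge rewrite e-++ʳ i c w (≮⇒≥ ge) = d ∷ e-columns i o<i ds

Conn-trans : ∀ {lo hi u v w} → Conn lo hi u v → Conn lo hi v w → Conn lo hi u w
Conn-trans c-refl              d = d
Conn-trans (c-fwd i p q eq c)  d = c-fwd i p q eq (Conn-trans c d)
Conn-trans (c-bwd i p q eq c)  d = c-bwd i p q eq (Conn-trans c d)

Conn-sym : ∀ {lo hi u v} → Conn lo hi u v → Conn lo hi v u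
Conn-sym c-refl             = c-refl
Conn-sym (c-fwd i p q eq c) = Conn-trans (Conn-sym c) (c-bwd i p q eq c-refl)
Conn-sym (c-bwd i p q eq c) = Conn-trans (Conn-sym c) (c-fwd i p q eq c-refl)

⟶-F : ∀ {i u v} → u ⟶[ i ] v → F i u ≡ just v
⟶-F {i} {u} s = trans (F-f i u (subst (1 ≤_) (sym (⟶-φ s)) (s≤s z≤n))) (cong just (⟶-f s))
  
Conn-f : ∀ {lo hi} i w → lo ≤ i → i ≤ hi → Conn lo hi w (f i w)
Conn-f i w p q with φ i w in z
... | zero  rewrite f-undefined i w z = c-refl
... | suc _ = c-fwd i p q (F-f i w (subst (1 ≤_) (sym z) (s≤s z≤n))) c-refl

Conn-e : ∀ {lo hi} i w → lo ≤ i → i ≤ hi → Conn lo hi w (e i w)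
Conn-e i w p q with ε i w in z
... | zero  rewrite e-undefined i w z = c-refl
... | suc _ = c-bwd i p q (⟶-F (e-defined i w (subst (1 ≤_) (sym z) (s≤s z≤n)))) c-refl

-- A step either changes the first letter and leaves the tail alone, or is itself a step of the
-- tail; so deleting first letters preserves connectedness.
Conn-tail : ∀ {lo hi x u v} → Conn lo hi (x ∷ u) v → ∃ λ x′ → ∃ λ u′ → v ≡ x′ ∷ u′ × Conn lo hi u u′
Conn-tail c-refl = _ , _ , refl , c-refl
Conn-tail {x = x} {u} (c-fwd {v = v} i p q eq c) with F-just {i} {x ∷ u} {v} eq
... | here _    = Conn-tail c
... | there _ s with _ , _ , eq′ , c′ ← Conn-tail c = _ , _ , eq′ , c-fwd i p q (⟶-F s) c′
Conn-tail {x = x} {u} (c-bwd {v = v} i p q eq c) with F-just {i} {v} {x ∷ u} eq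
... | here _    = Conn-tail c
... | there _ s with _ , _ , eq′ , c′ ← Conn-tail c = _ , _ , eq′ , c-bwd i p q (⟶-F s) c′

Conn-[] : ∀ {lo hi v} → Conn lo hi [] v → v ≡ []
Conn-[] c-refl = refl
Conn-[] (c-fwd {v = v} i p q eq c) with () ← F-just {i} {[]} {v} eq
Conn-[] (c-bwd {v = v} i p q eq c) with () ← F-just {i} {v} {[]} eq

fs : List ℕ → Word → Word
fs []      w = w
fs (i ∷ L) w = fs L (f i w)

Conn-fs : ∀ {lo hi L} w → All (λ i → lo ≤ i × i ≤ hi) L → Conn lo hi w (fs L w)
Conn-fs w []       = c-refl
Conn-fs {L = i ∷ _} w (c ∷ cs) = Conn-trans (Conn-f i w (proj₁ c) (proj₂ c)) (Conn-fs (f i w) cs)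

module WindowUniqueness (o m : ℕ) where
  open Window o m public

  Connected : Word → Word → Set
  Connected = Conn (suc o) (o + m)

  connected-run : ∀ {u v} → Connected u v → ∃ λ X → run X u ≡ v
  connected-run c-refl = [] , refl
  connected-run {u} (c-fwd {v = v} i p q eq c) with X , eq′ ← connected-run c =
    lower i (p , q) ∷ X , trans (cong (run X) (⟶-f (F-just {i} {u} {v} eq))) eq′
  connected-run {u} (c-bwd {v = v} i p q eq c) with X , eq′ ← connected-run c =
    raise i (p , q) ∷ X , trans (cong (run X) (⟶-e (F-just {i} {v} {u} eq))) eq′

  -- Bisimilar words move or rest together, so their letter sums change by the same amount. The
  -- equality of differences is written with additions to avoid truncated subtraction.
  sum-move : ∀ x {u w} → u ≋ w → sum (move x u) + sum w ≡ sum (move x w) + sum u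
  sum-move (lower i c) {u} {w} r with φ i u in z | ≋-signature r c
  ... | zero | a , _ rewrite f-undefined i u z | f-undefined i w (sym a) = +-comm (sum u) (sum w)
  ... | suc k | a , _
    rewrite ⟶-sum (f-defined i u (subst (1 ≤_) (sym z) (s≤s z≤n)))
          | ⟶-sum (f-defined i w (subst (1 ≤_) a (s≤s z≤n))) = cong suc (+-comm (sum u) (sum w))
  sum-move (raise i c) {u} {w} r with ε i u in z | ≋-signature r c
  ... | zero | _ , a rewrite e-undefined i u z | e-undefined i w (sym a) = +-comm (sum u) (sum w)
  ... | suc k | _ , a = begin
    sum (e i u) + sum w           ≡⟨ cong (sum (e i u) +_) (⟶-sum (e-defined i w (subst (1 ≤_) a (s≤s z≤n)))) ⟩
    sum (e i u) + suc (sum (e i w)) ≡⟨ +-suc _ _ ⟩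
    suc (sum (e i u) + sum (e i w)) ≡⟨ cong suc (+-comm (sum (e i u)) _) ⟩
    suc (sum (e i w) + sum (e i u)) ≡⟨ sym (+-suc _ _) ⟩
    sum (e i w) + suc (sum (e i u)) ≡⟨ cong (sum (e i w) +_) (sym (⟶-sum (e-defined i u (subst (1 ≤_) (sym z) (s≤s z≤n))))) ⟩
    sum (e i w) + sum u ∎
    where open ≡-Reasoning

  sum-run : ∀ X {u w} → u ≋ w → sum (run X u) + sum w ≡ sum (run X w) + sum u
  sum-run []      {u} {w} r = +-comm (sum u) (sum w)
  sum-run (x ∷ X) {u} {w} r = +-cancelʳ-≡ (sum (move x u) + sum (move x w)) _ _ (begin
    (sum (run X u′) + sum w) + (sum u′ + sum w′)   ≡⟨ shuffle (sum (run X u′)) (sum w) (sum u′) (sum w′) ⟩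
    (sum (run X u′) + sum w′) + (sum u′ + sum w)   ≡⟨ cong₂ _+_ (sum-run X (≋-move x r)) (sum-move x r) ⟩
    (sum (run X w′) + sum u′) + (sum w′ + sum u)   ≡⟨ shuffle (sum (run X w′)) (sum u′) (sum w′) (sum u) ⟩
    (sum (run X w′) + sum u) + (sum w′ + sum u′)   ≡⟨ cong ((sum (run X w′) + sum u) +_) (+-comm (sum w′) (sum u′)) ⟩
    (sum (run X w′) + sum u) + (sum u′ + sum w′)   ∎)
    where
    open ≡-Reasoning
    u′ = move x u
    w′ = move x w
    shuffle : ∀ a b c d → (a + b) + (c + d) ≡ (a + d) + (c + b)
    shuffle a b c d = begin
      (a + b) + (c + d) ≡⟨ +-assoc a b (c + d) ⟩
      a + (b + (c + d)) ≡⟨ cong (a +_) (trans (+-comm b (c + d)) (trans (cong (_+ b) (+-comm c d)) (+-assoc d c b))) ⟩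
      a + (d + (c + b)) ≡⟨ sym (+-assoc a d (c + b)) ⟩
      (a + d) + (c + b) ∎

  run-columns : ∀ {l w} X → DescendingColumns o l w → DescendingColumns o l (run X w)
  run-columns []                    d = d
  run-columns (lower i _ ∷ X)       d = run-columns X (f-columns i d)
  run-columns (raise i (lt , _) ∷ X) d = run-columns X (e-columns i lt d)

  sum-columns : ∀ {l w} → DescendingColumns o l w → sum (cols l) ≤ sum w
  sum-columns [] = z≤n
  sum-columns (_∷_ {l = l} {c} {w} (d , refl) ds) = subst₂ _≤_ (sym (sum-++ (down (suc o) (length c)) (cols l))) (sym (sum-++ c w))
    (+-mono-≤ (sum-descending d) (sum-columns ds))

  cols-descending : ∀ l → DescendingColumns o l (cols l)
  cols-descending []      = []
  cols-descending (k ∷ l) = down-descending o k ∷ cols-descending l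

  -- The bisimilar product of columns has the least letter sum along every run, and `sum-run`
  -- transfers the comparison to u, whose own factors are unknown.
  source-minimal : ∀ {u v} → Source u → Connected u v → sum u ≤ sum v
  source-minimal {u} {v} s c with l , _ , r ← source⇒cols u s | X , refl ← connected-run c =
    +-cancelʳ-≤ (sum (cols l)) _ _ (subst (_≤ sum (run X u) + sum (cols l)) (+-comm (sum (cols l)) (sum u))
      (≤-trans (+-monoˡ-≤ (sum u) (sum-columns (run-columns X (cols-descending l)))) (≤-reflexive (sym (sum-run X r)))))

  -- Deleting the first letter is compatible with the operators; the first letter itself is recovered from the letter sum.
  source-unique : ∀ {u v} → Source u → Source v → Connected u v → u ≡ v
  source-unique {[]}    _  _  c = sym (Conn-[] c)
  source-unique {x ∷ u} su sv c with x′ , u′ , refl , c′ ← Conn-tail c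
    with refl ← source-unique (Source-tail x u su) (Source-tail x′ u′ sv) c′ =
    cong (_∷ u) (+-cancelʳ-≡ (sum u) x x′ (≤-antisym (source-minimal su c) (source-minimal sv (Conn-sym c))))

  source-up-to? : ∀ w k → k ≤ m → (∀ i → suc o ≤ i → i ≤ o + k → ε i w ≡ 0) ⊎ ∃ λ i → Colour i × 1 ≤ ε i w
  source-up-to? w zero _ = inj₁ λ i p q → contradiction (≤-trans p (≤-trans q (≤-reflexive (+-identityʳ o)))) (<-irrefl refl)
  source-up-to? w (suc k) le with source-up-to? w k (≤-trans (n≤1+n k) le)
  ... | inj₂ found = inj₂ found
  ... | inj₁ none with ε (o + suc k) w in z
  ...   | suc _ = inj₂ (o + suc k , colour (s≤s z≤n , le) , subst (1 ≤_) (sym z) (s≤s z≤n))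
  ...   | zero  = inj₁ none′
    where
    none′ : ∀ i → suc o ≤ i → i ≤ o + suc k → ε i w ≡ 0
    none′ i p q with m≤n⇒m<n∨m≡n q
    ... | inj₁ lt = none i p (s≤s⁻¹ (subst (suc i ≤_) (+-suc o k) lt))
    ... | inj₂ refl = z

  source? : ∀ w → Source w ⊎ ∃ λ i → Colour i × 1 ≤ ε i w
  source? w with source-up-to? w m ≤-refl
  ... | inj₁ none  = inj₁ λ i c → none i (proj₁ c) (proj₂ c)
  ... | inj₂ found = inj₂ found

  -- Raising both words by the same operator keeps them bisimilar and connected and lowers the
  -- letter sum; once a source is reached, `source-unique` applies, and lowering undoes the raising.
  bisimilar-connected⇒≡ : ∀ {u v} → u ≋ v → Connected u v → u ≡ v
  bisimilar-connected⇒≡ {u} {v} = go u v (<-wellFounded (sum u))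
    where
    go : ∀ u v → Acc _<_ (sum u) → u ≋ v → Connected u v → u ≡ v
    go u v (acc rec) r c with source? u
    ... | inj₁ s = source-unique s (λ i ci → trans (sym (proj₂ (≋-signature r ci))) (s i ci)) c
    ... | inj₂ (i , ci , pos) = begin
      u           ≡⟨ sym (⟶-f su) ⟩
      f i (e i u) ≡⟨ cong (f i) (go (e i u) (e i v) (rec (subst (sum (e i u) <_) (sym (⟶-sum su)) ≤-refl)) (≋-move (raise i ci) r)
                       (Conn-trans (Conn-sym (Conn-e i u (proj₁ ci) (proj₂ ci))) (Conn-trans c (Conn-e i v (proj₁ ci) (proj₂ ci))))) ⟩
      f i (e i v) ≡⟨ ⟶-f (e-defined i v (subst (1 ≤_) (proj₂ (≋-signature r ci)) pos)) ⟩
      v           ∎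
      where
      open ≡-Reasoning
      su = e-defined i u pos

  Colours : List ℕ → Set
  Colours = All Colour

  ≋-fs : ∀ {L u w} → Colours L → u ≋ w → fs L u ≋ fs L w
  ≋-fs []       r = r
  ≋-fs (c ∷ cs) r = ≋-fs cs (≋-move (lower _ c) r)

  -- The two results on w are bisimilar through the common result on u, and connected through w
  -- itself.
  transport : ∀ {u w L M} → u ≋ w → Colours L → Colours M → fs L u ≡ fs M u → fs L w ≡ fs M w
  transport {u} {w} {L} {M} r cL cM eq = bisimilar-connected⇒≡
    (≋-trans (≋-fs cL (≋-sym r)) (subst (_≋ fs M w) (sym eq) (≋-fs cM r)))
    (Conn-trans (Conn-sym (Conn-fs w cL)) (Conn-fs w cM))

-- Operators acting factor by factor

-- The function `fs` silently skips undefined operators. Here every step really happens, which the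
-- tensor product rule needs and which later allows exponents to be read off from letter counts.
data Eff : List ℕ → Word → Word → Set where
  []  : ∀ {u} → Eff [] u u
  _∷_ : ∀ {i L u v w} → u ⟶[ i ] v → Eff L v w → Eff (i ∷ L) u w

Eff-fs : ∀ {L u v} → Eff L u v → fs L u ≡ v
Eff-fs []                   = refl
Eff-fs (_∷_ {L = L} s run) = trans (cong (fs L) (⟶-f s)) (Eff-fs run)

Eff-++ : ∀ {L M u v w} → Eff L u v → Eff M v w → Eff (L ++ M) u w
Eff-++ []        r′ = r′
Eff-++ (s ∷ r) r′ = s ∷ Eff-++ r r′

fs-++ : ∀ L M w → fs (L ++ M) w ≡ fs M (fs L w)
fs-++ []      M w = refl
fs-++ (i ∷ L) M w = fs-++ L M (f i w)

Eff-between : ∀ {L x y} {C : ℕ → Set} h l → All C L → (∀ i → C i → ε i h ≡ 0) → (∀ i → C i → φ i l ≡ 0) →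
  Eff L x y → Eff L (h ++ x ++ l) (h ++ y ++ l)
Eff-between h l _        εh φl []      = []
Eff-between {x = x} h l (c ∷ cs) εh φl (_∷_ {i} {v = v} s r) =
  ⟶-++ʳ h (subst₂ _<_ (sym (εh i c)) (sym (⟶-φ s′)) (s≤s z≤n)) s′ ∷ Eff-between h l cs εh φl r
  where
  s′ : x ++ l ⟶[ i ] v ++ l
  s′ = ⟶-++ˡ l (subst (_≤ ε i x) (sym (φl i c)) z≤n) s

times : ℕ → List ℕ → List ℕ
times zero    L = []
times (suc n) L = L ++ times n L

times-snoc : ∀ n L → times n L ++ L ≡ L ++ times n L
times-snoc zero    L = sym (++-identityʳ L)
times-snoc (suc n) L = trans (++-assoc L (times n L) L) (cong (L ++_) (times-snoc n L))

times-[] : ∀ n → times n [] ≡ []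
times-[] zero    = refl
times-[] (suc n) = times-[] n

blocks : (ℕ → Word) → (ℕ → ℕ) → ℕ → Word
blocks X a zero    = []
blocks X a (suc k) = times (a (suc k)) (X (suc k)) ++ blocks X a k

-- The index runs opposite to that of `blocks`: the rightmost factor of a product must be finished
-- before operators can reach its left neighbour.
blockOps : (ℕ → List ℕ) → (ℕ → ℕ) → ℕ → List ℕ
blockOps O a zero    = []
blockOps O a (suc k) = blockOps O a k ++ times (a (suc k)) (O (suc k))

-- Exactly what makes runs compose over products: `ε` zero at the start lets operators pass x to the
-- factors on its right, and `φ` zero at the end stops y from blocking the factors on its left.
record Clean (C : ℕ → Set) (L : List ℕ) (x y : Word) : Set where
  constructor clean
  field
    colours : All C L
    εˣ : ∀ i → C i → ε i x ≡ 0
    φʸ : ∀ i → C i → φ i y ≡ 0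
    eff : Eff L x y
open Clean

ε-++-0 : ∀ {i} u v → ε i u ≡ 0 → ε i v ≡ 0 → ε i (u ++ v) ≡ 0
ε-++-0 {i} u v p q rewrite ε-++ i u v | p | q = 0∸n≡0 (φ i v)

φ-++-0 : ∀ {i} u v → φ i u ≡ 0 → φ i v ≡ 0 → φ i (u ++ v) ≡ 0
φ-++-0 {i} u v p q rewrite φ-++ i u v | p | q = 0∸n≡0 (ε i u)

ε-times : ∀ {i} n x → ε i x ≡ 0 → ε i (times n x) ≡ 0
ε-times zero    x p = refl
ε-times (suc n) x p = ε-++-0 x (times n x) p (ε-times n x p)

φ-times-0 : ∀ {i} n x → φ i x ≡ 0 → φ i (times n x) ≡ 0
φ-times-0 zero    x p = refl
φ-times-0 (suc n) x p = φ-++-0 x (times n x) p (φ-times-0 n x p)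

All-times : ∀ {C : ℕ → Set} n {L} → All C L → All C (times n L)
All-times zero    p = []
All-times (suc n) p = ++⁺ p (All-times n p)

Clean-times : ∀ {C L x y} n → Clean C L x y → Clean C (times n L) (times n x) (times n y)
Clean-times zero    c = clean [] (λ _ _ → refl) (λ _ _ → refl) []
Clean-times {C} {L} {x} {y} (suc n) c = clean (All-times (suc n) (colours c))
  (λ i ci → ε-times (suc n) x (εˣ c i ci)) (λ i ci → φ-times-0 (suc n) y (φʸ c i ci))
  (subst (λ M → Eff M (x ++ times n x) (y ++ times n y)) (times-snoc n L) (Eff-++ first second))
  where
  rest = Clean-times n c
  first : Eff (times n L) (x ++ times n x) (x ++ times n y)
  first = subst₂ (Eff (times n L)) (cong (x ++_) (++-identityʳ (times n x))) (cong (x ++_) (++-identityʳ (times n y)))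
    (Eff-between x [] (colours rest) (εˣ c) (λ _ _ → refl) (eff rest))
  second : Eff L (x ++ times n y) (y ++ times n y)
  second = Eff-between [] (times n y) (colours c) (λ _ _ → refl) (φʸ rest) (eff c)

Clean-++ : ∀ {C L L′ x x′ y y′} → Clean C L x y → Clean C L′ x′ y′ → Clean C (L′ ++ L) (x ++ x′) (y ++ y′)
Clean-++ {C} {L} {L′} {x} {x′} {y} {y′} c c′ = clean (++⁺ (colours c′) (colours c))
  (λ i ci → ε-++-0 x x′ (εˣ c i ci) (εˣ c′ i ci)) (λ i ci → φ-++-0 y y′ (φʸ c i ci) (φʸ c′ i ci))
  (Eff-++ (subst₂ (Eff L′) (cong (x ++_) (++-identityʳ x′)) (cong (x ++_) (++-identityʳ y′))
            (Eff-between x [] (colours c′) (εˣ c) (λ _ _ → refl) (eff c′)))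
          (Eff-between [] y′ (colours c) (λ _ _ → refl) (φʸ c′) (eff c)))

Clean-blocks : ∀ {C} O X Y a N → (∀ k → k < N → Clean C (O (suc k)) (X (suc k)) (Y (suc k))) →
  Clean C (blockOps O a N) (blocks X a N) (blocks Y a N)
Clean-blocks O X Y a zero    c = clean [] (λ _ _ → refl) (λ _ _ → refl) []
Clean-blocks O X Y a (suc N) c = Clean-++ (Clean-times (a (suc N)) (c N ≤-refl)) (Clean-blocks O X Y a N (λ k lt → c k (m≤n⇒m≤1+n lt)))

Eff-clean : ∀ {C L x y} h → (∀ i → C i → ε i h ≡ 0) → Clean C L x y → Eff L (h ++ x) (h ++ y)
Eff-clean {L = L} {x} {y} h εh c = subst₂ (Eff L) (cong (h ++_) (++-identityʳ x)) (cong (h ++_) (++-identityʳ y))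
  (Eff-between h [] (colours c) εh (λ _ _ → refl) (eff c))

blocks-cong : ∀ {X Y} a N → (∀ k → k < N → X (suc k) ≡ Y (suc k)) → blocks X a N ≡ blocks Y a N
blocks-cong a zero    eq = refl
blocks-cong a (suc N) eq = cong₂ _++_ (cong (times (a (suc N))) (eq N ≤-refl)) (blocks-cong a N (λ k lt → eq k (m≤n⇒m≤1+n lt)))

ε-blocks : ∀ {i X} a N → (∀ k → k < N → ε i (X (suc k)) ≡ 0) → ε i (blocks X a N) ≡ 0
ε-blocks         a zero    z = refl
ε-blocks {X = X} a (suc N) z = ε-++-0 (times (a (suc N)) (X (suc N))) (blocks X a N)
  (ε-times (a (suc N)) (X (suc N)) (z N ≤-refl)) (ε-blocks a N (λ k lt → z k (m≤n⇒m≤1+n lt)))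

weighted : (ℕ → ℕ) → (ℕ → ℕ) → ℕ → ℕ
weighted a d zero    = 0
weighted a d (suc k) = weighted a d k + a (suc k) * d (suc k)

φ-times : ∀ {i} n x → ε i x ≡ 0 → φ i (times n x) ≡ n * φ i x
φ-times zero x z = refl
φ-times {i} (suc n) x z rewrite φ-++ i x (times n x) | z = cong (φ i x +_) (φ-times n x z)

φ-blocks : ∀ {i X} a N → (∀ k → k < N → ε i (X (suc k)) ≡ 0) → φ i (blocks X a N) ≡ weighted a (λ k → φ i (X k)) N
φ-blocks         a zero    z = refl
φ-blocks {i} {X} a (suc N) z
  rewrite φ-++ i (times (a (suc N)) (X (suc N))) (blocks X a N) | ε-times (a (suc N)) (X (suc N)) (z N ≤-refl)
        | φ-times (a (suc N)) (X (suc N)) (z N ≤-refl) | φ-blocks {i} {X} a N (λ k lt → z k (m≤n⇒m≤1+n lt)) =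
  +-comm (a (suc N) * φ i (X (suc N))) _

ε-times-sink : ∀ {i} n x → φ i x ≡ 0 → ε i (times n x) ≡ n * ε i x
ε-times-sink zero x z = refl
ε-times-sink {i} (suc n) x z rewrite ε-++ i x (times n x) | φ-times-0 n x z =
  trans (+-comm _ (ε i x)) (cong (ε i x +_) (ε-times-sink n x z))

ε-blocks-sink : ∀ {i X} a N → (∀ k → k < N → φ i (X (suc k)) ≡ 0) → φ i (blocks X a N) ≡ 0 × ε i (blocks X a N) ≡ weighted a (λ k → ε i (X k)) N
ε-blocks-sink         a zero    z = refl , refl
ε-blocks-sink {i} {X} a (suc N) z with p , q ← ε-blocks-sink {i} {X} a N (λ k lt → z k (m≤n⇒m≤1+n lt)) =
  φ-++-0 (times (a (suc N)) (X (suc N))) (blocks X a N) (φ-times-0 (a (suc N)) (X (suc N)) (z N ≤-refl)) p ,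
  eq
  where
  eq : ε i (blocks X a (suc N)) ≡ weighted a (λ k → ε i (X k)) (suc N)
  eq rewrite ε-++ i (times (a (suc N)) (X (suc N))) (blocks X a N) | p | q | ε-times-sink (a (suc N)) (X (suc N)) (z N ≤-refl) = refl

weighted-zero : ∀ a d N → (∀ k → k < N → d (suc k) ≡ 0) → weighted a d N ≡ 0
weighted-zero a d zero    z = refl
weighted-zero a d (suc N) z rewrite z N ≤-refl | *-zeroʳ (a (suc N)) | weighted-zero a d N (λ k lt → z k (m≤n⇒m≤1+n lt)) = refl

weighted-single : ∀ a d N j → j < N → d (suc j) ≡ 1 → (∀ k → k < N → k ≢ j → d (suc k) ≡ 0) → weighted a d N ≡ a (suc j)
weighted-single a d (suc N) j lt one z with m≤n⇒m<n∨m≡n lt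
... | inj₂ refl rewrite weighted-zero a d N (λ k k<N → z k (m≤n⇒m≤1+n k<N) (<⇒≢ k<N)) | one = *-identityʳ (a (suc N))
... | inj₁ (s≤s lt′) rewrite z N ≤-refl (≢-sym (<⇒≢ lt′)) | *-zeroʳ (a (suc N)) =
  trans (+-identityʳ _) (weighted-single a d N j lt′ one (λ k k<N → z k (m≤n⇒m≤1+n k<N)))

replicate-++ : ∀ {A : Set} a b {x : A} → replicate a x ++ replicate b x ≡ replicate (a + b) x
replicate-++ zero    b = refl
replicate-++ (suc a) b = cong (_ ∷_) (replicate-++ a b)

times-replicate : ∀ a d i → times a (replicate d i) ≡ replicate (a * d) i
times-replicate zero    d i = refl
times-replicate (suc a) d i = trans (cong (replicate d i ++_) (times-replicate a d i)) (replicate-++ d (a * d))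

blockOps-replicate : ∀ a d i N → blockOps (λ k → replicate (d k) i) a N ≡ replicate (weighted a d N) i
blockOps-replicate a d i zero    = refl
blockOps-replicate a d i (suc N) = trans
  (cong₂ _++_ (blockOps-replicate a d i N) (times-replicate (a (suc N)) (d (suc N)) i)) (replicate-++ (weighted a d N) _)

-- Runs on a single column

Between : ℕ → ℕ → ℕ → Set
Between lo hi i = lo ≤ i × i ≤ hi

Eff-∷ : ∀ {L u v} x → All (λ i → x ≢ suc i) L → Eff L u v → Eff L (x ∷ u) (x ∷ v)
Eff-∷ x []       []      = []
Eff-∷ x (n ∷ ns) (s ∷ r) = there (λ eq → contradiction eq n) s ∷ Eff-∷ x ns r

-- The letters of the column are also the colours to apply: the top letter moves first and vacates
-- its place for the next one.
Eff-down : ∀ j k → Eff (down j k) (down j k) (down (suc j) k)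
Eff-down j zero    = []
Eff-down j (suc k) = here (proj₁ (down-below j k ≤-refl)) ∷
  Eff-∷ (suc (j + k)) (All.map (λ lt eq → <-irrefl (sym (suc-injective eq)) lt) (down-< j k)) (Eff-down j k)

-- For j = 1 and t = N-k+1 this is S_{N,k} in order of application; it carries the column k...1 to
-- the lowest one, N+1,...,N-k+2.
shifts : ℕ → ℕ → ℕ → List ℕ
shifts j k zero    = []
shifts j k (suc t) = down j k ++ shifts (suc j) k t

Eff-shifts : ∀ j k t → Eff (shifts j k t) (down j k) (down (t + j) k)
Eff-shifts j k zero    = []
Eff-shifts j k (suc t) = Eff-++ (Eff-down j k)
  (subst (λ b → Eff (shifts (suc j) k t) (down (suc j) k) (down b k)) (+-suc t j) (Eff-shifts (suc j) k t))

down-≥ : ∀ j k → All (j ≤_) (down j k)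
down-≥ j zero    = []
down-≥ j (suc k) = m≤m+n j k ∷ down-≥ j k

shifts-between : ∀ {N} j k t → t + (j + k) ≤ suc (suc N) → All (Between j N) (shifts j k t)
shifts-between j k zero    _  = []
shifts-between {N} j k (suc t) le = ++⁺
  (All.zipWith (λ { (p , q) → p , s≤s⁻¹ (≤-trans q (≤-trans (m≤n+m (j + k) t) (s≤s⁻¹ le))) }) (down-≥ j k , down-< j k))
  (All.map (λ { (p , q) → ≤-trans (n≤1+n j) p , q }) (shifts-between (suc j) k t (subst (_≤ suc (suc N)) (sym (+-suc t (j + k))) le)))

lowest : ℕ → ℕ → Word
lowest N k = down (N ∸ k + 2) k

[n∸k]+2+k : ∀ {k n} → k ≤ n → n ∸ k + 2 + k ≡ suc (suc n)
[n∸k]+2+k {k} {n} le = trans (+-assoc (n ∸ k) 2 k) (trans (+-suc (n ∸ k) (suc k)) (cong suc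
  (trans (+-suc (n ∸ k) k) (cong suc (m∸n+n≡m le)))))

φ-lowest : ∀ {N i} k → k ≤ N → i ≤ N → φ i (lowest N k) ≡ 0
φ-lowest zero    _  _  = refl
φ-lowest {N} {i} (suc k) le i≤N = down-φ (N ∸ suc k + 2) k λ eq → <-irrefl
  (trans eq (suc-injective (trans (sym (+-suc (N ∸ suc k + 2) k)) ([n∸k]+2+k le)))) (s≤s i≤N)

[n∸k]+1+[1+k] : ∀ {k n} → k ≤ n → suc (n ∸ k) + (1 + k) ≡ suc (suc n)
[n∸k]+1+[1+k] {k} {n} le = cong suc (trans (+-suc (n ∸ k) k) (cong suc (m∸n+n≡m le)))

column-clean : ∀ {N k} → k < N →
  Clean (Between 1 N) (shifts 1 (suc k) (suc (N ∸ suc k))) (down 1 (suc k)) (lowest N (suc k))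
column-clean {N} {k} lt = clean
  (shifts-between 1 (suc k) (suc (N ∸ suc k)) (≤-reflexive ([n∸k]+1+[1+k] lt)))
  (λ i c → down-ε 1 (suc k) λ eq → <-irrefl (sym (suc-injective eq)) (proj₁ c))
  (λ i c → φ-lowest (suc k) lt (proj₂ c))
  (subst (λ b → Eff (shifts 1 (suc k) (suc (N ∸ suc k))) (down 1 (suc k)) (down b (suc k))) (sym (+-suc (N ∸ suc k) 1)) (Eff-shifts 1 (suc k) _))

-- Lifting the column by one first leaves a run in colours at least 2 only, that is, inside one
-- lower subcrystal.
raised-column-clean : ∀ {N k} → k < N →
  Clean (Between 2 N) (shifts 2 (suc k) (N ∸ suc k)) (down 2 (suc k)) (lowest N (suc k))
raised-column-clean {N} {k} lt = clean
  (shifts-between 2 (suc k) (N ∸ suc k) (≤-reflexive (trans (sym (+-assoc (N ∸ suc k) 2 (suc k))) ([n∸k]+2+k lt))))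
  (λ i c → down-ε 2 (suc k) λ eq → <-irrefl (sym (suc-injective eq)) (proj₁ c))
  (λ i c → φ-lowest (suc k) lt (proj₂ c))
  (Eff-shifts 2 (suc k) _)

-- The top letter m+2 is neutral for the colours up to m, so a column of height k+1 behaves like one
-- of height k. This is the origin of the index shift in h↑ = (a_2,...,a_n).
capped-column-clean : ∀ {m k} → k ≤ m →
  Clean (Between 1 m) (shifts 1 k (suc (m ∸ k))) (suc (suc m) ∷ down 1 k) (lowest (suc m) (suc k))
capped-column-clean {m} {k} le = subst (Clean _ _ _) (cong (_∷ lowest m k) (sym ([n∸k]+2+k le))) (clean cs
  (λ i c → trans (ε-neutral (down 1 k) (p c) (q c)) (down-ε 1 k λ eq → <-irrefl (sym (suc-injective eq)) (proj₁ c)))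
  (λ i c → trans (φ-neutral (lowest m k) (p c) (q c)) (φ-lowest k le (proj₂ c)))
  (Eff-∷ (suc (suc m)) (All.map q cs)
    (subst (λ b → Eff (shifts 1 k (suc (m ∸ k))) (down 1 k) (down b k)) (sym (+-suc (m ∸ k) 1)) (Eff-shifts 1 k _))))
  where
  cs : All (Between 1 m) (shifts 1 k (suc (m ∸ k)))
  cs = shifts-between 1 k (suc (m ∸ k)) (≤-reflexive ([n∸k]+1+[1+k] le))
  p : ∀ {i} → Between 1 m i → suc (suc m) ≢ i
  p (_ , le) refl = <-irrefl refl (≤-trans (n≤1+n _) le)
  q : ∀ {i} → Between 1 m i → suc (suc m) ≢ suc i
  q (_ , le) refl = <-irrefl refl le

-- The column k…1 with its letters above j raised by one.
raisedAbove : ℕ → ℕ → Word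
raisedAbove j k = down (2 + j) (k ∸ j) ++ down 1 (k ⊓ j)

-- The column k…1 with its top letter raised to j+1 if it is smaller.
cappedAt : ℕ → ℕ → Word
cappedAt j k = k ⊔ suc j ∷ down 1 (pred k)

-- Indicators of j ≤ k and of k ≤ j.
[_≤?] [_≥?] : ℕ → ℕ → ℕ
[ j ≤?] k = 1 ⊓ (suc k ∸ j)
[ j ≥?] k = 1 ⊓ (suc j ∸ k)

down-snoc : ∀ b t → down b (suc t) ≡ down (suc b) t ++ b ∷ []
down-snoc b zero    = cong (_∷ []) (+-identityʳ b)
down-snoc b (suc t) = cong₂ _∷_ (+-suc b t) (down-snoc b t)

neutral-clean : ∀ {i x} → ε i x ≡ 0 → φ i x ≡ 0 → Clean (_≡ i) [] x x
neutral-clean p q = clean [] (λ { _ refl → p }) (λ { _ refl → q }) []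

-- If the column reaches j+1, that letter is its only one relevant to colour j+1, because the letter
-- j+2 has already been raised; a shorter column does not see the colour.
raise-clean : ∀ j k → Clean (_≡ suc j) (replicate ([ suc j ≤?] k) (suc j)) (raisedAbove (suc j) k) (raisedAbove j k)
raise-clean j k with k ≤? j
... | yes le rewrite m≤n⇒m∸n≡0 le | m≤n⇒m∸n≡0 (m≤n⇒m≤1+n le) | m≤n⇒m⊓n≡m le | m≤n⇒m⊓n≡m (m≤n⇒m≤1+n le) =
  neutral-clean (proj₂ (down-below 1 k (s≤s le))) (proj₁ (down-below 1 k (s≤s le)))
... | no gt with t , refl ← m≤n⇒∃[o]m+o≡n (≰⇒> gt)
  rewrite m+n∸m≡n j t | m≥n⇒m⊓n≡n (m≤m+n j t) | m≥n⇒m⊓n≡n (≤-trans (n≤1+n j) (m≤m+n (suc j) t))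
        | trans (cong (_∸ j) (sym (+-suc j t))) (m+n∸m≡n j (suc t)) = clean
  (refl ∷ [])
  (λ { _ refl → ε-++-0 (down (3 + j) t) (suc j ∷ down 1 j) (proj₂ above) (trans (ε-closing (suc j) (down 1 j)) (proj₂ below)) })
  (λ { _ refl → trans (cong (φ (suc j)) shape) (φ-++-0 (down (3 + j) t) (2 + j ∷ down 1 j) (proj₁ above)
      (trans (φ-opening (suc j) (down 1 j)) (cong pred (proj₁ below)))) })
  (subst (down (3 + j) t ++ suc j ∷ down 1 j ⟶[ suc j ]_) (sym shape)
    (⟶-++ʳ (down (3 + j) t) (subst₂ _<_ (sym (proj₂ above)) (sym (φ-closing (suc j) (down 1 j))) (s≤s z≤n)) (here (proj₁ below))) ∷ [])
  where
  above = down-above {suc j} (3 + j) t ≤-refl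
  below = down-below {suc j} 1 j ≤-refl
  shape : down (2 + j) (suc t) ++ down 1 j ≡ down (3 + j) t ++ 2 + j ∷ down 1 j
  shape = trans (cong (_++ down 1 j) (down-snoc (2 + j) t)) (++-assoc (down (3 + j) t) _ _)

cap-clean : ∀ j k → Clean (_≡ suc j) (replicate ([ suc j ≥?] (suc k)) (suc j)) (cappedAt j (suc k)) (cappedAt (suc j) (suc k))
cap-clean j k with k ≤? j
... | yes le rewrite m≤n⇒m⊔n≡n le | m≤n⇒m⊔n≡n (m≤n⇒m≤1+n le) | +-∸-assoc 1 le = clean
  (refl ∷ [])
  (λ { _ refl → trans (ε-closing (suc j) (down 1 k)) (proj₂ below) })
  (λ { _ refl → trans (φ-opening (suc j) (down 1 k)) (cong pred (proj₁ below)) })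
  (here (proj₁ below) ∷ [])
  where below = down-below {suc j} 1 k (s≤s le)
... | no gt rewrite m≥n⇒m⊔n≡m (≤-trans (n≤1+n j) (≰⇒> gt)) | m≥n⇒m⊔n≡m (≰⇒> gt) | m≤n⇒m∸n≡0 (≰⇒> gt) =
  neutral-clean (down-ε {suc j} 1 (suc k) (λ ())) (down-φ 1 k (λ eq → gt (≤-reflexive (sym (suc-injective eq)))))

descendingPowers ascendingPowers : (ℕ → ℕ) → ℕ → List ℕ
descendingPowers B zero    = []
descendingPowers B (suc j) = replicate (B (suc j)) (suc j) ++ descendingPowers B j
ascendingPowers B zero    = []
ascendingPowers B (suc j) = ascendingPowers B j ++ replicate (B (suc j)) (suc j)

tailSum headSum : (ℕ → ℕ) → ℕ → ℕ → ℕ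
tailSum a N j = weighted a [ j ≤?] N
headSum a N j = weighted a [ j ≥?] N

Source₁ : ℕ → Word → Set
Source₁ N w = ∀ i → Between 1 N i → ε i w ≡ 0

-- Colours are used from the highest down, and each column of height at least j contributes one F_j;
-- hence the tail sums as exponents.
Eff-raise : ∀ a N j h → Source₁ j h → j ≤ N →
  Eff (descendingPowers (tailSum a N) j) (h ++ blocks (raisedAbove j) a N) (h ++ blocks (raisedAbove 0) a N)
Eff-raise a N zero    h εh _  = []
Eff-raise a N (suc j) h εh le = Eff-++
  (subst (λ L → Eff L (h ++ blocks (raisedAbove (suc j)) a N) (h ++ blocks (raisedAbove j) a N)) (blockOps-replicate a [ suc j ≤?] (suc j) N)
    (Eff-clean h (λ { _ refl → εh (suc j) (s≤s z≤n , ≤-refl) }) (Clean-blocks (λ k → replicate ([ suc j ≤?] k) (suc j)) (raisedAbove (suc j)) (raisedAbove j) a N (λ k _ → raise-clean j (suc k)))))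
  (Eff-raise a N j h (λ i c → εh i (proj₁ c , m≤n⇒m≤1+n (proj₂ c))) (≤-trans (n≤1+n j) le))

-- The top letter k of a column climbs through the colours k, k+1, ..., so F_j is used once for each
-- column of height at most j; hence the head sums.
Eff-cap : ∀ a N j h → Source₁ j h → j ≤ N →
  Eff (ascendingPowers (headSum a N) j) (h ++ blocks (cappedAt 0) a N) (h ++ blocks (cappedAt j) a N)
Eff-cap a N zero    h εh _  = []
Eff-cap a N (suc j) h εh le = Eff-++
  (Eff-cap a N j h (λ i c → εh i (proj₁ c , m≤n⇒m≤1+n (proj₂ c))) (≤-trans (n≤1+n j) le))
  (subst (λ L → Eff L (h ++ blocks (cappedAt j) a N) (h ++ blocks (cappedAt (suc j)) a N)) (blockOps-replicate a [ suc j ≥?] (suc j) N)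
    (Eff-clean h (λ { _ refl → εh (suc j) (s≤s z≤n , ≤-refl) }) (Clean-blocks (λ k → replicate ([ suc j ≥?] k) (suc j)) (cappedAt j) (cappedAt (suc j)) a N (λ k _ → cap-clean j k))))

H : ℕ → Word
H = down 1

raisedAbove≡H : ∀ {N} a → blocks (raisedAbove N) a N ≡ blocks H a N
raisedAbove≡H {N} a = blocks-cong a N λ k lt → cong₂ (λ p q → down (2 + N) p ++ down 1 q) (m≤n⇒m∸n≡0 lt) (m≤n⇒m⊓n≡m lt)

raisedAbove≡lifted : ∀ {N} a → blocks (raisedAbove 0) a N ≡ blocks (down 2) a N
raisedAbove≡lifted {N} a = blocks-cong a N λ k lt → ++-identityʳ (down 2 (suc k))

cappedAt≡H : ∀ {N} a → blocks (cappedAt 0) a N ≡ blocks H a N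
cappedAt≡H {N} a = blocks-cong a N λ k lt → cong (_∷ down 1 k) (cong suc (⊔-identityʳ k))

capped : ℕ → ℕ → Word
capped n k = suc n ∷ down 1 (pred k)

cappedAt≡capped : ∀ {n} a → blocks (cappedAt n) a n ≡ blocks (capped n) a n
cappedAt≡capped {n} a = blocks-cong a n λ k lt → cong (_∷ down 1 k) (cong suc (m≤n⇒m⊔n≡n (≤-trans (n≤1+n k) lt)))

φ-H-blocks : ∀ {N} a i → i < N → φ (suc i) (blocks H a N) ≡ a (suc i)
φ-H-blocks {N} a i lt = trans (φ-blocks {suc i} {H} a N (λ k _ → down-ε {suc i} 1 (suc k) (λ ()))) 
  (weighted-single a (λ k → φ (suc i) (H k)) N i lt (φ-down-top 1 i) λ k _ ne → down-φ 1 k (λ eq → ne (sym (suc-injective eq))))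

ε-H-blocks : ∀ {N} a i → 1 ≤ i → ε i (blocks H a N) ≡ 0
ε-H-blocks {N} a (suc i) _ = ε-blocks a N (λ k _ → down-ε {suc i} 1 (suc k) (λ ()))

-- Principal vertices in a product of columns

All-descendingPowers : ∀ {P : ℕ → Set} B N → (∀ j → j < N → P (suc j)) → All P (descendingPowers B N)
All-descendingPowers B zero    p = []
All-descendingPowers B (suc N) p = ++⁺ (replicate⁺ (B (suc N)) (p N ≤-refl)) (All-descendingPowers B N (λ j lt → p j (m≤n⇒m≤1+n lt)))

All-ascendingPowers : ∀ {P : ℕ → Set} B N → (∀ j → j < N → P (suc j)) → All P (ascendingPowers B N)
All-ascendingPowers B zero    p = []
All-ascendingPowers B (suc N) p = ++⁺ (All-ascendingPowers B N (λ j lt → p j (m≤n⇒m≤1+n lt))) (replicate⁺ (B (suc N)) (p N ≤-refl))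

principalOps : ℕ → (ℕ → ℕ) → List ℕ
principalOps N a = blockOps (λ k → shifts 1 k (suc (N ∸ k))) a N

principalOps-clean : ∀ N a → Clean (Between 1 N) (principalOps N a) (blocks H a N) (blocks (lowest N) a N)
principalOps-clean N a = Clean-blocks (λ k → shifts 1 k (suc (N ∸ k))) H (lowest N) a N (λ k lt → column-clean lt)

principalOps-colours : ∀ N a → All (Between 1 N) (principalOps N a)
principalOps-colours N a = colours (principalOps-clean N a)

blockOps-shift : ∀ (O O′ : ℕ → List ℕ) a m → O 0 ≡ [] → (∀ k → O′ (suc k) ≡ O k) → blockOps O′ a (suc m) ≡ blockOps O (a ∘ suc) m
blockOps-shift O O′ a zero    z eq rewrite eq 0 | z = times-[] (a 1)
blockOps-shift O O′ a (suc m) z eq = cong₂ _++_ (blockOps-shift O O′ a m z eq) (cong (times (a (suc (suc m)))) (eq (suc m)))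

shifts-[] : ∀ j t → shifts j 0 t ≡ []
shifts-[] j zero    = refl
shifts-[] j (suc t) = shifts-[] (suc j) t

-- A source with φ_k ≥ a_k is bisimilar to a product of columns k…1 ending with a_N, …, a_1 of them;
-- on this product the principal operators act one column at a time.
module Model (N : ℕ) (w : Word) (source : Source₁ N w) (a : ℕ → ℕ) (a≤φ : ∀ k → k < N → a (suc k) ≤ φ (suc k) w) where

  open WindowUniqueness 0 N public

  remainder : Word
  remainder = blocks H (λ k → φ k w ∸ a k) N

  remainder-Source : ∀ i → 1 ≤ i → ε i remainder ≡ 0
  remainder-Source = ε-H-blocks {N} (λ k → φ k w ∸ a k)

  ≋-model : w ≋ remainder ++ blocks H a N
  ≋-model = sources-bisimilar source
    (λ i c → ε-++-0 remainder (blocks H a N) (remainder-Source i (proj₁ c)) (ε-H-blocks {N} a i (proj₁ c))) eqφ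
    where
    eqφ : ∀ i → Colour i → φ i w ≡ φ i (remainder ++ blocks H a N)
    eqφ (suc i) c rewrite φ-Source-++ {remainder} (blocks H a N) (remainder-Source (suc i) (proj₁ c))
      | φ-H-blocks {N} (λ k → φ k w ∸ a k) i (proj₂ c) | φ-H-blocks {N} a i (proj₂ c) = sym (m∸n+n≡m (a≤φ i (proj₂ c)))

  Eff-≋ : ∀ {L u v x} → Colours L → u ≋ x → Eff L u v → Eff L x (fs L x)
  Eff-≋ []       r []      = []
  Eff-≋ {x = x} (c ∷ cs) r (_∷_ {i} {L} {v = v} s t) = f-defined i x pos ∷ Eff-≋ cs (subst (_≋ f i x) (⟶-f s) (≋-move (lower i c) r)) t
    where
    pos : 1 ≤ φ i x
    pos = subst (1 ≤_) (trans (sym (⟶-φ s)) (proj₁ (≋-signature r c))) (s≤s z≤n)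

  principal-model : fs (principalOps N a) (remainder ++ blocks H a N) ≡ remainder ++ blocks (lowest N) a N
  principal-model = Eff-fs (Eff-clean remainder (λ i c → remainder-Source i (proj₁ c)) (principalOps-clean N a))

  lowerSourceOps : List ℕ
  lowerSourceOps = descendingPowers (tailSum a N) N

  lowerSource-colours : Colours lowerSourceOps
  lowerSource-colours = All-descendingPowers _ N (λ j lt → s≤s z≤n , lt)

  lowerSource-Eff-model : Eff lowerSourceOps (remainder ++ blocks H a N) (remainder ++ blocks (down 2) a N)
  lowerSource-Eff-model = subst₂ (Eff lowerSourceOps)
    (cong (remainder ++_) (raisedAbove≡H {N} a)) (cong (remainder ++_) (raisedAbove≡lifted {N} a))
    (Eff-raise a N N remainder (λ i c → remainder-Source i (proj₁ c)) ≤-refl)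

  lowerSource-Eff : Eff lowerSourceOps w (fs lowerSourceOps w)
  lowerSource-Eff = Eff-≋ lowerSource-colours (≋-sym ≋-model) lowerSource-Eff-model

  lowerSource-≋ : fs lowerSourceOps w ≋ remainder ++ blocks (down 2) a N
  lowerSource-≋ = subst (fs lowerSourceOps w ≋_) (Eff-fs lowerSource-Eff-model) (≋-fs lowerSource-colours ≋-model)

  lowerSource-Source : ∀ i → Between 2 N i → ε i (fs lowerSourceOps w) ≡ 0
  lowerSource-Source (suc i) c = trans (proj₂ (≋-signature lowerSource-≋ (s≤s z≤n , proj₂ c)))
    (ε-++-0 remainder (blocks (down 2) a N) (remainder-Source (suc i) (s≤s z≤n))
      (ε-blocks a N (λ k _ → down-ε 2 (suc k) λ eq → <-irrefl (sym (suc-injective eq)) (proj₁ c))))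

  -- In the model the principal operators, and the source operators followed by shifts in colours at
  -- least 2, both end in the lowest columns. So the second part of the latter run joins the two
  -- vertices inside a lower subcrystal.
  lowerSource-Conn : Conn 2 N (fs (principalOps N a) w) (fs lowerSourceOps w)
  lowerSource-Conn = Conn-sym (subst (Conn 2 N (fs lowerSourceOps w)) lifted-path (Conn-fs (fs lowerSourceOps w) (colours lifted)))
    where
    liftedOps : List ℕ
    liftedOps = blockOps (λ k → shifts 2 k (N ∸ k)) a N
    lifted : Clean (Between 2 N) liftedOps (blocks (down 2) a N) (blocks (lowest N) a N)
    lifted = Clean-blocks (λ k → shifts 2 k (N ∸ k)) (down 2) (lowest N) a N (λ k lt → raised-column-clean lt)
    lifted-path : fs liftedOps (fs lowerSourceOps w) ≡ fs (principalOps N a) w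
    lifted-path = trans (sym (fs-++ lowerSourceOps liftedOps w))
      (transport (≋-sym ≋-model) (++⁺ lowerSource-colours (All.map (λ c → ≤-trans (s≤s z≤n) (proj₁ c) , proj₂ c) (colours lifted)))
        (principalOps-colours N a)
        (trans (Eff-fs (Eff-++ lowerSource-Eff-model (Eff-clean remainder (λ i c → remainder-Source i (≤-trans (s≤s z≤n) (proj₁ c))) lifted)))
               (sym principal-model)))

  -- The lowest column of height k+1 ends in the letter r+2, and no other height does, so `ε` in
  -- colour r+1 counts these columns. The coordinates of a principal vertex can thus be recovered
  -- from it.
  ε-principal : ∀ k r → suc k + r ≡ N → ε (suc r) (fs (principalOps N a) w) ≡ a (suc k)
  ε-principal k r eq = begin
    ε (suc r) (fs (principalOps N a) w)        ≡⟨ proj₂ (≋-signature principal-≋ (s≤s z≤n , r<N)) ⟩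
    ε (suc r) (remainder ++ blocks (lowest N) a N) ≡⟨ ε-++ (suc r) remainder _ ⟩
    ε (suc r) (blocks (lowest N) a N) + (ε (suc r) remainder ∸ φ (suc r) (blocks (lowest N) a N))
      ≡⟨ cong₂ (λ p q → ε (suc r) (blocks (lowest N) a N) + (p ∸ q)) (remainder-Source (suc r) (s≤s z≤n)) (proj₁ sink) ⟩
    ε (suc r) (blocks (lowest N) a N) + 0      ≡⟨ +-identityʳ _ ⟩
    ε (suc r) (blocks (lowest N) a N)          ≡⟨ proj₂ sink ⟩
    weighted a (λ j → ε (suc r) (lowest N j)) N ≡⟨ weighted-single a (λ j → ε (suc r) (lowest N j)) N k k<N bottom others ⟩
    a (suc k) ∎
    where
    open ≡-Reasoning
    r<N : suc r ≤ N
    r<N = subst (suc r ≤_) (trans (+-suc r k) (trans (cong suc (+-comm r k)) eq)) (subst (suc r ≤_) (sym (+-suc r k)) (s≤s (m≤m+n r k)))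
    k<N : k < N
    k<N = subst (suc k ≤_) eq (m≤m+n (suc k) r)
    sink = ε-blocks-sink {suc r} {lowest N} a N (λ j lt → φ-lowest (suc j) lt r<N)
    principal-≋ : fs (principalOps N a) w ≋ remainder ++ blocks (lowest N) a N
    principal-≋ = subst (fs (principalOps N a) w ≋_) principal-model (≋-fs (principalOps-colours N a) ≋-model)
    N∸ : N ∸ suc k ≡ r
    N∸ = trans (cong (_∸ suc k) (sym eq)) (m+n∸m≡n (suc k) r)
    bottom : ε (suc r) (lowest N (suc k)) ≡ 1
    bottom rewrite N∸ | +-comm r 2 = proj₂ (down-bottom (suc r) k)
    others : ∀ j → j < N → j ≢ k → ε (suc r) (lowest N (suc j)) ≡ 0
    others j lt ne = down-ε (N ∸ suc j + 2) (suc j) λ eq′ → ne (suc-injective (∸-cancelˡ-≡ lt k<N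
      (+-cancelʳ-≡ 2 _ _ (trans (sym eq′) (trans (+-comm 2 r) (cong (_+ 2) (sym N∸)))))))

  upperSourceOps : List ℕ
  upperSourceOps = ascendingPowers (headSum a N) N

  upperSource-colours : Colours upperSourceOps
  upperSource-colours = All-ascendingPowers _ N (λ j lt → s≤s z≤n , lt)

  upperSource-Eff-model : Eff upperSourceOps (remainder ++ blocks H a N) (remainder ++ blocks (capped N) a N)
  upperSource-Eff-model = subst₂ (Eff upperSourceOps)
    (cong (remainder ++_) (cappedAt≡H {N} a)) (cong (remainder ++_) (cappedAt≡capped {N} a))
    (Eff-cap a N N remainder (λ i c → remainder-Source i (proj₁ c)) ≤-refl)

  upperSource-≋ : fs upperSourceOps w ≋ remainder ++ blocks (capped N) a N
  upperSource-≋ = subst (fs upperSourceOps w ≋_) (Eff-fs upperSource-Eff-model) (≋-fs upperSource-colours ≋-model)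

module Upper (m : ℕ) (w : Word) (source : Source₁ (suc m) w) (a : ℕ → ℕ) (a≤φ : ∀ k → k < suc m → a (suc k) ≤ φ (suc k) w) where

  open Model (suc m) w source a a≤φ

  upperSource : Word
  upperSource = fs upperSourceOps w

  capped-signature : ∀ i k → Between 1 m i → SameSignature i (capped (suc m) (suc k)) (down 1 k)
  capped-signature i k c = φ-neutral (down 1 k) p q , ε-neutral (down 1 k) p q
    where
    p : suc (suc m) ≢ i
    p refl = <-irrefl refl (≤-trans (n≤1+n _) (proj₂ c))
    q : suc (suc m) ≢ suc i
    q refl = <-irrefl refl (proj₂ c)

  capped-Source : ∀ i k → Between 1 m i → ε i (capped (suc m) (suc k)) ≡ 0
  capped-Source i k c = trans (proj₂ (capped-signature i k c)) (down-ε 1 k λ eq → <-irrefl (sym (suc-injective eq)) (proj₁ c))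

  upperSource-Source : Source₁ m upperSource
  upperSource-Source i c = trans (proj₂ (≋-signature upperSource-≋ (proj₁ c , m≤n⇒m≤1+n (proj₂ c))))
    (ε-++-0 remainder (blocks (capped (suc m)) a (suc m)) (remainder-Source i (proj₁ c)) (ε-blocks a (suc m) (λ k _ → capped-Source i k c)))

  -- The parameter c↑: besides the c_i - a_i untouched columns of height i, the a_{i+1} capped
  -- columns of height i+1 count as columns of height i.
  φ-upperSource : ∀ i → i < m → φ (suc i) upperSource ≡ (φ (suc i) w ∸ a (suc i)) + a (suc (suc i))
  φ-upperSource i lt = begin
    φ (suc i) upperSource ≡⟨ proj₁ (≋-signature upperSource-≋ (s≤s z≤n , m≤n⇒m≤1+n lt)) ⟩
    φ (suc i) (remainder ++ blocks (capped (suc m)) a (suc m))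
      ≡⟨ φ-Source-++ {remainder} (blocks (capped (suc m)) a (suc m)) (remainder-Source (suc i) (s≤s z≤n)) ⟩
    φ (suc i) remainder + φ (suc i) (blocks (capped (suc m)) a (suc m))
      ≡⟨ cong₂ _+_ (φ-H-blocks {suc m} (λ k → φ k w ∸ a k) i (m≤n⇒m≤1+n lt)) (φ-blocks {suc i} {capped (suc m)} a (suc m) (λ k _ → capped-Source (suc i) k (s≤s z≤n , lt))) ⟩
    (φ (suc i) w ∸ a (suc i)) + weighted a (λ k → φ (suc i) (capped (suc m) k)) (suc m)
      ≡⟨ cong ((φ (suc i) w ∸ a (suc i)) +_) (weighted-single a (λ k → φ (suc i) (capped (suc m) k)) (suc m) (suc i) (s≤s lt)
           (trans (sig (suc i)) (φ-down-top 1 i)) others) ⟩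
    (φ (suc i) w ∸ a (suc i)) + a (suc (suc i)) ∎
    where
    open ≡-Reasoning
    sig : ∀ k → φ (suc i) (capped (suc m) (suc k)) ≡ φ (suc i) (down 1 k)
    sig k = proj₁ (capped-signature (suc i) k (s≤s z≤n , lt))
    others : ∀ k → k < suc m → k ≢ suc i → φ (suc i) (capped (suc m) (suc k)) ≡ 0
    others zero    _ _  = sig 0
    others (suc k) _ ne = trans (sig (suc k)) (down-φ 1 k (λ eq → ne (sym eq)))

  -- After capping, the columns of height one are already lowest and those of height k+1 are
  -- completed by S_{m,k}; the result is the same product of lowest columns that the full principal
  -- operators reach.
  principal-upperSource : fs (principalOps m (a ∘ suc)) upperSource ≡ fs (principalOps (suc m) a) w
  principal-upperSource = trans (sym (fs-++ upperSourceOps (principalOps m (a ∘ suc)) w))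
    (transport (≋-sym ≋-model)
      (++⁺ upperSource-colours (subst Colours ops-eq (All.map (λ c → proj₁ c , m≤n⇒m≤1+n (proj₂ c)) (colours cappedClean))))
      (principalOps-colours (suc m) a)
      (trans (trans (fs-++ upperSourceOps (principalOps m (a ∘ suc)) _) (trans (cong₂ fs (sym ops-eq) (Eff-fs upperSource-Eff-model))
        (Eff-fs (Eff-clean remainder (λ i c → remainder-Source i (proj₁ c)) cappedClean)))) (sym principal-model)))
    where
    cappedOps : ℕ → List ℕ
    cappedOps k = shifts 1 (pred k) (suc (m ∸ pred k))
    cappedClean : Clean (Between 1 m) (blockOps cappedOps a (suc m)) (blocks (capped (suc m)) a (suc m)) (blocks (lowest (suc m)) a (suc m))
    cappedClean = Clean-blocks cappedOps (capped (suc m)) (lowest (suc m)) a (suc m) (λ k lt → capped-column-clean (s≤s⁻¹ lt))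
    ops-eq : blockOps cappedOps a (suc m) ≡ principalOps m (a ∘ suc)
    ops-eq = blockOps-shift (λ k → shifts 1 k (suc (m ∸ k))) cappedOps a m (shifts-[] 1 (suc m)) (λ k → refl)

-- The exchange of string exponents

module Braid (o : ℕ) where

  open WindowUniqueness o 2

  i j k : ℕ
  i = suc o
  j = suc i
  k = suc j

  colour? : ∀ {c} → Colour c → c ≡ i ⊎ c ≡ j
  colour? {c} (p , q) with m≤n⇒m<n∨m≡n p
  ... | inj₂ eq = inj₁ (sym eq)
  ... | inj₁ lt = inj₂ (≤-antisym (≤-trans q (≤-reflexive (+-comm o 2))) lt)

  i-colour : Colour i
  i-colour = ≤-refl , ≤-trans (n≤1+n i) (≤-reflexive (+-comm 2 o))

  j-colour : Colour j
  j-colour = n≤1+n i , ≤-reflexive (+-comm 2 o)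

  j≢i : j ≢ i
  j≢i = 1+n≢n
  k≢i : k ≢ i
  k≢i eq = 1+n≰n (≤-trans (n≤1+n j) (≤-reflexive eq))
  k≢j : k ≢ j
  k≢j = 1+n≢n

  Clean-i : Clean (_≡ i) (i ∷ []) (i ∷ []) (j ∷ [])
  Clean-i = clean (refl ∷ []) (λ { _ refl → ε-closing i [] }) (λ { _ refl → φ-opening i [] }) (here refl ∷ [])

  Clean-j : Clean (_≡ j) (j ∷ []) (j ∷ []) (k ∷ [])
  Clean-j = clean (refl ∷ []) (λ { _ refl → ε-closing j [] }) (λ { _ refl → φ-opening j [] }) (here refl ∷ [])

  Clean-ki : Clean (_≡ i) (i ∷ []) (k ∷ i ∷ []) (k ∷ j ∷ [])
  Clean-ki = clean (refl ∷ [])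
    (λ { _ refl → trans (ε-neutral (i ∷ []) k≢i k≢j) (ε-closing i []) })
    (λ { _ refl → trans (φ-neutral (j ∷ []) k≢i k≢j) (φ-opening i []) })
    (there (λ eq → contradiction eq k≢j) (here refl) ∷ [])

  Clean-ji : Clean (_≡ j) (j ∷ []) (j ∷ i ∷ []) (k ∷ i ∷ [])
  Clean-ji = clean (refl ∷ [])
    (λ { _ refl → trans (ε-closing j (i ∷ [])) (ε-neutral [] (≢-sym j≢i) (≢-sym k≢i)) })
    (λ { _ refl → trans (φ-opening j (i ∷ [])) (cong pred (φ-neutral [] (≢-sym j≢i) (≢-sym k≢i))) })
    (here (φ-neutral [] (≢-sym j≢i) (≢-sym k≢i)) ∷ [])

  neutral-i : Clean (_≡ j) [] (i ∷ []) (i ∷ [])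
  neutral-i = neutral-clean (ε-neutral [] (≢-sym j≢i) (≢-sym k≢i)) (φ-neutral [] (≢-sym j≢i) (≢-sym k≢i))

  neutral-k : Clean (_≡ i) [] (k ∷ []) (k ∷ [])
  neutral-k = neutral-clean (ε-neutral [] k≢i k≢j) (φ-neutral [] k≢i k≢j)

  neutral-kj : Clean (_≡ j) [] (k ∷ j ∷ []) (k ∷ j ∷ [])
  neutral-kj = neutral-clean ε≡0 φ≡0
    where
    ε≡0 : ε j (k ∷ j ∷ []) ≡ 0
    ε≡0 rewrite role-opening j | role-closing j = refl
    φ≡0 : φ j (k ∷ j ∷ []) ≡ 0
    φ≡0 rewrite φ-opening j (j ∷ []) | φ-closing j [] = refl

  times-[_] : ∀ c n → times n (c ∷ []) ≡ replicate n c
  times-[ c ] zero    = refl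
  times-[ c ] (suc n) = cong (c ∷_) (times-[ c ] n)

  powers : ∀ {c x y} n → Clean (_≡ c) (c ∷ []) x y → Clean (_≡ c) (replicate n c) (times n x) (times n y)
  powers {c} n cl = subst (λ L → Clean (_≡ c) L _ _) (times-[ c ] n) (Clean-times n cl)

  idle : ∀ {c x} n → Clean (_≡ c) [] x x → Clean (_≡ c) [] (times n x) (times n x)
  idle {c} {x} n cl = subst (λ L → Clean (_≡ c) L (times n x) (times n x)) (times-[] n) (Clean-times n cl)

  behind : ∀ {c L x y} h → ε c h ≡ 0 → Clean (_≡ c) L x y → Eff L (h ++ x) (h ++ y)
  behind h z = Eff-clean h (λ { _ refl → z })

  prefix : ∀ {c} n x → ε c x ≡ 0 → ∀ {h} → ε c h ≡ 0 → ε c (h ++ times n x) ≡ 0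
  prefix n x z {h} zh = ε-++-0 h (times n x) zh (ε-times n x z)

  assoc-Eff : ∀ {L} u v {x y} → Eff L ((u ++ v) ++ x) ((u ++ v) ++ y) → Eff L (u ++ v ++ x) (u ++ v ++ y)
  assoc-Eff {L} u v {x} {y} = subst₂ (Eff L) (++-assoc u v x) (++-assoc u v y)

  P Q : Word
  P = i ∷ []
  Q = j ∷ i ∷ []

  module _ (R : Word) (Ri : ε i R ≡ 0) (Rj : ε j R ≡ 0) where

    εi-Q : ε i Q ≡ 0
    εi-Q rewrite role-opening i | role-closing i = refl

    εi-ki : ε i (k ∷ i ∷ []) ≡ 0
    εi-ki = εˣ Clean-ki i refl

    -- The case a = x + d. The a columns Q are split because the last power of F_i reaches only the
    -- x rightmost of them; in `small-right` the same x columns absorb the first power of F_j.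
    small-left : ∀ d x z → Eff (replicate z i ++ ((replicate z j ++ replicate x j) ++ replicate d j) ++ replicate x i)
      (R ++ times d Q ++ times x Q ++ times z P) (R ++ times d (k ∷ i ∷ []) ++ times x (k ∷ j ∷ []) ++ times z (k ∷ []))
    small-left d x z = Eff-++
      (assoc-Eff R (times d Q) (assoc-Eff (R ++ times d Q) (times x Q)
        (behind ((R ++ times d Q) ++ times x Q) (prefix x Q εi-Q {R ++ times d Q} (prefix d Q εi-Q {R} Ri)) (powers z Clean-i))))
      (Eff-++ (behind R Rj (Clean-++ (powers d Clean-ji) (Clean-++ (powers x Clean-ji) (powers z Clean-j))))
        (assoc-Eff R (times d (k ∷ i ∷ [])) (behind (R ++ times d (k ∷ i ∷ [])) (prefix d (k ∷ i ∷ []) εi-ki {R} Ri)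
          (Clean-++ (powers x Clean-ki) (idle z neutral-k)))))

    small-right : ∀ d x z → Eff (replicate x j ++ (replicate z i ++ replicate x i) ++ (replicate z j ++ []) ++ replicate d j)
      (R ++ times d Q ++ times x Q ++ times z P) (R ++ times d (k ∷ i ∷ []) ++ times x (k ∷ j ∷ []) ++ times z (k ∷ []))
    small-right d x z = Eff-++
      (assoc-Eff R (times d Q) (behind (R ++ times d Q) (prefix d Q (εˣ Clean-ji j refl) {R} Rj)
        (Clean-++ (powers x Clean-ji) (idle z neutral-i))))
      (Eff-++ (assoc-Eff R (times d Q) (behind (R ++ times d Q) (prefix d Q εi-Q {R} Ri)
          (Clean-++ (powers x Clean-ki) (powers z Clean-i))))
        (behind R Rj (Clean-++ (powers d Clean-ji) (Clean-++ (idle x neutral-kj) (powers z Clean-j)))))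

    -- The case x = a + e. All a columns Q are used up by F_i, and the e surplus applications fall
    -- on the single letters P to their left.
    large-left : ∀ e a z → Eff (replicate z i ++ (replicate z j ++ replicate a j) ++ replicate a i ++ replicate e i)
      (R ++ times e P ++ times a Q ++ times z P) (R ++ times e (j ∷ []) ++ times a (k ∷ j ∷ []) ++ times z (k ∷ []))
    large-left e a z = Eff-++
      (assoc-Eff R (times e P) (assoc-Eff (R ++ times e P) (times a Q)
        (behind ((R ++ times e P) ++ times a Q) (prefix a Q εi-Q {R ++ times e P} (prefix e P (ε-closing i []) {R} Ri)) (powers z Clean-i))))
      (Eff-++ (assoc-Eff R (times e P) (behind (R ++ times e P) (prefix e P (εˣ neutral-i j refl) {R} Rj)
          (Clean-++ (powers a Clean-ji) (powers z Clean-j))))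
        (behind R Ri (Clean-++ (powers e Clean-i) (Clean-++ (powers a Clean-ki) (idle z neutral-k)))))

    large-right : ∀ e a z → Eff (replicate a j ++ ((replicate z i ++ replicate a i) ++ replicate e i) ++ replicate z j)
      (R ++ times e P ++ times a Q ++ times z P) (R ++ times e (j ∷ []) ++ times a (k ∷ j ∷ []) ++ times z (k ∷ []))
    large-right e a z = Eff-++
      (assoc-Eff R (times e P) (behind (R ++ times e P) (prefix e P (εˣ neutral-i j refl) {R} Rj)
        (Clean-++ (powers a Clean-ji) (idle z neutral-i))))
      (Eff-++ (behind R Ri (Clean-++ (powers e Clean-i) (Clean-++ (powers a Clean-ki) (powers z Clean-i))))
        (assoc-Eff R (times e (j ∷ [])) (assoc-Eff (R ++ times e (j ∷ [])) (times a (k ∷ j ∷ []))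
          (behind ((R ++ times e (j ∷ [])) ++ times a (k ∷ j ∷ []))
            (prefix a (k ∷ j ∷ []) (εˣ neutral-kj j refl) {R ++ times e (j ∷ [])} (prefix e (j ∷ []) (ε-closing j []) {R} Rj))
            (powers z Clean-j)))))

  -- One of x ∸ a and a ∸ x vanishes, so the word fits both cases. It holds a columns Q and z + (x ∸
  -- a) letters P, the amounts that `braid` requires of u.
  braidWord : ℕ → ℕ → ℕ → Word
  braidWord x z a = times (x ∸ a) P ++ (times (a ∸ x) Q ++ times (a ⊓ x) Q) ++ times z P

  Eff-by : ∀ {L M u v} → L ≡ M → Eff L u v → fs M u ≡ v
  Eff-by refl = Eff-fs

  braid-model : ∀ R → ε i R ≡ 0 → ε j R ≡ 0 → ∀ x z a →
    fs (replicate z i ++ replicate (z + a) j ++ replicate x i) (R ++ braidWord x z a) ≡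
    fs (replicate (x ⊓ a) j ++ replicate (z + x) i ++ replicate (z + (a ∸ x)) j) (R ++ braidWord x z a)
  braid-model R Ri Rj x z a with ≤-total x a
  ... | inj₁ le with d , refl ← m≤n⇒∃[o]m+o≡n le
    rewrite m≤n⇒m∸n≡0 (m≤m+n x d) | m+n∸m≡n x d | m≥n⇒m⊓n≡n (m≤m+n x d) | m≤n⇒m⊓n≡m (m≤m+n x d)
          | ++-assoc (times d Q) (times x Q) (times z P) =
    trans (Eff-by left-ops (small-left R Ri Rj d x z)) (sym (Eff-by right-ops (small-right R Ri Rj d x z)))
    where
    left-ops : replicate z i ++ ((replicate z j ++ replicate x j) ++ replicate d j) ++ replicate x i ≡ replicate z i ++ replicate (z + (x + d)) j ++ replicate x i
    left-ops = cong (λ L → replicate z i ++ L ++ replicate x i)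
      (trans (cong (_++ replicate d j) (replicate-++ z x)) (trans (replicate-++ (z + x) d) (cong (λ n → replicate n j) (+-assoc z x d))))
    right-ops : replicate x j ++ (replicate z i ++ replicate x i) ++ (replicate z j ++ []) ++ replicate d j ≡ replicate x j ++ replicate (z + x) i ++ replicate (z + d) j
    right-ops = cong (replicate x j ++_)
      (cong₂ _++_ (replicate-++ z x) (trans (cong (_++ replicate d j) (++-identityʳ (replicate z j))) (replicate-++ z d)))
  ... | inj₂ ge with e , refl ← m≤n⇒∃[o]m+o≡n ge
    rewrite m≤n⇒m∸n≡0 (m≤m+n a e) | m+n∸m≡n a e | m≥n⇒m⊓n≡n (m≤m+n a e) | m≤n⇒m⊓n≡m (m≤m+n a e) | +-identityʳ z =
    trans (Eff-by left-ops (large-left R Ri Rj e a z)) (sym (Eff-by right-ops (large-right R Ri Rj e a z)))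
    where
    left-ops : replicate z i ++ (replicate z j ++ replicate a j) ++ replicate a i ++ replicate e i ≡ replicate z i ++ replicate (z + a) j ++ replicate (a + e) i
    left-ops = cong (replicate z i ++_) (cong₂ _++_ (replicate-++ z a) (replicate-++ a e))
    right-ops : replicate a j ++ ((replicate z i ++ replicate a i) ++ replicate e i) ++ replicate z j ≡ replicate a j ++ replicate (z + (a + e)) i ++ replicate z j
    right-ops = cong (λ L → replicate a j ++ L ++ replicate z j)
      (trans (cong (_++ replicate e i) (replicate-++ z a)) (trans (replicate-++ (z + a) e) (cong (λ n → replicate n i) (+-assoc z a e))))

  record Free (x : Word) (p q : ℕ) : Set where
    constructor free
    field
      εi : ε i x ≡ 0
      εj : ε j x ≡ 0
      φi : φ i x ≡ p
      φj : φ j x ≡ q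

  Free-++ : ∀ {x y p q p′ q′} → Free x p q → Free y p′ q′ → Free (x ++ y) (p + p′) (q + q′)
  Free-++ {x} {y} (free a b c d) (free a′ b′ c′ d′) = free (ε-++-0 x y a a′) (ε-++-0 x y b b′)
    (trans (φ-Source-++ {x} y a) (cong₂ _+_ c c′)) (trans (φ-Source-++ {x} y b) (cong₂ _+_ d d′))

  Free-P : ∀ n → Free (times n P) n 0
  Free-P zero    = free refl refl refl refl
  Free-P (suc n) = Free-++ (free (εˣ Clean-i i refl) (εˣ neutral-i j refl) (φ-closing i []) (φʸ neutral-i j refl)) (Free-P n)

  Free-Q : ∀ n → Free (times n Q) 0 n
  Free-Q zero    = free refl refl refl refl
  Free-Q (suc n) = Free-++ (free ε≡0 (εˣ Clean-ji j refl) φ≡0 (trans (φ-closing j (i ∷ [])) (cong suc (φʸ neutral-i j refl)))) (Free-Q n)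
    where
    ε≡0 : ε i Q ≡ 0
    ε≡0 rewrite role-opening i | role-closing i = refl
    φ≡0 : φ i Q ≡ 0
    φ≡0 rewrite φ-opening i (i ∷ []) | φ-closing i [] = refl

  Free-≋ : ∀ {u x p q} → ε i u ≡ 0 → ε j u ≡ 0 → φ i u ≡ p → φ j u ≡ q → Free x p q → u ≋ x
  Free-≋ {u} {x} a b c d (free a′ b′ c′ d′) = sources-bisimilar (source-at u a b) (source-at x a′ b′) eqφ
    where
    source-at : ∀ y → ε i y ≡ 0 → ε j y ≡ 0 → Source y
    source-at y p q l cl with colour? cl
    ... | inj₁ refl = p
    ... | inj₂ refl = q
    eqφ : ∀ l → Colour l → φ l u ≡ φ l x
    eqφ l cl with colour? cl
    ... | inj₁ refl = trans c (sym c′)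
    ... | inj₂ refl = trans d (sym d′)

  i-powers : ∀ n → Colours (replicate n i)
  i-powers n = replicate⁺ n i-colour
  j-powers : ∀ n → Colours (replicate n j)
  j-powers n = replicate⁺ n j-colour

  -- With y = z + a this is the map (x, y, z) ↦ (max(z, y-x), x+z, min(x, y-z)) of string
  -- coordinates. The two inequalities ensure that the columns consumed by the model occur in u; the
  -- others form R.
  braid : ∀ u x z a → ε i u ≡ 0 → ε j u ≡ 0 → z + (x ∸ a) ≤ φ i u → a ≤ φ j u →
    fs (replicate z i ++ replicate (z + a) j ++ replicate x i) u ≡
    fs (replicate (x ⊓ a) j ++ replicate (z + x) i ++ replicate (z + (a ∸ x)) j) u
  braid u x z a εi εj φi≥ φj≥ = transport (≋-sym u≋)
    (++⁺ (i-powers z) (++⁺ (j-powers (z + a)) (i-powers x)))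
    (++⁺ (j-powers (x ⊓ a)) (++⁺ (i-powers (z + x)) (j-powers (z + (a ∸ x)))))
    (braid-model R (Free.εi Free-R) (Free.εj Free-R) x z a)
    where
    R T : Word
    R = times (φ j u ∸ a) Q ++ times (φ i u ∸ (z + (x ∸ a))) P
    T = braidWord x z a
    Free-R : Free R (φ i u ∸ (z + (x ∸ a))) (φ j u ∸ a + 0)
    Free-R = Free-++ (Free-Q _) (Free-P _)
    Free-T : Free T ((x ∸ a) + z) ((a ∸ x + a ⊓ x) + 0)
    Free-T = Free-++ (Free-P (x ∸ a)) (Free-++ (Free-++ (Free-Q (a ∸ x)) (Free-Q (a ⊓ x))) (Free-P z))
    a≡ : a ∸ x + a ⊓ x ≡ a
    a≡ = trans (+-comm (a ∸ x) (a ⊓ x)) (trans (cong (_+ (a ∸ x)) (⊓-comm a x)) (m⊓n+n∸m≡n x a))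
    u≋ : u ≋ R ++ T
    u≋ = Free-≋ εi εj
      (sym (trans (cong (φ i u ∸ (z + (x ∸ a)) +_) (+-comm (x ∸ a) z)) (m∸n+n≡m φi≥)))
      (sym (trans (cong₂ _+_ (+-identityʳ (φ j u ∸ a)) (trans (+-identityʳ (a ∸ x + a ⊓ x)) a≡)) (m∸n+n≡m φj≥)))
      (Free-++ Free-R Free-T)

-- Commutation of distant colours and interaction of adjacent ones

Far : ℕ → ℕ → Set
Far i j = i ≢ j × i ≢ suc j × suc i ≢ j

far-below : ∀ {i j} → suc i < j → Far i j
far-below lt = (λ { refl → <-irrefl refl (≤-trans (n≤1+n _) lt) }) , (λ { refl → <-irrefl refl (≤-trans (n≤1+n _) (≤-trans (n≤1+n _) lt)) }) ,
  (λ { refl → <-irrefl refl lt })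

far-sym : ∀ {i j} → Far i j → Far j i
far-sym (p , q , r) = ≢-sym p , ≢-sym r , ≢-sym q

far-roles : ∀ {i j} → Far i j → role j i ≡ neutral × role j (suc i) ≡ neutral
far-roles (p , q , r) = role-neutral p q , role-neutral r (λ eq → p (suc-injective eq))

⟶-far : ∀ {i j u v} → Far i j → u ⟶[ i ] v → SameSignature j u v
⟶-far {j = j} far (here {w = w} _) with p , q ← far-roles far rewrite p | q = refl , refl
⟶-far {j = j} far (there {x = x} {w} {w′} _ s) with a , b ← ⟶-far far s rewrite a | b = refl , refl

f-far : ∀ {i j} w → Far i j → SameSignature j w (f i w)
f-far {i} {j} w far with φ i w in z
... | zero  rewrite f-undefined i w z = refl , refl
... | suc _ = ⟶-far far (f-defined i w (subst (1 ≤_) (sym z) (s≤s z≤n)))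

⟶-square : ∀ {i j w u v} → Far i j → w ⟶[ i ] u → w ⟶[ j ] v → ∃ λ x → u ⟶[ j ] x × v ⟶[ i ] x
⟶-square (p , _) (here _) (here _) = contradiction refl p
⟶-square far@(p , _) (here z) (there _ t) =
  _ , there (λ eq → contradiction (suc-injective eq) p) t , here (trans (sym (proj₁ (⟶-far (far-sym far) t))) z)
⟶-square far@(p , _) (there _ s) (here z) =
  _ , here (trans (sym (proj₁ (⟶-far far s))) z) , there (λ eq → contradiction (sym (suc-injective eq)) p) s
⟶-square far (there q s) (there q′ t) with x , s′ , t′ ← ⟶-square far s t = _ ,
  there (λ eq → subst (2 ≤_) (proj₁ (⟶-far far s)) (q′ eq)) s′ ,
  there (λ eq → subst (2 ≤_) (proj₁ (⟶-far (far-sym far) t)) (q eq)) t′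

f-commute : ∀ {i j} w → Far i j → f i (f j w) ≡ f j (f i w)
f-commute {i} {j} w far with φ i w in zi | φ j w in zj
... | zero | _ rewrite f-undefined i w zi = f-undefined i (f j w) (trans (sym (proj₁ (f-far w (far-sym far)))) zi)
... | suc _ | zero rewrite f-undefined j w zj = sym (f-undefined j (f i w) (trans (sym (proj₁ (f-far w far))) zj))
... | suc _ | suc _ with x , s , t ← ⟶-square far (f-defined i w (subst (1 ≤_) (sym zi) (s≤s z≤n))) (f-defined j w (subst (1 ≤_) (sym zj) (s≤s z≤n))) =
  trans (⟶-f t) (sym (⟶-f s))

fs-far : ∀ {L j} w → All (λ i → Far i j) L → SameSignature j w (fs L w)
fs-far w []       = refl , refl
fs-far {i ∷ L} w (p ∷ ps) = trans (proj₁ (f-far w p)) (proj₁ (fs-far (f i w) ps)) , trans (proj₂ (f-far w p)) (proj₂ (fs-far (f i w) ps))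

f-fs-commute : ∀ {L j} w → All (λ i → Far i j) L → f j (fs L w) ≡ fs L (f j w)
f-fs-commute w []       = refl
f-fs-commute {i ∷ L} w (p ∷ ps) = trans (f-fs-commute (f i w) ps) (cong (fs L) (sym (f-commute w p)))

powers-commute : ∀ {L j} t w → All (λ i → Far i j) L → fs (replicate t j) (fs L w) ≡ fs L (fs (replicate t j) w)
powers-commute zero    w ps = refl
powers-commute {L} {j} (suc t) w ps = trans (cong (fs (replicate t j)) (f-fs-commute w ps)) (powers-commute t (f j w) ps)

-- Adding a letter i+1 (a closing bracket in colour i+1) or removing one (an opening bracket in colour i)
-- adds an unmatched closing bracket when there is no unmatched opening one.
⟶-above : ∀ {i u v} → u ⟶[ i ] v → ε (suc i) u ≡ 0 → φ (suc i) v ≡ suc (φ (suc i) u) × ε (suc i) v ≡ 0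
⟶-above {i} (here {w = w} _) z
  rewrite role-closing (suc i) | role-neutral {suc i} {i} (≢-sym 1+n≢n) (λ eq → m≢1+m+n i (trans eq (cong (λ n → suc n) (+-comm 1 i)))) = refl , z
⟶-above {i} (there {x = x} {w} {w′} _ s) z with a , b ← ⟶-above s (ε-tail (suc i) x w z) with role (suc i) x
... | closing = cong suc a , b
... | neutral = a , b
... | opening with φ (suc i) w | φ (suc i) w′ | a
...   | suc _ | _ | refl = refl , b

⟶-below : ∀ {i u v} → u ⟶[ suc i ] v → ε i u ≡ 0 → φ i v ≡ suc (φ i u) × ε i v ≡ 0
⟶-below {i} (here {w = w} _) z
  rewrite role-opening i | role-neutral {i} {suc (suc i)} (λ eq → m≢1+m+n i (trans (sym eq) (cong suc (+-comm 1 i)))) (λ eq → 1+n≢n (suc-injective eq))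
  with φ i w
... | suc _ = refl , z
⟶-below {i} (there {x = x} {w} {w′} _ s) z with a , b ← ⟶-below s (ε-tail i x w z) with role i x
... | closing = cong suc a , b
... | neutral = a , b
... | opening with φ i w | φ i w′ | a
...   | suc _ | _ | refl = refl , b

powers-above : ∀ i t w → t ≤ φ i w → ε (suc i) w ≡ 0 →
  φ (suc i) (fs (replicate t i) w) ≡ φ (suc i) w + t × ε (suc i) (fs (replicate t i) w) ≡ 0
powers-above i zero    w _  z = sym (+-identityʳ _) , z
powers-above i (suc t) w le z
  with s ← f-defined i w (≤-trans (s≤s z≤n) le) with a , b ← ⟶-above s z
  with c , d ← powers-above i t (f i w) (s≤s⁻¹ (subst (suc t ≤_) (⟶-φ s) le)) b =
  trans c (trans (cong (_+ t) a) (sym (+-suc _ t))) , d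

powers-below : ∀ i t w → t ≤ φ (suc i) w → ε i w ≡ 0 →
  φ i (fs (replicate t (suc i)) w) ≡ φ i w + t × ε i (fs (replicate t (suc i)) w) ≡ 0
powers-below i zero    w _  z = sym (+-identityʳ _) , z
powers-below i (suc t) w le z
  with s ← f-defined (suc i) w (≤-trans (s≤s z≤n) le) with a , b ← ⟶-below s z
  with c , d ← powers-below i t (f (suc i) w) (s≤s⁻¹ (subst (suc t ≤_) (⟶-φ s) le)) b =
  trans c (trans (cong (_+ t) a) (sym (+-suc _ t))) , d

-- Moving surplus powers to the left

sumTo : (ℕ → ℕ) → ℕ → ℕ
sumTo a zero    = 0
sumTo a (suc k) = sumTo a k + a (suc k)

ascending-far : ∀ a m j → suc m < j → All (λ i → Far i j) (ascendingPowers a m)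
ascending-far a m j lt = All-ascendingPowers a m (λ k k<m → far-below (≤-trans (s≤s (s≤s k<m)) lt))

-- The power of F_k finds a_k unmatched letters of w and the a_1 + ⋯ + a_{k-1} created by the
-- preceding power, so every power is fully defined and passes its whole exponent on to the next
-- colour.
φ-ascending : ∀ a m w → Source₁ (suc m) w → (∀ k → k < m → a (suc k) ≤ φ (suc k) w) →
  φ (suc m) (fs (ascendingPowers (sumTo a) m) w) ≡ φ (suc m) w + sumTo a m × ε (suc m) (fs (ascendingPowers (sumTo a) m) w) ≡ 0
φ-ascending a zero    w src le = sym (+-identityʳ _) , src 1 (s≤s z≤n , s≤s z≤n)
φ-ascending a (suc m) w src le
  rewrite fs-++ (ascendingPowers (sumTo a) m) (replicate (sumTo a (suc m)) (suc m)) w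
  with p , _ ← φ-ascending a m w (λ i c → src i (proj₁ c , m≤n⇒m≤1+n (proj₂ c))) (λ k lt → le k (m≤n⇒m≤1+n lt))
  with q , r ← fs-far w (ascending-far (sumTo a) m (suc (suc m)) ≤-refl)
  with s , t ← powers-above (suc m) (sumTo a (suc m)) (fs (ascendingPowers (sumTo a) m) w)
    (subst₂ _≤_ (+-comm (a (suc m)) (sumTo a m)) (sym p) (+-monoˡ-≤ (sumTo a m) (le m ≤-refl)))
    (trans (sym r) (src (suc (suc m)) (s≤s z≤n , ≤-refl))) =
  trans s (cong (_+ sumTo a (suc m)) (sym q)) , t

-- With x the current exponent P_m, these are F_1^{P_1}⋯F_m^{P_m} and F_1^{B_1}⋯F_{m+1}^{B_{m+1}},
-- where P_k = x + p_k + ⋯ + p_{m-1} and B_{m+1} = min(x, g).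
lowerPowers : ℕ → ℕ → (ℕ → ℕ) → List ℕ
lowerPowers zero    x p = []
lowerPowers (suc m) x p = replicate x (suc m) ++ lowerPowers m (x + p m) p

exchangedPowers : ℕ → ℕ → ℕ → (ℕ → ℕ) → (ℕ → ℕ) → List ℕ
exchangedPowers zero    x g a p = replicate g 1
exchangedPowers (suc m) x g a p = replicate (x ⊓ g) (suc (suc m)) ++ exchangedPowers m (x + p m) (a (suc m) + x) a p

All-lowerPowers : ∀ {P : ℕ → Set} m x p → (∀ j → j < m → P (suc j)) → All P (lowerPowers m x p)
All-lowerPowers zero    x p c = []
All-lowerPowers (suc m) x p c = ++⁺ (replicate⁺ x (c m ≤-refl)) (All-lowerPowers m (x + p m) p (λ j lt → c j (m≤n⇒m≤1+n lt)))

m∸n+m⊓n≡m : ∀ m n → m ∸ n + m ⊓ n ≡ m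
m∸n+m⊓n≡m m n = trans (+-comm (m ∸ n) (m ⊓ n)) (trans (cong (_+ (m ∸ n)) (⊓-comm m n)) (m⊓n+n∸m≡n n m))

-- The inequality that the rank-two relation demands at each stage, where y stands for x ∸ g. At the
-- next stage this difference is (x + p_m) ∸ (a_{m+1} + x) = p_m ∸ a_{m+1}, so x drops out.
Room : ℕ → ℕ → (ℕ → ℕ) → (ℕ → ℕ) → Word → Set
Room zero    y a p w = ⊤
Room (suc m) y a p w = a (suc m) + y ≤ φ (suc m) w × Room m (p m ∸ a (suc m)) a p w

Room-far : ∀ {w v} m y a p → (∀ k → k < m → φ (suc k) w ≡ φ (suc k) v) → Room m y a p w → Room m y a p v
Room-far zero    y a p eq _       = tt
Room-far (suc m) y a p eq (l , r) = subst (a (suc m) + y ≤_) (eq m ≤-refl) l , Room-far m _ a p (λ k lt → eq k (m≤n⇒m≤1+n lt)) r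

Room-≤ : ∀ {w} m y a p → Room m y a p w → ∀ k → k < m → a (suc k) ≤ φ (suc k) w
Room-≤ (suc m) y a p (l , r) k lt with m≤n⇒m<n∨m≡n lt
... | inj₁ (s≤s lt′) = Room-≤ m _ a p r k lt′
... | inj₂ refl      = ≤-trans (m≤m+n _ y) l

-- For m+1 in place of m, put M = m+1 and n = m+2: F_M^x F_n^{z+g} F_M^z becomes F_n^t F_M^{z+x}
-- F_n^{x⊓g}. The left power commutes with the remaining colours up to m and joins T; the right one
-- commutes with the ascending powers up to m and acts on w first. What remains has the same form
-- one rank lower, with a_M + x as the new g. Since n is at least 2, T avoids colour 1.
exchange : ∀ m x g a p w → Source₁ (suc m) w → g ≤ φ (suc m) w → Room m (x ∸ g) a p w →
  ∃ λ T → All (Between 2 (suc m)) T ×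
    fs (lowerPowers m x p) (fs (replicate (sumTo a m + g) (suc m)) (fs (ascendingPowers (sumTo a) m) w)) ≡ fs T (fs (exchangedPowers m x g a p) w)
exchange zero    x g a p w src g≤ room = [] , [] , refl
exchange (suc m) x g a p w src g≤ (room , rest) =
  T ++ replicate t n , ++⁺ (All.map (λ c → proj₁ c , m≤n⇒m≤1+n (proj₂ c)) (proj₁ (proj₂ ih))) (replicate⁺ t (s≤s (s≤s z≤n) , ≤-refl)) , (begin
    fs (replicate x M ++ lowerPowers m x′ p) (fs (replicate (z + g) n) (fs (A ++ replicate z M) w))
      ≡⟨ cong (λ v → fs (replicate x M ++ lowerPowers m x′ p) (fs (replicate (z + g) n) v)) (fs-++ A (replicate z M) w) ⟩
    fs (replicate x M ++ lowerPowers m x′ p) (fs (replicate (z + g) n) (fs (replicate z M) y))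
      ≡⟨ fs-++ (replicate x M) (lowerPowers m x′ p) _ ⟩
    fs (lowerPowers m x′ p) (fs (replicate x M) (fs (replicate (z + g) n) (fs (replicate z M) y)))
      ≡⟨ cong (fs (lowerPowers m x′ p)) (sym (fs-3 (replicate z M) (replicate (z + g) n) (replicate x M) y)) ⟩
    fs (lowerPowers m x′ p) (fs (replicate z M ++ replicate (z + g) n ++ replicate x M) y)
      ≡⟨ cong (fs (lowerPowers m x′ p)) (Braid.braid m y x z g (proj₂ y-signature) (trans (sym (proj₂ y-far)) (src n (s≤s z≤n , ≤-refl))) φM≥ (subst (g ≤_) (proj₁ y-far) g≤)) ⟩
    fs (lowerPowers m x′ p) (fs (replicate (x ⊓ g) n ++ replicate (z + x) M ++ replicate t n) y)
      ≡⟨ cong (fs (lowerPowers m x′ p)) (fs-3 (replicate (x ⊓ g) n) (replicate (z + x) M) (replicate t n) y) ⟩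
    fs (lowerPowers m x′ p) (fs (replicate t n) (fs (replicate (z + x) M) (fs (replicate (x ⊓ g) n) y)))
      ≡⟨ sym (powers-commute t _ (All-lowerPowers m x′ p (λ k lt → far-below (s≤s (s≤s lt))))) ⟩
    fs (replicate t n) (fs (lowerPowers m x′ p) (fs (replicate (z + x) M) (fs (replicate (x ⊓ g) n) y)))
      ≡⟨ cong (λ v → fs (replicate t n) (fs (lowerPowers m x′ p) (fs (replicate (z + x) M) v))) (powers-commute (x ⊓ g) w (ascending-far (sumTo a) m n ≤-refl)) ⟩
    fs (replicate t n) (fs (lowerPowers m x′ p) (fs (replicate (z + x) M) (fs A w′)))
      ≡⟨ cong (λ k → fs (replicate t n) (fs (lowerPowers m x′ p) (fs (replicate k M) (fs A w′)))) (+-assoc (sumTo a m) (a M) x) ⟩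
    fs (replicate t n) (fs (lowerPowers m x′ p) (fs (replicate (sumTo a m + (a M + x)) M) (fs A w′)))
      ≡⟨ cong (fs (replicate t n)) (proj₂ (proj₂ ih)) ⟩
    fs (replicate t n) (fs T (fs (exchangedPowers m x′ (a M + x) a p) w′))
      ≡⟨ sym (fs-++ T (replicate t n) _) ⟩
    fs (T ++ replicate t n) (fs (exchangedPowers m x′ (a M + x) a p) w′)
      ≡⟨ cong (fs (T ++ replicate t n)) (sym (fs-++ (replicate (x ⊓ g) n) _ w)) ⟩
    fs (T ++ replicate t n) (fs (exchangedPowers (suc m) x g a p) w) ∎)
  where
  open ≡-Reasoning
  M n z t x′ : ℕ
  M = suc m
  n = suc M
  z = sumTo a M
  t = z + (g ∸ x)
  x′ = x + p m
  A : List ℕ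
  A = ascendingPowers (sumTo a) m
  y w′ : Word
  y = fs A w
  w′ = fs (replicate (x ⊓ g) n) w
  fs-3 : ∀ L₁ L₂ L₃ v → fs (L₁ ++ L₂ ++ L₃) v ≡ fs L₃ (fs L₂ (fs L₁ v))
  fs-3 L₁ L₂ L₃ v = trans (fs-++ L₁ (L₂ ++ L₃) v) (fs-++ L₂ L₃ (fs L₁ v))
  far-w′ : ∀ k → k < m → SameSignature (suc k) w w′
  far-w′ k lt = fs-far w (replicate⁺ (x ⊓ g) (far-sym (far-below (s≤s (s≤s lt)))))
  far-φ : ∀ k → k < m → φ (suc k) w ≡ φ (suc k) w′
  far-φ k lt = proj₁ (far-w′ k lt)
  source′ : ε M w′ ≡ 0 → Source₁ M w′
  source′ εM (suc i) (p , q) with m≤n⇒m<n∨m≡n q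
  ... | inj₁ (s≤s lt) = trans (sym (proj₂ (far-w′ i lt))) (src (suc i) (s≤s z≤n , m≤n⇒m≤1+n (m≤n⇒m≤1+n lt)))
  ... | inj₂ refl = εM
  shift-∸ : x + p m ∸ (a M + x) ≡ p m ∸ a M
  shift-∸ = trans (cong (x + p m ∸_) (+-comm (a M) x)) ([m+n]∸[m+o]≡n∸o x (p m) (a M))
  y-signature : φ M y ≡ φ M w + sumTo a m × ε M y ≡ 0
  y-signature = φ-ascending a m w (λ i c → src i (proj₁ c , m≤n⇒m≤1+n (proj₂ c))) (Room-≤ m _ a p rest)
  y-far : SameSignature n w y
  y-far = fs-far w (ascending-far (sumTo a) m n ≤-refl)
  w′-signature : φ M w′ ≡ φ M w + x ⊓ g × ε M w′ ≡ 0
  w′-signature = powers-below M (x ⊓ g) w (≤-trans (m⊓n≤n x g) g≤) (src M (s≤s z≤n , n≤1+n M))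
  φM≥ : z + (x ∸ g) ≤ φ M y
  φM≥ = subst₂ _≤_ (trans (+-comm (a M + (x ∸ g)) (sumTo a m)) (sym (+-assoc (sumTo a m) (a M) (x ∸ g))))
    (sym (proj₁ y-signature)) (+-monoˡ-≤ (sumTo a m) room)
  ih : ∃ λ T → All (Between 2 M) T ×
    fs (lowerPowers m x′ p) (fs (replicate (sumTo a m + (a M + x)) M) (fs A w′)) ≡ fs T (fs (exchangedPowers m x′ (a M + x) a p) w′)
  ih = exchange m x′ (a M + x) a p w′ (source′ (proj₂ w′-signature))
    -- The new g is a_M + x, while `room` covers only a_M + (x ∸ g); the missing x ⊓ g letters are
    -- those that F_n^{x⊓g} has freed for colour M.
    (subst₂ _≤_ (trans (+-assoc (a M) _ _) (cong (a M +_) (m∸n+m⊓n≡m x g))) (sym (proj₁ w′-signature)) (+-monoˡ-≤ (x ⊓ g) room))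
    (subst (λ y → Room m y a p w′) (sym shift-∸) (Room-far m _ a p far-φ rest))
  T : List ℕ
  T = proj₁ ih

-- The principal operators as operator words

open import Data.Fin using (Fin; zero; suc; toℕ; fromℕ<)
open import Data.Fin.Properties using (toℕ<n; fromℕ<-toℕ; toℕ-fromℕ<)
open import Data.List using (map; concat; reverse; upTo; applyUpTo; allFin; tabulate; _∷ʳ_)
open import Data.List.Properties using (map-tabulate; map-upTo; map-++; reverse-++; upTo-∷ʳ; tabulate-cong)

down≡reverse : ∀ j k → reverse (map (j +_) (upTo k)) ≡ down j k
down≡reverse j zero    = refl
down≡reverse j (suc k) = begin
  reverse (map (j +_) (upTo (suc k)))              ≡⟨ cong (reverse ∘ map (j +_)) (sym (upTo-∷ʳ k)) ⟩
  reverse (map (j +_) (upTo k ∷ʳ k))               ≡⟨ cong reverse (map-++ (j +_) (upTo k) (k ∷ [])) ⟩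
  reverse (map (j +_) (upTo k) ∷ʳ (j + k))         ≡⟨ reverse-++ (map (j +_) (upTo k)) (j + k ∷ []) ⟩
  j + k ∷ reverse (map (j +_) (upTo k))            ≡⟨ cong (j + k ∷_) (down≡reverse j k) ⟩
  down j (suc k) ∎
  where open ≡-Reasoning

concat-replicate : ∀ n x → concat (replicate n x) ≡ times n x
concat-replicate zero    x = refl
concat-replicate (suc n) x = cong (x ++_) (concat-replicate n x)

blockOps-∷ : ∀ O a n → blockOps O a (suc n) ≡ times (a 1) (O 1) ++ blockOps (O ∘ suc) (a ∘ suc) n
blockOps-∷ O a zero    = sym (++-identityʳ _)
blockOps-∷ O a (suc n) = trans (cong (_++ times (a (2 + n)) (O (2 + n))) (blockOps-∷ O a n))
  (++-assoc (times (a 1) (O 1)) (blockOps (O ∘ suc) (a ∘ suc) n) _)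

concat-tabulate : ∀ O a n → concat (tabulate {n = n} λ i → times (a (suc (toℕ i))) (O (suc (toℕ i)))) ≡ blockOps O a n
concat-tabulate O a zero    = refl
concat-tabulate O a (suc n) = trans (cong (times (a 1) (O 1) ++_) (concat-tabulate (O ∘ suc) (a ∘ suc) n)) (sym (blockOps-∷ O a n))

-- One-based. The default 0 beyond n provides p_n = 0 and a_{n+1} = 0, the boundary values of the
-- exchange formula.
extend : ∀ {n} → (Fin n → ℕ) → ℕ → ℕ
extend         a zero = 0
extend {n = n} a (suc j) with j <? n
... | yes lt = a (fromℕ< lt)
... | no _   = 0

extend-toℕ : ∀ {n} (a : Fin n → ℕ) i → extend a (suc (toℕ i)) ≡ a i
extend-toℕ {n} a i with toℕ i <? n
... | yes lt = cong a (fromℕ<-toℕ i lt)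
... | no ge  = contradiction (toℕ<n i) ge

extend-beyond : ∀ {n} (a : Fin n → ℕ) j → n ≤ j → extend a (suc j) ≡ 0
extend-beyond {n} a j le with j <? n
... | yes lt = contradiction lt (≤⇒≯ le)
... | no _   = refl

-- Compares a partial operator with its total counterpart where it is defined; definedness of the
-- composites is supplied by the equations with `just`.
record Tracks (g : Word → Maybe Word) (L : List ℕ) : Set where
  constructor tracks
  field follow : ∀ w u → g w ≡ just u → fs L w ≡ u
open Tracks

tracks-seq : ∀ {g L M} gs → Tracks g L → Tracks (seqOps gs) M → Tracks (seqOps (g ∷ gs)) (L ++ M)
tracks-seq {g} {L} {M} gs t ts = tracks go
  where
  go : ∀ w u → seqOps (g ∷ gs) w ≡ just u → fs (L ++ M) w ≡ u
  go w u eq with g w in gw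
  ... | just v = trans (fs-++ L M w) (trans (cong (fs M) (follow t w v gw)) (follow ts v u eq))

tracks-[] : Tracks (seqOps []) []
tracks-[] = tracks λ { w u refl → refl }

tracks-iter : ∀ {g L} n → Tracks g L → Tracks (iterOp n g) (times n L)
tracks-iter         zero    t = tracks λ { w u refl → refl }
tracks-iter {g} {L} (suc n) t = tracks go
  where
  go : ∀ w u → iterOp (suc n) g w ≡ just u → fs (times (suc n) L) w ≡ u
  go w u eq with g w in gw
  ... | just v = trans (fs-++ L (times n L) w) (trans (cong (fs (times n L)) (follow t w v gw)) (follow (tracks-iter n t) v u eq))

tracks-F : ∀ L → Tracks (seqOps (map F L)) L
tracks-F []      = tracks-[]
tracks-F (i ∷ L) = tracks-seq {F i} {i ∷ []} (map F L) (tracks λ w u eq → ⟶-f (F-just {i} {w} {u} eq)) (tracks-F L)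

tracks-w : ∀ k j → Tracks (wOp k j) (down j k)
tracks-w k j = subst (λ L → Tracks (seqOps (map F L)) (down j k)) (sym (down≡reverse j k)) (tracks-F (down j k))

tracks-applyUpTo : ∀ k g j n → (∀ t → Tracks (g t) (down (t + j) k)) → Tracks (seqOps (applyUpTo g n)) (shifts j k n)
tracks-applyUpTo k g j zero    t = tracks-[]
tracks-applyUpTo k g j (suc n) t = tracks-seq {g 0} (applyUpTo (g ∘ suc) n) (t 0)
  (tracks-applyUpTo k (g ∘ suc) (suc j) n (λ s → subst (λ b → Tracks (g (suc s)) (down b k)) (sym (+-suc s j)) (t (suc s))))

tracks-S : ∀ n k → Tracks (SOp n k) (shifts 1 k (suc (n ∸ k)))
tracks-S n k = subst (λ gs → Tracks (seqOps gs) (shifts 1 k (suc (n ∸ k)))) (sym (map-upTo (λ t → wOp k (suc t)) (suc (n ∸ k))))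
  (tracks-applyUpTo k (λ t → wOp k (suc t)) 1 (suc (n ∸ k)) (λ t → subst (λ b → Tracks (wOp k (suc t)) (down b k)) (+-comm 1 t) (tracks-w k (suc t))))

tracks-tabulate : ∀ {n} (g : Fin n → Word → Maybe Word) L → (∀ i → Tracks (g i) (L i)) → Tracks (seqOps (tabulate g)) (concat (tabulate L))
tracks-tabulate {zero}  g L t = tracks-[]
tracks-tabulate {suc n} g L t = tracks-seq {g zero} (tabulate (g ∘ suc)) (t zero) (tracks-tabulate (g ∘ suc) (L ∘ suc) (t ∘ suc))

tracks-π : ∀ n a → Tracks (piOp n a) (principalOps n (extend a))
tracks-π n a = subst₂ (λ gs L → Tracks (seqOps gs) L)
  (sym (map-tabulate {n = n} (λ i → i) (λ i → iterOp (a i) (SOp n (suc (toℕ i))))))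
  (concat-tabulate (λ k → shifts 1 k (suc (n ∸ k))) (extend a) n)
  (tracks-tabulate _ _ λ i → subst (λ t → Tracks (iterOp (a i) (SOp n (suc (toℕ i)))) (times t _)) (sym (extend-toℕ a i))
    (tracks-iter (a i) (tracks-S n (suc (toℕ i)))))

-- The highest-weight word lists its columns by increasing height, opposite to `blocks`, so its
-- signature is computed separately, with `blockOps` reused to form a word.
source-blockOps : ∀ c n {i} → 1 ≤ i → ε i (blockOps H c n) ≡ 0 × φ i (blockOps H c n) ≡ weighted c (λ k → φ i (H k)) n
source-blockOps c zero    _  = refl , refl
source-blockOps c (suc n) {suc i} le with a , b ← source-blockOps c n {suc i} le =
  ε-++-0 (blockOps H c n) block a (ε-times (c (suc n)) (H (suc n)) z) ,
  trans (φ-++ (suc i) (blockOps H c n) block)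
    (trans (cong₂ (λ p q → p + (φ (suc i) block ∸ q)) b a) (cong (weighted c (λ k → φ (suc i) (H k)) n +_) (φ-times (c (suc n)) (H (suc n)) z)))
  where
  block = times (c (suc n)) (H (suc n))
  z : ε (suc i) (H (suc n)) ≡ 0
  z = down-ε {suc i} 1 (suc n) (λ ())

hw≡blockOps : ∀ n c → hw n c ≡ blockOps H (extend c) n
hw≡blockOps n c = begin
  concat (map column (allFin n)) ≡⟨ cong concat (map-tabulate {n = n} (λ i → i) column) ⟩
  concat (tabulate column)       ≡⟨ cong concat (tabulate-cong (λ i → trans (concat-replicate (c i) (colWord (suc (toℕ i))))
                                      (cong₂ times (sym (extend-toℕ c i)) (down≡reverse 1 (suc (toℕ i)))))) ⟩
  concat (tabulate {n = n} λ i → times (extend c (suc (toℕ i))) (H (suc (toℕ i)))) ≡⟨ concat-tabulate H (extend c) n ⟩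
  blockOps H (extend c) n ∎
  where
  open ≡-Reasoning
  column : Fin n → Word
  column i = concat (Data.List.replicate (c i) (colWord (suc (toℕ i))))

hw-Source : ∀ n c → Source₁ n (hw n c)
hw-Source n c i (p , _) rewrite hw≡blockOps n c = proj₁ (source-blockOps (extend c) n p)

φ-hw : ∀ n c k → k < n → φ (suc k) (hw n c) ≡ extend c (suc k)
φ-hw n c k lt rewrite hw≡blockOps n c = trans (proj₂ (source-blockOps (extend c) n (s≤s z≤n)))
  (weighted-single (extend c) (λ j → φ (suc k) (H j)) n k lt (φ-down-top 1 k) λ j _ ne → down-φ 1 j (λ eq → ne (sym (suc-injective eq))))

extend-≤ : ∀ {n} (a c : Fin n → ℕ) → (∀ i → a i ≤ c i) → ∀ k → extend a (suc k) ≤ extend c (suc k)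
extend-≤ {n} a c le k with k <? n
... | yes lt = le (fromℕ< lt)
... | no _   = z≤n

iterate-φ : ∀ i t w u → iterOp t (F i) w ≡ just u → t ≤ φ i w
iterate-φ i zero    w u _  = z≤n
iterate-φ i (suc t) w u eq with F i w in Fw
... | just v with s ← F-just {i} {w} {v} Fw = subst (suc t ≤_) (sym (⟶-φ s)) (s≤s (iterate-φ i t v u eq))

InBox-φ : ∀ {m s} (p : Fin m → ℕ) → InBox m s p → ∀ k → k < m → extend p (suc k) ≤ φ (suc k) s
InBox-φ {m} {s} p box k lt with k <? m
... | no ge = z≤n
... | yes lt′ with box (fromℕ< lt′)
...   | u , eq rewrite toℕ-fromℕ< lt′ = iterate-φ (suc k) (p (fromℕ< lt′)) s u eq

IsSourceFor-Source : ∀ {m s} → IsSourceFor 1 m s → Source₁ m s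
IsSourceFor-Source {m} {s} src i (p , q) with ε i s in z
... | zero  = refl
... | suc _ = ⊥-elim (src i (e i s) p q (⟶-F (e-defined i s (subst (1 ≤_) (sym z) (s≤s z≤n)))))

-- Recovering exponents from letter counts

above : ℕ → Word → ℕ
above j []      = 0
above j (x ∷ w) = (1 ⊓ (x ∸ j)) + above j w

-- Replacing i by i+1 crosses the threshold j only for i = j. Along a run `above j` therefore counts
-- the steps of colour j.
⟶-above-same : ∀ {j u v} → u ⟶[ j ] v → above j v ≡ suc (above j u)
⟶-above-same {j} (here {w = w} _) rewrite m+n∸n≡m 1 j | n∸n≡0 j = refl
⟶-above-same {j} (there {x = x} _ s) = trans (cong (1 ⊓ (x ∸ j) +_) (⟶-above-same s)) (+-suc _ _)

⟶-above-other : ∀ {i j u v} → i ≢ j → u ⟶[ i ] v → above j v ≡ above j u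
⟶-above-other {i} {j} ne (here {w = w} _) = cong (_+ above j w) letter
  where
  letter : 1 ⊓ (suc i ∸ j) ≡ 1 ⊓ (i ∸ j)
  letter with <-cmp i j
  ... | tri< lt _ _ rewrite m≤n⇒m∸n≡0 lt | m≤n⇒m∸n≡0 (<⇒≤ lt) = refl
  ... | tri≈ _ eq _ = contradiction eq ne
  ... | tri> _ _ gt = trans (m≤n⇒m⊓n≡m (m<n⇒0<n∸m (m<n⇒m<1+n gt))) (sym (m≤n⇒m⊓n≡m (m<n⇒0<n∸m gt)))
⟶-above-other {j = j} ne (there {x = x} _ s) = cong (1 ⊓ (x ∸ j) +_) (⟶-above-other ne s)

above-same : ∀ {j t L u v} → Eff (replicate t j ++ L) u v → (∀ {x} → Eff L x v → above j v ≡ above j x) → above j v ≡ above j u + t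
above-same {t = zero}  r       g = trans (g r) (sym (+-identityʳ _))
above-same {t = suc t} (s ∷ r) g = trans (above-same {t = t} r g) (trans (cong (_+ t) (⟶-above-same s)) (sym (+-suc _ t)))

above-other : ∀ {i j t L u v} → i ≢ j → Eff (replicate t i ++ L) u v → ∃ λ x → Eff L x v × above j x ≡ above j u
above-other {t = zero}  ne r       = _ , r , refl
above-other {t = suc t} ne (s ∷ r) with x , r′ , eq ← above-other {t = t} ne r = x , r′ , trans eq (⟶-above-other ne s)

above-descending-beyond : ∀ B N j {u v} → N < j → Eff (descendingPowers B N) u v → above j v ≡ above j u
above-descending-beyond B zero    j lt [] = refl
above-descending-beyond B (suc N) j lt r with x , r′ , eq ← above-other {suc N} {j} {B (suc N)} (<⇒≢ lt) r =
  trans (above-descending-beyond B N j (<-trans ≤-refl lt) r′) eq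

above-descending : ∀ B N j {u v} → j < N → Eff (descendingPowers B N) u v → above (suc j) v ≡ above (suc j) u + B (suc j)
above-descending B (suc N) j lt r with m≤n⇒m<n∨m≡n lt
... | inj₂ refl = above-same {suc N} {B (suc N)} r (above-descending-beyond B N (suc N) ≤-refl)
... | inj₁ (s≤s lt′) with x , r′ , eq ← above-other {suc N} {suc j} {B (suc N)} (λ eq → <⇒≢ lt′ (sym (suc-injective eq))) r =
  trans (above-descending B N j lt′ r′) (cong (_+ B (suc j)) eq)

tailSum-zero : ∀ a N j → N < j → tailSum a N j ≡ 0
tailSum-zero a N j lt = weighted-zero a [ j ≤?] N λ k k<N → cong (1 ⊓_) (m≤n⇒m∸n≡0 (≤-trans (s≤s k<N) lt))

[≤?]-true : ∀ {j k} → j ≤ k → [ j ≤?] k ≡ 1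
[≤?]-true le = m≤n⇒m⊓n≡m (m<n⇒0<n∸m (s≤s le))

tailSum-step : ∀ a N j → j < N → tailSum a N (suc j) ≡ tailSum a N (suc (suc j)) + a (suc j)
tailSum-step a (suc N) j lt with m≤n⇒m<n∨m≡n lt
... | inj₂ refl rewrite tailSum-zero a N (suc N) ≤-refl | tailSum-zero a (suc N) (2 + N) ≤-refl
                      | [≤?]-true {suc N} {suc N} ≤-refl = *-identityʳ (a (suc N))
... | inj₁ (s≤s lt′) rewrite [≤?]-true {suc j} {suc N} lt | [≤?]-true {2 + j} {suc N} (s≤s lt′) | tailSum-step a N j lt′ =
  trans (+-assoc (tailSum a N (2 + j)) _ _) (trans (cong (tailSum a N (2 + j) +_) (+-comm (a (suc j)) _)) (sym (+-assoc (tailSum a N (2 + j)) _ _)))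

headSum≡sumTo : ∀ a N j → j ≤ N → headSum a N j ≡ sumTo a j
headSum≡sumTo a zero    zero    _  = refl
headSum≡sumTo a (suc N) j le with m≤n⇒m<n∨m≡n le
... | inj₁ (s≤s le′) rewrite m≤n⇒m∸n≡0 (s≤s le′) | *-zeroʳ (a (suc N)) = trans (+-identityʳ _) (headSum≡sumTo a N j le′)
... | inj₂ refl = cong₂ _+_ (all N ≤-refl) (trans (cong (a (suc N) *_) (one N ≤-refl)) (*-identityʳ (a (suc N))))
  where
  one : ∀ k → k ≤ N → [ suc N ≥?] (suc k) ≡ 1
  one k le = m≤n⇒m⊓n≡m (m<n⇒0<n∸m (s≤s le))
  all : ∀ K → K ≤ N → weighted a [ suc N ≥?] K ≡ sumTo a K
  all zero    _  = refl
  all (suc K) le = cong₂ _+_ (all K (≤-trans (n≤1+n K) le)) (trans (cong (a (suc K) *_) (one K (≤-trans (n≤1+n K) le))) (*-identityʳ (a (suc K))))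

ascendingPowers-cong : ∀ {A B} N → (∀ k → k < N → A (suc k) ≡ B (suc k)) → ascendingPowers A N ≡ ascendingPowers B N
ascendingPowers-cong zero    eq = refl
ascendingPowers-cong (suc N) eq = cong₂ _++_ (ascendingPowers-cong N (λ k lt → eq k (m≤n⇒m≤1+n lt))) (cong (λ t → replicate t (suc N)) (eq N ≤-refl))

-- The condition on x is guarded by m ≡ suc k because at m = 0 the accumulated x lies past the last
-- exponent and is no tail sum to be matched.
lowerPowers≡ : ∀ p M m x → m ≤ M → (∀ k → m ≡ suc k → x ≡ tailSum p M (suc k)) → lowerPowers m x p ≡ descendingPowers (tailSum p M) m
lowerPowers≡ p M zero    x _  _  = refl
lowerPowers≡ p M (suc m) x le eq = cong₂ _++_ (cong (λ t → replicate t (suc m)) (eq m refl))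
  (lowerPowers≡ p M m (x + p m) (≤-trans (n≤1+n m) le) λ { k refl → trans (cong (_+ p (suc k)) (eq (suc k) refl)) (sym (tailSum-step p M k (≤-trans (n≤1+n (suc k)) le))) })

-- The coordinate of the lower subcrystal, b_k = (p_k - a_{k+1})⁺ + min(a_k, p_{k-1}) with p_0 := a_1.
exchangedLow : (ℕ → ℕ) → (ℕ → ℕ) → ℕ → ℕ
exchangedLow a p zero          = 0
exchangedLow a p (suc zero)    = a 1
exchangedLow a p (suc (suc k)) = a (suc (suc k)) ⊓ p (suc k)

exchanged : (ℕ → ℕ) → (ℕ → ℕ) → ℕ → ℕ
exchanged a p k = (p k ∸ a (suc k)) + exchangedLow a p k

-- The sum telescopes: (p_k - a_{k+1})⁺ at index k and min(a_{k+1}, p_k) at index k+1 add up to p_k.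
-- The induction descends from the top index, t being the distance to it.
tailSum-exchanged : ∀ a p m t j → suc j + t ≡ suc m → p (suc m) ≡ 0 →
  tailSum (exchanged a p) (suc m) (suc j) ≡ tailSum p m (suc j) + exchangedLow a p (suc j)
tailSum-exchanged a p m zero j eq pn with refl ← trans (sym (+-identityʳ j)) (suc-injective eq)
  rewrite tailSum-step (exchanged a p) (suc m) m ≤-refl | tailSum-zero (exchanged a p) (suc m) (2 + m) ≤-refl
        | tailSum-zero p m (suc m) ≤-refl | pn | 0∸n≡0 (a (2 + m)) = refl
tailSum-exchanged a p m (suc t) j eq pn = begin
  tailSum b (suc m) (suc j) ≡⟨ tailSum-step b (suc m) j (subst (suc j ≤_) eq (m≤m+n (suc j) (suc t))) ⟩
  tailSum b (suc m) (2 + j) + ((p (suc j) ∸ a (2 + j)) + low)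
    ≡⟨ cong (_+ ((p (suc j) ∸ a (2 + j)) + low)) (tailSum-exchanged a p m t (suc j) (trans (cong suc (sym (+-suc j t))) eq) pn) ⟩
  (tailSum p m (2 + j) + a (2 + j) ⊓ p (suc j)) + ((p (suc j) ∸ a (2 + j)) + low)
    ≡⟨ trans (sym (+-assoc (tailSum p m (2 + j) + a (2 + j) ⊓ p (suc j)) _ low)) (cong (_+ low) (trans (+-assoc (tailSum p m (2 + j)) _ _) (cong (tailSum p m (2 + j) +_) (m⊓n+n∸m≡n (a (2 + j)) (p (suc j)))))) ⟩
  (tailSum p m (2 + j) + p (suc j)) + low ≡⟨ cong (_+ low) (sym (tailSum-step p m j (s≤s⁻¹ (subst (suc (suc j) ≤_) (trans (sym (+-suc (suc j) t)) eq) (m≤m+n (suc (suc j)) t))))) ⟩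
  tailSum p m (suc j) + low ∎
  where
  open ≡-Reasoning
  b = exchanged a p
  low = exchangedLow a p (suc j)

-- Addition distributes over the minimum: min(P_{j-1}, a_j + P_j) = P_j + min(p_{j-1}, a_j), since
-- P_{j-1} = P_j + p_{j-1}.
exchangedPowers≡ : ∀ a p M m x g → p (suc M) ≡ 0 → m ≤ M → g ≡ a (suc m) + tailSum p M (suc m) → (∀ k → m ≡ suc k → x ≡ tailSum p M (suc k)) →
  exchangedPowers m x g a p ≡ descendingPowers (tailSum (exchanged a p) (suc M)) (suc m)
exchangedPowers≡ a p M zero    x g pn _  refl _  =
  trans (cong (λ t → replicate t 1) (sym (trans (tailSum-exchanged a p M M 0 refl pn) (+-comm (tailSum p M 1) (a 1))))) (sym (++-identityʳ _))
exchangedPowers≡ a p M (suc m) x g pn le refl eq with refl ← eq m refl = cong₂ _++_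
  (cong (λ t → replicate t (2 + m)) (sym exponent))
  (exchangedPowers≡ a p M m (x + p m) (a (suc m) + x) pn (≤-trans (n≤1+n m) le) refl
    λ { k refl → sym (tailSum-step p M k (≤-trans (n≤1+n (suc k)) le)) })
  where
  exponent : tailSum (exchanged a p) (suc M) (2 + m) ≡ tailSum p M (suc m) ⊓ (a (2 + m) + tailSum p M (2 + m))
  exponent = begin
    tailSum (exchanged a p) (suc M) (2 + m) ≡⟨ tailSum-exchanged a p M (M ∸ suc m) (suc m) (cong suc (m+[n∸m]≡n le)) pn ⟩
    tailSum p M (2 + m) + a (2 + m) ⊓ p (suc m) ≡⟨ +-distribˡ-⊓ (tailSum p M (2 + m)) _ _ ⟩
    (tailSum p M (2 + m) + a (2 + m)) ⊓ (tailSum p M (2 + m) + p (suc m)) ≡⟨ ⊓-comm (tailSum p M (2 + m) + a (2 + m)) _ ⟩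
    (tailSum p M (2 + m) + p (suc m)) ⊓ (tailSum p M (2 + m) + a (2 + m)) ≡⟨ cong₂ _⊓_ (sym (tailSum-step p M m le)) (+-comm (tailSum p M (2 + m)) (a (2 + m))) ⟩
    tailSum p M (suc m) ⊓ (a (2 + m) + tailSum p M (2 + m)) ∎
    where open ≡-Reasoning

-- Signed differences and identification of the coordinates

open import Data.Integer using (ℤ; +_)
import Data.Integer as ℤ
import Data.Integer.Properties as ℤ
open import Algebra.Bundles using (AbelianGroup)
import Algebra.Properties.Group as GroupProperties

Conn-widen : ∀ {lo hi hi′ u v} → hi ≤ hi′ → Conn lo hi u v → Conn lo hi′ u v
Conn-widen le c-refl             = c-refl
Conn-widen le (c-fwd i p q eq c) = c-fwd i p (≤-trans q le) eq (Conn-widen le c)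
Conn-widen le (c-bwd i p q eq c) = c-bwd i p (≤-trans q le) eq (Conn-widen le c)

Room-intro : ∀ {w} m a p → (∀ k → k < m → a (suc k) + (p (suc k) ∸ a (suc (suc k))) ≤ φ (suc k) w) →
  Room m (p m ∸ a (suc m)) a p w
Room-intro zero    a p le = tt
Room-intro (suc m) a p le = le m ≤-refl , Room-intro m a p (λ k lt → le k (m≤n⇒m≤1+n lt))

-- For c_k, a_k, p_k and a_{k+1}, the second hypothesis says that p lies in the box of c↑; this is
-- where membership in the upper principal lattice yields `Room`.
room-≤ : ∀ {a c p a′} → a ≤ c → p ≤ (c ∸ a) + a′ → a + (p ∸ a′) ≤ c
room-≤ {a} {c} {p} {a′} le le′ = subst (a + (p ∸ a′) ≤_) (m+[n∸m]≡n le)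
  (+-monoʳ-≤ a (subst (p ∸ a′ ≤_) (m+n∸n≡m (c ∸ a) a′) (∸-monoˡ-≤ a′ le′)))

exchanged-≤ : ∀ {a c p a′ low} → a ≤ c → p ≤ (c ∸ a) + a′ → low ≤ a → (p ∸ a′) + low ≤ c
exchanged-≤ {a} {p = p} {a′} {low} le le′ le″ = ≤-trans (+-monoʳ-≤ (p ∸ a′) le″)
  (≤-trans (≤-reflexive (+-comm (p ∸ a′) a)) (room-≤ le le′))

exchangedLow-≤ : ∀ a p k → exchangedLow a p (suc k) ≤ a (suc k)
exchangedLow-≤ a p zero    = ≤-refl
exchangedLow-≤ a p (suc k) = m⊓n≤m _ _

difference-sign : ∀ {p h d} → + p ≡ + h ℤ.+ d → (h ≤ p × d ≡ + (p ∸ h)) ⊎ (p ≤ h × d ≡ ℤ.- (+ (h ∸ p)))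
difference-sign {p} {h} {d} eq with ≤-total h p
... | inj₁ le = inj₁ (le , ∙-cancelˡ (+ h) d (+ (p ∸ h)) (trans (sym eq) (cong +_ (sym (m+[n∸m]≡n le)))))
  where open GroupProperties (AbelianGroup.group ℤ.+-0-abelianGroup)
... | inj₂ le = inj₂ (le , ∙-cancelˡ (+ h) d (ℤ.- (+ (h ∸ p))) (trans (sym eq) (sym (trans (ℤ.m-n≡m⊖n h (h ∸ p))
  (trans (ℤ.⊖-≥ (m∸n≤m h p)) (cong +_ (m∸[m∸n]≡n le)))))))
  where open GroupProperties (AbelianGroup.group ℤ.+-0-abelianGroup)

nonpositive-⁺ : ∀ k → (ℤ.- (+ k)) ⁺ ≡ ℤ.0ℤ
nonpositive-⁺ zero    = refl
nonpositive-⁺ (suc k) = refl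

nonpositive-⁻ : ∀ k → (ℤ.- (+ k)) ⁻ ≡ ℤ.- (+ k)
nonpositive-⁻ zero    = refl
nonpositive-⁻ (suc k) = refl

⊖-⁺ : ∀ {p h d} → + p ≡ + h ℤ.+ d → d ⁺ ≡ + (p ∸ h)
⊖-⁺ {p} {h} {d} eq with difference-sign {p} {h} {d} eq
... | inj₁ (_ , refl)  = cong +_ (⊔-identityʳ (p ∸ h))
... | inj₂ (le , refl) = trans (nonpositive-⁺ (h ∸ p)) (cong +_ (sym (m≤n⇒m∸n≡0 le)))

+-⁻ : ∀ {p h d} → + p ≡ + h ℤ.+ d → + h ℤ.+ d ⁻ ≡ + (h ⊓ p)
+-⁻ {p} {h} {d} eq with difference-sign {p} {h} {d} eq
... | inj₁ (le , refl) = cong +_ (trans (cong (λ t → h + t) (⊓-zeroʳ (p ∸ h))) (trans (+-identityʳ h) (sym (m≤n⇒m⊓n≡m le))))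
... | inj₂ (le , refl) = trans (cong (ℤ._+_ (+ h)) (nonpositive-⁻ (h ∸ p))) (trans (sym eq) (cong +_ (sym (m≥n⇒m⊓n≡n le))))

DeltaExt-extend : ∀ {m} (Δ : Fin m → ℤ) (p h : Fin m → ℕ) → (∀ i → + (p i) ≡ + (h i) ℤ.+ Δ i) →
  ∀ k → + (extend p k) ≡ + (extend h k) ℤ.+ DeltaExt m Δ k
DeltaExt-extend     Δ p h eq zero    = refl
DeltaExt-extend {m} Δ p h eq (suc k) with k <? m
... | yes lt = eq (fromℕ< lt)
... | no _   = refl

-- With p_k = a_{k+1} + Δ_k the truncated difference p_k ∸ a_{k+1} is Δ_k⁺, and min(a_k, p_{k-1}) is
-- a_k + Δ_{k-1}⁻. The two boundary terms agree with Δ_0 = Δ_{m+1} = 0.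
exchanged-Δ : ∀ {m} a (p : Fin m → ℕ) (Δ : Fin m → ℤ) →
  (∀ k → k < m → + (extend p (suc k)) ≡ + (a (suc (suc k))) ℤ.+ DeltaExt m Δ (suc k)) →
  a (suc (suc m)) ≡ 0 → ∀ k → k < suc m →
  + (exchanged a (extend p) (suc k)) ≡ + (a (suc k)) ℤ.+ (DeltaExt m Δ (suc k)) ⁺ ℤ.+ (DeltaExt m Δ k) ⁻
exchanged-Δ {m} a p Δ eq a≡0 k lt = begin
  + (extend p (suc k) ∸ a (2 + k)) ℤ.+ + exchangedLow a (extend p) (suc k) ≡⟨ cong₂ ℤ._+_ (sym (plus k lt)) (sym (minus k lt)) ⟩
  Δ⁺ ℤ.+ (+ (a (suc k)) ℤ.+ Δ⁻)  ≡⟨ sym (ℤ.+-assoc Δ⁺ (+ (a (suc k))) Δ⁻) ⟩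
  Δ⁺ ℤ.+ + (a (suc k)) ℤ.+ Δ⁻    ≡⟨ cong (ℤ._+ Δ⁻) (ℤ.+-comm Δ⁺ (+ (a (suc k)))) ⟩
  + (a (suc k)) ℤ.+ Δ⁺ ℤ.+ Δ⁻    ∎
  where
  open ≡-Reasoning
  Δ⁺ = (DeltaExt m Δ (suc k)) ⁺
  Δ⁻ = (DeltaExt m Δ k) ⁻
  last : DeltaExt m Δ (suc m) ≡ ℤ.0ℤ
  last with m <? m
  ... | yes lt = contradiction lt (<-irrefl refl)
  ... | no _   = refl
  plus : ∀ k → k < suc m → (DeltaExt m Δ (suc k)) ⁺ ≡ + (extend p (suc k) ∸ a (2 + k))
  plus k lt with m≤n⇒m<n∨m≡n lt
  ... | inj₁ (s≤s lt′) = ⊖-⁺ {extend p (suc k)} {a (2 + k)} {DeltaExt m Δ (suc k)} (eq k lt′)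
  ... | inj₂ refl rewrite last | extend-beyond p m ≤-refl | a≡0 = refl
  minus : ∀ k → k < suc m → + (a (suc k)) ℤ.+ (DeltaExt m Δ k) ⁻ ≡ + exchangedLow a (extend p) (suc k)
  minus zero    _  = ℤ.+-identityʳ _
  minus (suc k) lt = +-⁻ {extend p (suc k)} {a (2 + k)} {DeltaExt m Δ (suc k)} (eq k (s≤s⁻¹ lt))

-- All powers leading to the lower source are defined, so its count of letters above j exceeds that
-- of w by exactly the tail sum at j; consecutive tail sums differ by the coordinates.
principal-exponents : ∀ N w → Source₁ N w → ∀ {L a a′} (p : ∀ k → k < N → a (suc k) ≤ φ (suc k) w) (p′ : ∀ k → k < N → a′ (suc k) ≤ φ (suc k) w) →
  L ≡ fs (descendingPowers (tailSum a N) N) w → L ≡ fs (descendingPowers (tailSum a′ N) N) w → ∀ k → k < N → a (suc k) ≡ a′ (suc k)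
principal-exponents N w src {L} {a} {a′} p p′ refl eq k lt = +-cancelˡ-≡ (tailSum a N (2 + k)) _ _ (begin
  tailSum a N (2 + k) + a (suc k)   ≡⟨ sym (tailSum-step a N k lt) ⟩
  tailSum a N (suc k)               ≡⟨ sums k lt ⟩
  tailSum a′ N (suc k)              ≡⟨ tailSum-step a′ N k lt ⟩
  tailSum a′ N (2 + k) + a′ (suc k) ≡⟨ cong (_+ a′ (suc k)) (sym next) ⟩
  tailSum a N (2 + k) + a′ (suc k)  ∎)
  where
  open ≡-Reasoning
  module A = Model N w src a p
  module A′ = Model N w src a′ p′
  sums : ∀ j → j < N → tailSum a N (suc j) ≡ tailSum a′ N (suc j)
  sums j lt = +-cancelˡ-≡ (above (suc j) w) _ _ (begin
    above (suc j) w + tailSum a N (suc j)  ≡⟨ sym (above-descending (tailSum a N) N j lt A.lowerSource-Eff) ⟩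
    above (suc j) (fs A.lowerSourceOps w)  ≡⟨ cong (above (suc j)) eq ⟩
    above (suc j) (fs A′.lowerSourceOps w) ≡⟨ above-descending (tailSum a′ N) N j lt A′.lowerSource-Eff ⟩
    above (suc j) w + tailSum a′ N (suc j) ∎)
  next : tailSum a N (2 + k) ≡ tailSum a′ N (2 + k)
  next with m≤n⇒m<n∨m≡n lt
  ... | inj₁ lt′  = sums (suc k) lt′
  ... | inj₂ refl = trans (tailSum-zero a N (2 + k) ≤-refl) (sym (tailSum-zero a′ N (2 + k) ≤-refl))

module Neighbour (m : ℕ) (w : Word) (source : Source₁ (2 + m) w) (a p : ℕ → ℕ)
  (a≤φ : ∀ k → k < 2 + m → a (suc k) ≤ φ (suc k) w)
  (p-beyond : p (2 + m) ≡ 0)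
  (p≤ : ∀ k → k < suc m → p (suc k) ≤ (φ (suc k) w ∸ a (suc k)) + a (2 + k)) where

  private
    M N : ℕ
    M = suc m
    N = suc M

  open Upper M w source a a≤φ public using (upperSource; upperSource-Source; φ-upperSource; principal-upperSource)

  exchanged≤φ : ∀ k → k < N → exchanged a p (suc k) ≤ φ (suc k) w
  exchanged≤φ k lt with m≤n⇒m<n∨m≡n lt
  ... | inj₁ (s≤s lt′) = exchanged-≤ (a≤φ k lt) (p≤ k lt′) (exchangedLow-≤ a p k)
  ... | inj₂ refl rewrite p-beyond | 0∸n≡0 (a (suc N)) = ≤-trans (exchangedLow-≤ a p k) (a≤φ k lt)

  -- The exchange starts from x = p_M, which is P_M, and g = a_N, because P_N = 0.
  exchange-path : ∃ λ T → All (Between 2 N) T ×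
    fs (descendingPowers (tailSum p M) M) upperSource ≡ fs T (fs (descendingPowers (tailSum (exchanged a p) N) N) w)
  exchange-path = T , proj₁ (proj₂ exchange-T) , (begin
    fs (descendingPowers (tailSum p M) M) upperSource
      ≡⟨ cong₂ fs (sym (lowerPowers≡ p M M (p M) ≤-refl λ { _ refl → p≡ })) (cong (λ L → fs L w) (ascendingPowers-cong N (λ k lt → headSum≡sumTo a N (suc k) lt))) ⟩
    fs (lowerPowers M (p M) p) (fs (ascendingPowers (sumTo a) M ++ replicate (sumTo a M + a N) N) w)
      ≡⟨ cong (fs (lowerPowers M (p M) p)) (fs-++ (ascendingPowers (sumTo a) M) _ w) ⟩
    fs (lowerPowers M (p M) p) (fs (replicate (sumTo a M + a N) N) (fs (ascendingPowers (sumTo a) M) w))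
      ≡⟨ proj₂ (proj₂ exchange-T) ⟩
    fs T (fs (exchangedPowers M (p M) (a N) a p) w)
      ≡⟨ cong (λ L → fs T (fs L w)) (exchangedPowers≡ a p M M (p M) (a N) p-beyond ≤-refl
           (sym (trans (cong (λ t → a N + t) (tailSum-zero p M N ≤-refl)) (+-identityʳ (a N)))) λ { _ refl → p≡ }) ⟩
    fs T (fs (descendingPowers (tailSum (exchanged a p) N) N) w) ∎)
    where
    open ≡-Reasoning
    exchange-T = exchange M (p M) (a N) a p w source (a≤φ M ≤-refl)
      (Room-intro M a p λ k lt → room-≤ (a≤φ k (m≤n⇒m≤1+n lt)) (p≤ k lt))
    T = proj₁ exchange-T
    p≡ : p M ≡ tailSum p M M
    p≡ = sym (trans (tailSum-step p M m ≤-refl) (cong (_+ p M) (tailSum-zero p M N ≤-refl)))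

  -- Inside the upper subcrystal, colours 2,...,M lead from v to the lower source of coordinate p;
  -- the surplus powers, of colours 2,...,N, link that vertex to the lower source of K with the
  -- exchanged coordinate.
  neighbour-Conn : (∀ k → k < M → p (suc k) ≤ φ (suc k) upperSource) →
    Conn 2 N (fs (principalOps M p) upperSource) (fs (descendingPowers (tailSum (exchanged a p) N) N) w)
  neighbour-Conn p≤φ = Conn-trans (Conn-widen (n≤1+n M) (Model.lowerSource-Conn M upperSource upperSource-Source p p≤φ))
    (Conn-sym (subst (Conn 2 N _) (sym (proj₂ (proj₂ exchange-path))) (Conn-fs _ (proj₁ (proj₂ exchange-path)))))

  -- The lower subcrystal through π[b] determines b: its source is unique, and so are the exponents leading to it.
  neighbour-exponents : ∀ b → (∀ k → k < N → b (suc k) ≤ φ (suc k) w) → (∀ k → k < M → p (suc k) ≤ φ (suc k) upperSource) →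
    Conn 2 N (fs (principalOps M p) upperSource) (fs (principalOps N b) w) → ∀ k → k < N → b (suc k) ≡ exchanged a p (suc k)
  neighbour-exponents b b≤φ p≤φ c = principal-exponents N w source b≤φ exchanged≤φ refl
    (WindowUniqueness.source-unique 1 M
      (Model.lowerSource-Source N w source b b≤φ) (Model.lowerSource-Source N w source (exchanged a p) exchanged≤φ)
      (Conn-trans (Conn-sym (Model.lowerSource-Conn N w source b b≤φ)) (Conn-trans (Conn-sym c) (neighbour-Conn p≤φ))))

-- Lowest columns of height k+1 in rank m and of height k+2 in rank m+1 have the same bottom letter,
-- so the same value of `ε` at the common vertex reads both coordinates.
upper-coordinate : ∀ m w → (source : Source₁ (suc m) w) (a : ℕ → ℕ) (a≤φ : ∀ k → k < suc m → a (suc k) ≤ φ (suc k) w) →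
  ∀ s → Source₁ m s → (h : ℕ → ℕ) → (∀ k → k < m → h (suc k) ≤ φ (suc k) s) →
  fs (principalOps m h) s ≡ fs (principalOps (suc m) a) w → ∀ k → k < m → h (suc k) ≡ a (2 + k)
upper-coordinate m w source a a≤φ s s-source h h≤φ eq k lt = begin
  h (suc k)                                  ≡⟨ sym (Model.ε-principal m s s-source h h≤φ k r k+r) ⟩
  ε (suc r) (fs (principalOps m h) s)        ≡⟨ cong (ε (suc r)) eq ⟩
  ε (suc r) (fs (principalOps (suc m) a) w)  ≡⟨ Model.ε-principal (suc m) w source a a≤φ (suc k) r (cong suc k+r) ⟩
  a (2 + k)                                  ∎
  where
  open ≡-Reasoning
  r = m ∸ suc k
  k+r : suc k + r ≡ m
  k+r = m+[n∸m]≡n lt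

-- Both vertices are sources for the colours 1,...,m and both are connected to π[a] by these
-- colours. It replaces the abstract source s by a computed one.
upperSource-unique : ∀ m w → (source : Source₁ (suc m) w) (a : ℕ → ℕ) (a≤φ : ∀ k → k < suc m → a (suc k) ≤ φ (suc k) w) →
  ∀ s → Source₁ m s → Conn 1 m (fs (principalOps (suc m) a) w) s → s ≡ Upper.upperSource m w source a a≤φ
upperSource-unique m w source a a≤φ s s-source c = WindowUniqueness.source-unique 0 m s-source upperSource-Source
  (Conn-trans (Conn-sym c) (subst (λ x → Conn 1 m x upperSource) principal-upperSource
    (Conn-sym (Conn-fs upperSource (principalOps-colours m (a ∘ suc))))))
  where open Upper m w source a a≤φ

extend-bound : ∀ n (c a : Fin n → ℕ) → (∀ i → a i ≤ c i) → ∀ k → k < n → extend a (suc k) ≤ φ (suc k) (hw n c)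
extend-bound n c a a≤c k lt = subst (extend a (suc k) ≤_) (sym (φ-hw n c k lt)) (extend-≤ a c a≤c k)

neighbour-principal : ∀ m w (source : Source₁ (2 + m) w) (a p h b : ℕ → ℕ) s →
  (∀ k → k < 2 + m → a (suc k) ≤ φ (suc k) w) → (∀ k → k < 2 + m → b (suc k) ≤ φ (suc k) w) →
  Source₁ (suc m) s → Conn 1 (suc m) (fs (principalOps (2 + m) a) w) s →
  (∀ k → k < suc m → h (suc k) ≤ φ (suc k) s) → fs (principalOps (suc m) h) s ≡ fs (principalOps (2 + m) a) w →
  p (2 + m) ≡ 0 → (∀ k → k < suc m → p (suc k) ≤ φ (suc k) s) →
  Conn 2 (2 + m) (fs (principalOps (suc m) p) s) (fs (principalOps (2 + m) b) w) →
  (∀ k → k < suc m → h (suc k) ≡ a (2 + k)) × (∀ k → k < 2 + m → b (suc k) ≡ exchanged a p (suc k))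
neighbour-principal m w source a p h b s a≤φ b≤φ s-source xa-s h≤φ πh p-beyond p≤φ v-xb
  with refl ← upperSource-unique (suc m) w source a a≤φ s s-source xa-s =
  upper-coordinate (suc m) w source a a≤φ s s-source h h≤φ πh ,
  Neighbour.neighbour-exponents m w source a p a≤φ p-beyond
    (λ k lt → subst (p (suc k) ≤_) (Upper.φ-upperSource (suc m) w source a a≤φ k lt) (p≤φ k lt)) b b≤φ p≤φ v-xb

theorem3 : (m : ℕ) → 1 ≤ m → (c : Fin (suc m) → ℕ)
    → (a : Fin (suc m) → ℕ) → (∀ i → a i ≤ c i)
    → (xa : Word) → piOp (suc m) a (hw (suc m) c) ≡ just xa
    → (s : Word) → Conn 1 m xa s → IsSourceFor 1 m s
    → (h : Fin m → ℕ) → InBox m s h → piOp m h s ≡ just xa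
    → (Δ : Fin m → ℤ) → (p : Fin m → ℕ) → (∀ i → + (p i) ≡ + (h i) ℤ.+ Δ i)
    → InBox m s p → (v : Word) → piOp m p s ≡ just v
    → (b : Fin (suc m) → ℕ) → (∀ i → b i ≤ c i)
    → (xb : Word) → piOp (suc m) b (hw (suc m) c) ≡ just xb
    → Conn 2 (suc m) v xb
    → ∀ (i : Fin (suc m))
    → + (b i) ≡ + (a i) ℤ.+ (DeltaExt m Δ (suc (toℕ i))) ⁺ ℤ.+ (DeltaExt m Δ (toℕ i)) ⁻
theorem3 (suc m) _ c a a≤c xa πa s xa-s s-source h h-box πh Δ p p≡ p-box v πp b b≤c xb πb v-xb i = begin
  + (b i)                               ≡⟨ cong +_ (trans (sym (extend-toℕ b i)) (proj₂ exponents (toℕ i) (toℕ<n i))) ⟩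
  + (exchanged A P (suc (toℕ i)))       ≡⟨ exchanged-Δ A p Δ Δ-A (extend-beyond a (2 + m) ≤-refl) (toℕ i) (toℕ<n i) ⟩
  + (A (suc (toℕ i))) ℤ.+ Δ⁺ ℤ.+ Δ⁻     ≡⟨ cong (λ t → + t ℤ.+ Δ⁺ ℤ.+ Δ⁻) (extend-toℕ a i) ⟩
  + (a i) ℤ.+ Δ⁺ ℤ.+ Δ⁻                 ∎
  where
  open ≡-Reasoning
  Δ⁺ = (DeltaExt (suc m) Δ (suc (toℕ i))) ⁺
  Δ⁻ = (DeltaExt (suc m) Δ (toℕ i)) ⁻
  A P : ℕ → ℕ
  A = extend a
  P = extend p
  xa≡ = follow (tracks-π (2 + m) a) (hw (2 + m) c) xa πa
  xb≡ = follow (tracks-π (2 + m) b) (hw (2 + m) c) xb πb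
  v≡  = follow (tracks-π (suc m) p) s v πp
  exponents = neighbour-principal m (hw (2 + m) c) (hw-Source (2 + m) c) A P (extend h) (extend b) s
    (extend-bound (2 + m) c a a≤c) (extend-bound (2 + m) c b b≤c) (IsSourceFor-Source s-source)
    (subst (λ x → Conn 1 (suc m) x s) (sym xa≡) xa-s) (InBox-φ {suc m} {s} h h-box)
    (trans (follow (tracks-π (suc m) h) s xa πh) (sym xa≡)) (extend-beyond p (suc m) ≤-refl) (InBox-φ {suc m} {s} p p-box)
    (subst₂ (Conn 2 (2 + m)) (sym v≡) (sym xb≡) v-xb)
  -- The identification h_k = a_{k+1} turns p = h + Δ into a relation between p and a.
  Δ-A : ∀ k → k < suc m → + (P (suc k)) ≡ + (A (2 + k)) ℤ.+ DeltaExt (suc m) Δ (suc k)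
  Δ-A k lt = trans (DeltaExt-extend Δ p h p≡ (suc k)) (cong (λ t → + t ℤ.+ DeltaExt (suc m) Δ (suc k)) (proj₁ exponents k lt))
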